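{- Suppose that $q$ is an odd prime power and $t\ge 3$ is an odd integer. Then the induced subgraph of $\mathrm{AK}(t-1,q)$ on $X_{\boxtimes}/{\sim}$ is a $K_t$-free $(p,\alpha)$-jumbled graph with $p=\Theta\left(n^{ -\frac{1}{t-1}}\right)$ and $\alpha=\Theta(\sqrt{np})$, where $n=|X_{\boxtimes}/{\sim}|$.
   Context: $\mathbb{F}_q$ is the finite field with $q$ elements. For $\mathbf{x},\mathbf{y}\in\mathbb{F}_q^t$ let $\mathbf{x}\cdot\mathbf{y}=\sum_{i=1}^t x_iy_i$. $\mathrm{PG}(t-1,q)$ is the $(t-1)$-dimensional projective space over $\mathbb{F}_q$: the set of classes of nonzero vectors of $\mathbb{F}_q^t$ under the relation $\sim$, where $\mathbf{x}\sim\mathbf{y}$ iff $\mathbf{x}=a\mathbf{y}$ for some nonzero $a\in\mathbb{F}_q$. A vector $\mathbf{x}$ (or its class) is absolute if $\mathbf{x}\cdot\mathbf{x}=0$, and non-square if $\mathbf{x}\cdot\mathbf{x}\ne a^2$ for all $a\in\mathbb{F}_q$; both notions depend only on the class of $\mathbf{x}$. $X_{\boxtimes}=X_{\boxtimes}(t,q)$ is the set of non-square vectors in $\mathbb{F}_q^t$, and $X_{\boxtimes}/{\sim}$ is the set of their classes. $\mathrm{AK}(t-1,q)$ is the graph whose vertices are the non-absolute points of $\mathrm{PG}(t-1,q)$, with two vertices (the classes of $\mathbf{x}$ and $\mathbf{y}$) adjacent iff $\mathbf{x}\cdot\mathbf{y}=0$. For a graph $G$ and $X,Y\subset V(G)$,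 $e(X,Y)$ is the number of edges with one vertex in $X$ and one vertex in $Y$, where edges with both vertices in $X\cap Y$ are counted twice. For real $p\in[0,1]$ and $\alpha\ge 0$, $G$ is $(p,\alpha)$-jumbled if $\left|e(X,Y)-p|X||Y|\right|\le\alpha\sqrt{|X||Y|}$ for all $X,Y\subset V(G)$. $K_t$-free means containing no complete subgraph on $t$ vertices. The constants implied by $\Theta(\cdot)$ are positive and may depend on $t$ but not on $q$. -}

module Defs where

open import Level using (0ℓ)
open import Algebra.Apartness.Bundles using (HeytingField)
open import Algebra.Bundles using (CommutativeRing)
import Algebra.Definitions.RawSemiring as RawSemiringDefs
import Algebra.Properties.Semiring.Sum as Sum
import Algebra.Properties.Ring as RingProperties
open import Data.Fin.Base as Fin using (Fin; finToFun; funToFin)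
open import Data.Fin.Properties as Finₚ using (finToFun-funToFin)
open import Data.Fin.Subset using (Subset; _∩_; ∣_∣)
open import Data.Fin.Subset.Properties using (_∈?_)
import Data.Integer.Base as ℤ
import Data.Integer.Properties as ℤₚ
open import Data.List.Base
  using (List; []; _∷_; length; lookup; filter; map; allFin; cartesianProduct; deduplicate)
open import Data.List.Membership.Propositional.Properties using (∈-allFin)
open import Data.List.Relation.Unary.All using (All; []; _∷_)
open import Data.List.Relation.Unary.AllPairs using ([]; _∷_)
open import Data.List.Relation.Unary.Any as Any using (Any; here; there)
import Data.List.Relation.Unary.Any.Properties as Anyₚ
open Anyₚ using (lookup-index)
open import Data.List.Relation.Unary.Enumerates.Setoid using (IsEnumeration)
open import Data.List.Relation.Unary.Enumerates.Setoid.Properties using (deduplicate⁺)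
open import Data.List.Relation.Unary.Unique.Setoid using (Unique)
open import Data.List.Relation.Unary.Unique.DecSetoid.Properties using (deduplicate-!)
open import Data.Nat.Base as ℕ using (ℕ; zero; suc)
open import Data.Nat.Divisibility using (_∣_)
open import Data.Nat.Primality using (Prime)
import Data.Nat.Properties as ℕₚ
open import Data.Product.Base using (Σ; ∃; ∃₂; _×_; _,_; proj₁; proj₂)
open import Data.Rational.Base as ℚ using (ℚ; 0ℚ; 1ℚ; ½; ↥_; ↧ₙ_; toℚᵘ)
import Data.Rational.Properties as ℚₚ
import Data.Rational.Unnormalised.Base as ℚᵘ
import Data.Rational.Unnormalised.Properties as ℚᵘₚ
open import Data.Rational.Solver using (module +-*-Solver)
open import Data.Sum.Base using (inj₁; inj₂)
open import Data.Vec.Functional using (Vector)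
import Data.Vec.Functional.Relation.Binary.Equality.Setoid as VectorEquality
open import Function.Base using (_on_)
open import Function.Bundles using (Inverse)
open import Relation.Binary.Bundles using (DecSetoid)
import Relation.Binary.Construct.On as On
open import Relation.Binary.Core using (Rel)
open import Relation.Binary.Definitions using (Decidable)
open import Relation.Binary.PropositionalEquality as ≡ using (_≡_; _≢_; refl)
open import Relation.Binary.Structures using (IsEquivalence)
open import Relation.Nullary.Decidable using (Dec; yes; no; ¬?; _×-dec_; _⊎-dec_; map′)
open import Relation.Nullary.Negation using (¬_; contradiction)
import Relation.Unary as U

open RawSemiringDefs ℚ.+-*-rawSemiring
  using () renaming (_^_ to _^ℚ_) public

ι : ℕ → ℚ
ι n = ℤ.+ n ℚ./ 1

-- 1/(n+1)
mesh : ℕ → ℚ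
mesh n = ℤ.+ 1 ℚ./ suc n

module RationalLemmas where

  toℚᵘ-/ : ∀ z d .{{_ : ℕ.NonZero d}} → toℚᵘ (z ℚ./ d) ℚᵘ.≃ (z ℚᵘ./ d)
  toℚᵘ-/ z (suc d) = ℚₚ.toℚᵘ-fromℚᵘ (ℚᵘ.mkℚᵘ z d)

  ι-suc : ∀ n → ι (suc n) ≡ 1ℚ ℚ.+ ι n
  ι-suc n = ℚₚ.toℚᵘ-injective (begin
    toℚᵘ (ι (suc n))               ≈⟨ toℚᵘ-/ (ℤ.+ suc n) 1 ⟩
    ℤ.+ suc n ℚᵘ./ 1               ≈⟨ ℚᵘ.*≡* (≡.cong (λ z → (ℤ.+ 1 ℤ.+ z) ℤ.* ℤ.+ 1) (≡.sym (ℤₚ.*-identityʳ (ℤ.+ n)))) ⟩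
    ℚᵘ.1ℚᵘ ℚᵘ.+ (ℤ.+ n ℚᵘ./ 1)     ≈⟨ ℚᵘₚ.+-congʳ ℚᵘ.1ℚᵘ (toℚᵘ-/ (ℤ.+ n) 1) ⟨
    ℚᵘ.1ℚᵘ ℚᵘ.+ toℚᵘ (ι n)         ≈⟨ ℚₚ.toℚᵘ-homo-+ 1ℚ (ι n) ⟨
    toℚᵘ (1ℚ ℚ.+ ι n)              ∎)
    where open ℚᵘₚ.≃-Reasoning

  ι-+ : ∀ m n → ι (m ℕ.+ n) ≡ ι m ℚ.+ ι n
  ι-+ zero    n = ≡.sym (ℚₚ.+-identityˡ (ι n))
  ι-+ (suc m) n = begin
    ι (suc (m ℕ.+ n))         ≡⟨ ι-suc (m ℕ.+ n) ⟩
    1ℚ ℚ.+ ι (m ℕ.+ n)        ≡⟨ ≡.cong (1ℚ ℚ.+_) (ι-+ m n) ⟩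
    1ℚ ℚ.+ (ι m ℚ.+ ι n)      ≡⟨ ℚₚ.+-assoc 1ℚ (ι m) (ι n) ⟨
    (1ℚ ℚ.+ ι m) ℚ.+ ι n      ≡⟨ ≡.cong (ℚ._+ ι n) (ι-suc m) ⟨
    ι (suc m) ℚ.+ ι n         ∎
    where open ≡.≡-Reasoning

  ι-* : ∀ m n → ι (m ℕ.* n) ≡ ι m ℚ.* ι n
  ι-* zero    n = ≡.sym (ℚₚ.*-zeroˡ (ι n))
  ι-* (suc m) n = begin
    ι (n ℕ.+ m ℕ.* n)             ≡⟨ ι-+ n (m ℕ.* n) ⟩
    ι n ℚ.+ ι (m ℕ.* n)           ≡⟨ ≡.cong₂ ℚ._+_ (≡.sym (ℚₚ.*-identityˡ (ι n))) (ι-* m n) ⟩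
    1ℚ ℚ.* ι n ℚ.+ ι m ℚ.* ι n    ≡⟨ ℚₚ.*-distribʳ-+ (ι n) 1ℚ (ι m) ⟨
    (1ℚ ℚ.+ ι m) ℚ.* ι n          ≡⟨ ≡.cong (ℚ._* ι n) (ι-suc m) ⟨
    ι (suc m) ℚ.* ι n             ∎
    where open ≡.≡-Reasoning

  0<1 : 0ℚ ℚ.< 1ℚ
  0<1 = ℚₚ.positive⁻¹ 1ℚ

  0≤1 : 0ℚ ℚ.≤ 1ℚ
  0≤1 = ℚₚ.<⇒≤ 0<1

  0≤ι : ∀ n → 0ℚ ℚ.≤ ι n
  0≤ι n = ℚₚ.nonNegative⁻¹ (ι n) {{ℚₚ.normalize-nonNeg n 1}}

  0<mesh : ∀ n → 0ℚ ℚ.< mesh n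
  0<mesh n = ℚₚ.positive⁻¹ (mesh n) {{ℚₚ.normalize-pos 1 (suc n)}}

  ι*mesh : ∀ n → ι (suc n) ℚ.* mesh n ≡ 1ℚ
  ι*mesh n = ℚₚ.toℚᵘ-injective (begin
    toℚᵘ (ι (suc n) ℚ.* mesh n)                    ≈⟨ ℚₚ.toℚᵘ-homo-* (ι (suc n)) (mesh n) ⟩
    toℚᵘ (ι (suc n)) ℚᵘ.* toℚᵘ (mesh n)            ≈⟨ ℚᵘₚ.*-cong (toℚᵘ-/ (ℤ.+ suc n) 1) (toℚᵘ-/ (ℤ.+ 1) (suc n)) ⟩
    (ℤ.+ suc n ℚᵘ./ 1) ℚᵘ.* (ℤ.+ 1 ℚᵘ./ suc n)     ≈⟨ ℚᵘ.*≡* (≡.trans (ℤₚ.*-identityʳ _) (≡.trans (ℤₚ.*-identityʳ _) (≡.sym (≡.trans (ℤₚ.*-identityˡ _) (≡.cong ℤ.+_ (ℕₚ.*-identityˡ (suc n))))))) ⟩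
    ℚᵘ.1ℚᵘ                                         ∎)
    where open ℚᵘₚ.≃-Reasoning

  p≤ι∣↥p∣ : ∀ p → p ℚ.≤ ι ℤ.∣ ↥ p ∣
  p≤ι∣↥p∣ p@(ℚ.mkℚ _ _ _) = ℚₚ.toℚᵘ-cancel-≤
    (ℚᵘₚ.≤-trans {toℚᵘ p} {ℤ.+ ℤ.∣ ↥ p ∣ ℚᵘ./ 1} (ℚᵘ.*≤* (go (↥ p) (ℚ.denominator-1 p)))
      (ℚᵘₚ.≤-reflexive (ℚᵘₚ.≃-sym (toℚᵘ-/ (ℤ.+ ℤ.∣ ↥ p ∣) 1))))
    where
    go : ∀ z d → z ℤ.* ℤ.+ 1 ℤ.≤ ℤ.+ ℤ.∣ z ∣ ℤ.* ℤ.+ suc d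
    go (ℤ.+ n)    d = ≡.subst₂ ℤ._≤_ (≡.sym (ℤₚ.*-identityʳ _)) (ℤₚ.pos-* n (suc d)) (ℤ.+≤+ (ℕₚ.m≤m*n n (suc d)))
    go ℤ.-[1+ n ] d = ℤ.-≤+

  mesh≤ : ∀ {e} n → 0ℚ ℚ.< e → ↧ₙ e ℕ.≤ n → mesh n ℚ.≤ e
  mesh≤ {e@(ℚ.mkℚ (ℤ.+ suc a) d _)} n _ d≤n = ℚₚ.toℚᵘ-cancel-≤
    (ℚᵘₚ.≤-trans {toℚᵘ (mesh n)} {ℤ.+ 1 ℚᵘ./ suc n} (ℚᵘₚ.≤-reflexive (toℚᵘ-/ (ℤ.+ 1) (suc n)))
      (ℚᵘ.*≤* (≡.subst₂ ℤ._≤_ (≡.sym (ℤₚ.*-identityˡ _)) (ℤₚ.pos-* (suc a) (suc n))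
        (ℤ.+≤+ (ℕₚ.≤-trans (ℕₚ.≤-trans d≤n (ℕₚ.n≤1+n n)) (ℕₚ.m≤n*m (suc n) (suc a)))))))
  mesh≤ {ℚ.mkℚ (ℤ.+ zero) d _}    n (ℚ.*<* (ℤ.+<+ ())) _
  mesh≤ {ℚ.mkℚ ℤ.-[1+ a ] d _}    n (ℚ.*<* ()) _

  *-mono-≤ : ∀ {a b c d} → 0ℚ ℚ.≤ a → 0ℚ ℚ.≤ c → a ℚ.≤ b → c ℚ.≤ d → a ℚ.* c ℚ.≤ b ℚ.* d
  *-mono-≤ {a} {b} {c} {d} 0≤a 0≤c a≤b c≤d = ℚₚ.≤-trans
    (ℚₚ.*-monoˡ-≤-nonNeg a {{ℚ.nonNegative 0≤a}} c≤d)
    (ℚₚ.*-monoʳ-≤-nonNeg d {{ℚ.nonNegative (ℚₚ.≤-trans 0≤c c≤d)}} a≤b)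

  0≤* : ∀ {a b} → 0ℚ ℚ.≤ a → 0ℚ ℚ.≤ b → 0ℚ ℚ.≤ a ℚ.* b
  0≤* {a} {b} 0≤a 0≤b = ≡.subst (ℚ._≤ a ℚ.* b) (ℚₚ.*-zeroˡ 0ℚ) (*-mono-≤ ℚₚ.≤-refl ℚₚ.≤-refl 0≤a 0≤b)

  0<* : ∀ {a b} → 0ℚ ℚ.< a → 0ℚ ℚ.< b → 0ℚ ℚ.< a ℚ.* b
  0<* {a} {b} 0<a 0<b = ℚₚ.positive⁻¹ (a ℚ.* b)
    {{ℚₚ.pos*pos⇒pos a {{ℚ.positive 0<a}} b {{ℚ.positive 0<b}}}}

  0≤+ : ∀ {a b} → 0ℚ ℚ.≤ a → 0ℚ ℚ.≤ b → 0ℚ ℚ.≤ a ℚ.+ b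
  0≤+ = ℚₚ.+-mono-≤ {0ℚ} {_} {0ℚ}

  0≤^ : ∀ k {a} → 0ℚ ℚ.≤ a → 0ℚ ℚ.≤ a ^ℚ k
  0≤^ zero    0≤a = 0≤1
  0≤^ (suc k) 0≤a = 0≤* 0≤a (0≤^ k 0≤a)

  0<^ : ∀ k {a} → 0ℚ ℚ.< a → 0ℚ ℚ.< a ^ℚ k
  0<^ zero    0<a = 0<1
  0<^ (suc k) 0<a = 0<* 0<a (0<^ k 0<a)

  ^-mono-≤ : ∀ k {a b} → 0ℚ ℚ.≤ a → a ℚ.≤ b → a ^ℚ k ℚ.≤ b ^ℚ k
  ^-mono-≤ zero    0≤a a≤b = ℚₚ.≤-refl
  ^-mono-≤ (suc k) 0≤a a≤b = *-mono-≤ 0≤a (0≤^ k 0≤a) a≤b (^-mono-≤ k 0≤a a≤b)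

  1≤^ : ∀ k {a} → 1ℚ ℚ.≤ a → 1ℚ ℚ.≤ a ^ℚ k
  1≤^ zero    1≤a = ℚₚ.≤-refl
  1≤^ (suc k) {a} 1≤a = ℚₚ.≤-trans 1≤a
    (≡.subst (ℚ._≤ a ℚ.* a ^ℚ k) (ℚₚ.*-identityʳ a)
      (*-mono-≤ (ℚₚ.≤-trans 0≤1 1≤a) 0≤1 ℚₚ.≤-refl (1≤^ k 1≤a)))

  a≤^ : ∀ k {a} → 1ℚ ℚ.≤ a → a ℚ.≤ a ^ℚ suc k
  a≤^ k {a} 1≤a = ≡.subst (ℚ._≤ a ^ℚ suc k) (ℚₚ.*-identityʳ a)
    (*-mono-≤ (ℚₚ.≤-trans 0≤1 1≤a) 0≤1 ℚₚ.≤-refl (1≤^ k 1≤a))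

  ≤-+ʳ : ∀ {a b} → 0ℚ ℚ.≤ b → a ℚ.≤ a ℚ.+ b
  ≤-+ʳ {a} {b} 0≤b = ≡.subst (ℚ._≤ a ℚ.+ b) (ℚₚ.+-identityʳ a) (ℚₚ.+-monoʳ-≤ a 0≤b)

  ^-superadditive : ∀ k {a b} → 0ℚ ℚ.≤ a → 0ℚ ℚ.≤ b →
    a ^ℚ suc k ℚ.+ b ^ℚ suc k ℚ.≤ (a ℚ.+ b) ^ℚ suc k
  ^-superadditive k {a} {b} 0≤a 0≤b =
    ≡.subst (a ^ℚ suc k ℚ.+ b ^ℚ suc k ℚ.≤_) (≡.sym (ℚₚ.*-distribʳ-+ ((a ℚ.+ b) ^ℚ k) a b))
      (ℚₚ.+-mono-≤
        (*-mono-≤ 0≤a (0≤^ k 0≤a) ℚₚ.≤-refl (^-mono-≤ k 0≤a (≤-+ʳ 0≤b)))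
        (*-mono-≤ 0≤b (0≤^ k 0≤b) ℚₚ.≤-refl
          (^-mono-≤ k 0≤b (≡.subst (b ℚ.≤_) (ℚₚ.+-comm b a) (≤-+ʳ 0≤a)))))

  0<½* : ∀ {e} → 0ℚ ℚ.< e → 0ℚ ℚ.< ½ ℚ.* e
  0<½* = 0<* (ℚₚ.positive⁻¹ ½)

  halves : ∀ e → ½ ℚ.* e ℚ.+ ½ ℚ.* e ≡ e
  halves e = ≡.trans (≡.sym (ℚₚ.*-distribʳ-+ e ½ ½)) (ℚₚ.*-identityˡ e)

  ∣∣≤⇒≤ : ∀ {a b e} → ℚ.∣ a ℚ.- b ∣ ℚ.≤ e → a ℚ.≤ b ℚ.+ e
  ∣∣≤⇒≤ {a} {b} {e} h = ≡.subst (ℚ._≤ b ℚ.+ e)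
    (solve 2 (λ a b → b :+ (a :- b) := a) refl a b)
    (ℚₚ.+-monoʳ-≤ b (ℚₚ.≤-trans (p≤∣p∣ (a ℚ.- b)) h))
    where
    open +-*-Solver
    p≤∣p∣ : ∀ p → p ℚ.≤ ℚ.∣ p ∣
    p≤∣p∣ p with ℚₚ.≤-total 0ℚ p
    ... | inj₁ 0≤p = ℚₚ.≤-reflexive (≡.sym (ℚₚ.0≤p⇒∣p∣≡p 0≤p))
    ... | inj₂ p≤0 = ℚₚ.≤-trans p≤0 (ℚₚ.0≤∣p∣ p)

  ≤⇒∣∣≤ : ∀ {a b e} → a ℚ.≤ b ℚ.+ e → b ℚ.≤ a ℚ.+ e → ℚ.∣ a ℚ.- b ∣ ℚ.≤ e
  ≤⇒∣∣≤ {a} {b} {e} a≤ b≤ with ℚₚ.∣p∣≡p∨∣p∣≡-p (a ℚ.- b)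
  ... | inj₁ eq = ≡.subst (ℚ._≤ e) (≡.sym eq)
    (≡.subst (a ℚ.- b ℚ.≤_) (solve 2 (λ b e → b :+ e :- b := e) refl b e) (ℚₚ.+-monoˡ-≤ (ℚ.- b) a≤))
    where open +-*-Solver
  ... | inj₂ eq = ≡.subst (ℚ._≤ e) (≡.sym eq)
    (≡.subst₂ ℚ._≤_ (solve 2 (λ a b → b :- a := :- (a :- b)) refl a b)
      (solve 2 (λ a e → a :+ e :- a := e) refl a e) (ℚₚ.+-monoˡ-≤ (ℚ.- a) b≤))
    where open +-*-Solver

  ∣∣-sym : ∀ a b → ℚ.∣ a ℚ.- b ∣ ≡ ℚ.∣ b ℚ.- a ∣
  ∣∣-sym a b = ≡.trans (≡.sym (ℚₚ.∣-p∣≡∣p∣ (a ℚ.- b)))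
    (≡.cong ℚ.∣_∣ (solve 2 (λ a b → :- (a :- b) := b :- a) refl a b))
    where open +-*-Solver

  ∣∣∣-∣∣∣≤ : ∀ a b → ℚ.∣ ℚ.∣ a ∣ ℚ.- ℚ.∣ b ∣ ∣ ℚ.≤ ℚ.∣ a ℚ.- b ∣
  ∣∣∣-∣∣∣≤ a b = ≤⇒∣∣≤ (half a b) (≡.subst (λ e → ℚ.∣ b ∣ ℚ.≤ ℚ.∣ a ∣ ℚ.+ e) (∣∣-sym b a) (half b a))
    where
    open +-*-Solver
    half : ∀ a b → ℚ.∣ a ∣ ℚ.≤ ℚ.∣ b ∣ ℚ.+ ℚ.∣ a ℚ.- b ∣
    half a b = ≡.subst (λ c → ℚ.∣ c ∣ ℚ.≤ ℚ.∣ b ∣ ℚ.+ ℚ.∣ a ℚ.- b ∣)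
      (solve 2 (λ a b → b :+ (a :- b) := a) refl a b) (ℚₚ.∣p+q∣≤∣p∣+∣q∣ b (a ℚ.- b))

  ∣∣-difference≤ : ∀ {a b c d e} →
    ℚ.∣ a ℚ.- b ∣ ℚ.≤ ½ ℚ.* e → ℚ.∣ c ℚ.- d ∣ ℚ.≤ ½ ℚ.* e →
    ℚ.∣ (a ℚ.- c) ℚ.- (b ℚ.- d) ∣ ℚ.≤ e
  ∣∣-difference≤ {a} {b} {c} {d} {e} hab hcd = begin
    ℚ.∣ (a ℚ.- c) ℚ.- (b ℚ.- d) ∣        ≡⟨ ≡.cong ℚ.∣_∣ (rearrange a b c d) ⟩
    ℚ.∣ (a ℚ.- b) ℚ.- (c ℚ.- d) ∣        ≤⟨ ℚₚ.∣p-q∣≤∣p∣+∣q∣ (a ℚ.- b) (c ℚ.- d) ⟩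
    ℚ.∣ a ℚ.- b ∣ ℚ.+ ℚ.∣ c ℚ.- d ∣      ≤⟨ ℚₚ.+-mono-≤ hab hcd ⟩
    ½ ℚ.* e ℚ.+ ½ ℚ.* e                  ≡⟨ halves e ⟩
    e                                    ∎
    where
    open ℚₚ.≤-Reasoning
    rearrange : ∀ a b c d → (a ℚ.- c) ℚ.- (b ℚ.- d) ≡ (a ℚ.- b) ℚ.- (c ℚ.- d)
    rearrange = solve 4 (λ a b c d → (a :- c) :- (b :- d) := (a :- b) :- (c :- d)) refl
      where open +-*-Solver

  ∣∣-*≤ : ∀ {c d C D} → ℚ.∣ c ∣ ℚ.≤ C → ℚ.∣ d ∣ ℚ.≤ D → ℚ.∣ c ℚ.* d ∣ ℚ.≤ C ℚ.* D
  ∣∣-*≤ {c} {d} {C} {D} c≤C d≤D = ≡.subst (ℚ._≤ C ℚ.* D) (≡.sym (ℚₚ.∣p*q∣≡∣p∣*∣q∣ c d))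
    (*-mono-≤ (ℚₚ.0≤∣p∣ c) (ℚₚ.0≤∣p∣ d) c≤C d≤D)

  ∣∣-product≤ : ∀ {a a′ b b′ A B η ε} → A ℚ.* η ℚ.+ η ℚ.* B ≡ ε →
    ℚ.∣ a ∣ ℚ.≤ A → ℚ.∣ b′ ∣ ℚ.≤ B → ℚ.∣ a ℚ.- a′ ∣ ℚ.≤ η → ℚ.∣ b ℚ.- b′ ∣ ℚ.≤ η →
    ℚ.∣ a ℚ.* b ℚ.- a′ ℚ.* b′ ∣ ℚ.≤ ε
  ∣∣-product≤ {a} {a′} {b} {b′} {A} {B} {η} {ε} eq a≤ b′≤ a-a′≤ b-b′≤ = begin
    ℚ.∣ a ℚ.* b ℚ.- a′ ℚ.* b′ ∣
      ≡⟨ ≡.cong ℚ.∣_∣ (split a a′ b b′) ⟩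
    ℚ.∣ a ℚ.* (b ℚ.- b′) ℚ.+ (a ℚ.- a′) ℚ.* b′ ∣
      ≤⟨ ℚₚ.∣p+q∣≤∣p∣+∣q∣ (a ℚ.* (b ℚ.- b′)) ((a ℚ.- a′) ℚ.* b′) ⟩
    ℚ.∣ a ℚ.* (b ℚ.- b′) ∣ ℚ.+ ℚ.∣ (a ℚ.- a′) ℚ.* b′ ∣
      ≤⟨ ℚₚ.+-mono-≤ (∣∣-*≤ {a} {b ℚ.- b′} a≤ b-b′≤) (∣∣-*≤ {a ℚ.- a′} {b′} a-a′≤ b′≤) ⟩
    A ℚ.* η ℚ.+ η ℚ.* B
      ≡⟨ eq ⟩
    ε ∎
    where
    open ℚₚ.≤-Reasoning
    split : ∀ a a′ b b′ → a ℚ.* b ℚ.- a′ ℚ.* b′ ≡ a ℚ.* (b ℚ.- b′) ℚ.+ (a ℚ.- a′) ℚ.* b′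
    split = solve 4 (λ a a′ b b′ →
      a :* b :- a′ :* b′ := a :* (b :- b′) :+ (a :- a′) :* b′) refl
      where open +-*-Solver

  factor : ∀ A B r ε → A ℚ.* (r ℚ.* ε) ℚ.+ (r ℚ.* ε) ℚ.* B ≡ (A ℚ.+ B) ℚ.* r ℚ.* ε
  factor = solve 4 (λ A B r ε → A :* (r :* ε) :+ (r :* ε) :* B := (A :+ B) :* r :* ε) refl
    where open +-*-Solver

  roots-close : ∀ k {r r′ δ e a a′} → 0ℚ ℚ.≤ r → 0ℚ ℚ.≤ δ → 0ℚ ℚ.≤ e → δ ℚ.≤ e →
    a ℚ.< (r ℚ.+ δ) ^ℚ suc k → r′ ^ℚ suc k ℚ.≤ a′ → a′ ℚ.≤ a ℚ.+ e ^ℚ suc k →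
    r′ ℚ.≤ (r ℚ.+ e) ℚ.+ e
  roots-close k {r} {r′} {δ} {e} {a} {a′} 0≤r 0≤δ 0≤e δ≤e a< r′≤ a′≤ with r′ ℚₚ.≤? (r ℚ.+ e) ℚ.+ e
  ... | yes h = h
  ... | no  h = contradiction a+η<a+η (ℚₚ.<-irrefl {a ℚ.+ e ^ℚ suc k} refl)
    where
    open ℚₚ.≤-Reasoning
    0≤r+δ : 0ℚ ℚ.≤ r ℚ.+ δ
    0≤r+δ = 0≤+ {r} {δ} 0≤r 0≤δ
    r+δ+e≤r′ : (r ℚ.+ δ) ℚ.+ e ℚ.≤ r′
    r+δ+e≤r′ = begin
      (r ℚ.+ δ) ℚ.+ e  ≤⟨ ℚₚ.+-monoˡ-≤ e {r ℚ.+ δ} {r ℚ.+ e} (ℚₚ.+-monoʳ-≤ r δ≤e) ⟩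
      (r ℚ.+ e) ℚ.+ e  ≤⟨ ℚₚ.<⇒≤ (ℚₚ.≰⇒> h) ⟩
      r′               ∎
    a+η<a+η : a ℚ.+ e ^ℚ suc k ℚ.< a ℚ.+ e ^ℚ suc k
    a+η<a+η = begin-strict
      a ℚ.+ e ^ℚ suc k                   <⟨ ℚₚ.+-monoˡ-< (e ^ℚ suc k) {a} {(r ℚ.+ δ) ^ℚ suc k} a< ⟩
      (r ℚ.+ δ) ^ℚ suc k ℚ.+ e ^ℚ suc k  ≤⟨ ^-superadditive k {r ℚ.+ δ} {e} 0≤r+δ 0≤e ⟩
      ((r ℚ.+ δ) ℚ.+ e) ^ℚ suc k         ≤⟨ ^-mono-≤ (suc k) {(r ℚ.+ δ) ℚ.+ e} {r′} (0≤+ {r ℚ.+ δ} {e} 0≤r+δ 0≤e) r+δ+e≤r′ ⟩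
      r′ ^ℚ suc k                        ≤⟨ r′≤ ⟩
      a′                                 ≤⟨ a′≤ ⟩
      a ℚ.+ e ^ℚ suc k                   ∎

  +½+½ : ∀ r ε → (r ℚ.+ ½ ℚ.* ε) ℚ.+ ½ ℚ.* ε ≡ r ℚ.+ ε
  +½+½ r ε = ≡.trans (ℚₚ.+-assoc r (½ ℚ.* ε) (½ ℚ.* ε)) (≡.cong (r ℚ.+_) (halves ε))

  ⊔0-close : ∀ {x y η} → 0ℚ ℚ.< η → ℚ.∣ x ℚ.- y ∣ ℚ.≤ η → x ℚ.⊔ 0ℚ ℚ.≤ y ℚ.⊔ 0ℚ ℚ.+ η
  ⊔0-close {x} {y} {η} 0<η h = ℚₚ.⊔-lub {y ℚ.⊔ 0ℚ ℚ.+ η} {x} {0ℚ}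
    (ℚₚ.≤-trans {x} {y ℚ.+ η} {y ℚ.⊔ 0ℚ ℚ.+ η} (∣∣≤⇒≤ {x} {y} {η} h) (ℚₚ.+-monoˡ-≤ η {y} {y ℚ.⊔ 0ℚ} (ℚₚ.p≤p⊔q y 0ℚ)))
    (0≤+ {y ℚ.⊔ 0ℚ} {η} (ℚₚ.p≤q⊔p y 0ℚ) (ℚₚ.<⇒≤ 0<η))

open RationalLemmas

-- Reals are Cauchy sequences of rationals; equality is _≤ᴿ_ in both directions.
record ℝ : Set where
  field
    seq    : ℕ → ℚ
    cauchy : ∀ ε → 0ℚ ℚ.< ε →
             ∃ λ N → ∀ m n → N ℕ.≤ m → N ℕ.≤ n → ℚ.∣ seq m ℚ.- seq n ∣ ℚ.≤ ε

open ℝ public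

infix  4 _≤ᴿ_ _<ᴿ_
infixl 6 _-ᴿ_
infixl 7 _*ᴿ_

_≤ᴿ_ : Rel ℝ 0ℓ
x ≤ᴿ y = ∀ ε → 0ℚ ℚ.< ε → ∃ λ N → ∀ n → N ℕ.≤ n → seq x n ℚ.≤ seq y n ℚ.+ ε

_<ᴿ_ : Rel ℝ 0ℓ
x <ᴿ y = ∃ λ ε → 0ℚ ℚ.< ε × ∃ λ N → ∀ n → N ℕ.≤ n → seq x n ℚ.+ ε ℚ.≤ seq y n

fromℚ : ℚ → ℝ
fromℚ a = record
  { seq    = λ _ → a
  ; cauchy = λ ε 0<ε → 0 , λ _ _ _ _ →
      ≡.subst (ℚ._≤ ε) (≡.sym (≡.cong ℚ.∣_∣ (ℚₚ.+-inverseʳ a))) (ℚₚ.<⇒≤ 0<ε)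
  }

fromℕ : ℕ → ℝ
fromℕ n = fromℚ (ι n)

0ᴿ 1ᴿ : ℝ
0ᴿ = fromℚ 0ℚ
1ᴿ = fromℚ 1ℚ

_-ᴿ_ : ℝ → ℝ → ℝ
x -ᴿ y = record { seq = λ n → seq x n ℚ.- seq y n ; cauchy = bound }
  where
  bound : ∀ ε → 0ℚ ℚ.< ε → ∃ λ N → ∀ m n → N ℕ.≤ m → N ℕ.≤ n →
    ℚ.∣ (seq x m ℚ.- seq y m) ℚ.- (seq x n ℚ.- seq y n) ∣ ℚ.≤ ε
  bound ε 0<ε = M ℕ.⊔ N , λ m n h h′ →
    ∣∣-difference≤ {seq x m} {seq x n} {seq y m} {seq y n} {ε}
      (proj₂ hx m n (ℕₚ.m⊔n≤o⇒m≤o M N h) (ℕₚ.m⊔n≤o⇒m≤o M N h′))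
      (proj₂ hy m n (ℕₚ.m⊔n≤o⇒n≤o M N h) (ℕₚ.m⊔n≤o⇒n≤o M N h′))
    where
    hx = cauchy x (½ ℚ.* ε) (0<½* 0<ε)
    hy = cauchy y (½ ℚ.* ε) (0<½* 0<ε)
    M = proj₁ hx
    N = proj₁ hy

_*ᴿ_ : ℝ → ℝ → ℝ
x *ᴿ y = record { seq = λ n → seq x n ℚ.* seq y n ; cauchy = bound }
  where
  eventuallyBounded : (z : ℝ) → ∃₂ λ N A → 0ℚ ℚ.< A × (∀ n → N ℕ.≤ n → ℚ.∣ seq z n ∣ ℚ.≤ A)
  eventuallyBounded z = N , ℚ.∣ seq z N ∣ ℚ.+ 1ℚ
    , ℚₚ.+-mono-≤-< (ℚₚ.0≤∣p∣ (seq z N)) 0<1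
    , λ n N≤n → ∣∣≤⇒≤ {ℚ.∣ seq z n ∣} {ℚ.∣ seq z N ∣} {1ℚ}
        (ℚₚ.≤-trans (∣∣∣-∣∣∣≤ (seq z n) (seq z N)) (proj₂ (cauchy z 1ℚ 0<1) n N N≤n ℕₚ.≤-refl))
    where N = proj₁ (cauchy z 1ℚ 0<1)

  bound : ∀ ε → 0ℚ ℚ.< ε → ∃ λ N → ∀ m n → N ℕ.≤ m → N ℕ.≤ n →
    ℚ.∣ seq x m ℚ.* seq y m ℚ.- seq x n ℚ.* seq y n ∣ ℚ.≤ ε
  bound ε 0<ε = P , λ m n P≤m P≤n →
    ∣∣-product≤ {seq x m} {seq x n} {seq y m} {seq y n} {A} {B} {η} Aη+ηB≡ε
      (x≤A m (M≤ P≤m)) (y≤B n (N≤ P≤n))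
      (proj₂ hx m n (R≤ P≤m) (R≤ P≤n)) (proj₂ hy m n (Q≤ P≤m) (Q≤ P≤n))
    where
    M = proj₁ (eventuallyBounded x)
    A = proj₁ (proj₂ (eventuallyBounded x))
    0<A = proj₁ (proj₂ (proj₂ (eventuallyBounded x)))
    x≤A = proj₂ (proj₂ (proj₂ (eventuallyBounded x)))
    N = proj₁ (eventuallyBounded y)
    B = proj₁ (proj₂ (eventuallyBounded y))
    0<B = proj₁ (proj₂ (proj₂ (eventuallyBounded y)))
    y≤B = proj₂ (proj₂ (proj₂ (eventuallyBounded y)))
    0<A+B : 0ℚ ℚ.< A ℚ.+ B
    0<A+B = ℚₚ.+-mono-< 0<A 0<B
    instance
      A+B-pos : ℚ.Positive (A ℚ.+ B)
      A+B-pos = ℚ.positive 0<A+B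
      A+B-nonZero : ℚ.NonZero (A ℚ.+ B)
      A+B-nonZero = ℚₚ.pos⇒nonZero (A ℚ.+ B)
    η : ℚ
    η = ℚ.1/ (A ℚ.+ B) ℚ.* ε
    0<η : 0ℚ ℚ.< η
    0<η = 0<* (ℚₚ.positive⁻¹ (ℚ.1/ (A ℚ.+ B)) {{ℚₚ.1/pos⇒pos (A ℚ.+ B)}}) 0<ε
    hx = cauchy x η 0<η
    hy = cauchy y η 0<η
    P = (M ℕ.⊔ N) ℕ.⊔ (proj₁ hx ℕ.⊔ proj₁ hy)
    MN≤ : ∀ {m} → P ℕ.≤ m → M ℕ.⊔ N ℕ.≤ m
    MN≤ = ℕₚ.m⊔n≤o⇒m≤o (M ℕ.⊔ N) (proj₁ hx ℕ.⊔ proj₁ hy)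
    RQ≤ : ∀ {m} → P ℕ.≤ m → proj₁ hx ℕ.⊔ proj₁ hy ℕ.≤ m
    RQ≤ = ℕₚ.m⊔n≤o⇒n≤o (M ℕ.⊔ N) (proj₁ hx ℕ.⊔ proj₁ hy)
    M≤ : ∀ {m} → P ℕ.≤ m → M ℕ.≤ m
    M≤ h = ℕₚ.m⊔n≤o⇒m≤o M N (MN≤ h)
    N≤ : ∀ {m} → P ℕ.≤ m → N ℕ.≤ m
    N≤ h = ℕₚ.m⊔n≤o⇒n≤o M N (MN≤ h)
    R≤ : ∀ {m} → P ℕ.≤ m → proj₁ hx ℕ.≤ m
    R≤ h = ℕₚ.m⊔n≤o⇒m≤o (proj₁ hx) (proj₁ hy) (RQ≤ h)
    Q≤ : ∀ {m} → P ℕ.≤ m → proj₁ hy ℕ.≤ m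
    Q≤ h = ℕₚ.m⊔n≤o⇒n≤o (proj₁ hx) (proj₁ hy) (RQ≤ h)
    Aη+ηB≡ε : A ℚ.* η ℚ.+ η ℚ.* B ≡ ε
    Aη+ηB≡ε = begin
      A ℚ.* η ℚ.+ η ℚ.* B                   ≡⟨ factor A B (ℚ.1/ (A ℚ.+ B)) ε ⟩
      (A ℚ.+ B) ℚ.* ℚ.1/ (A ℚ.+ B) ℚ.* ε    ≡⟨ ≡.cong (ℚ._* ε) (ℚₚ.*-inverseʳ (A ℚ.+ B)) ⟩
      1ℚ ℚ.* ε                              ≡⟨ ℚₚ.*-identityˡ ε ⟩
      ε                                     ∎
      where open ≡.≡-Reasoning

absᴿ : ℝ → ℝ
absᴿ x = record
  { seq    = λ n → ℚ.∣ seq x n ∣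
  ; cauchy = λ ε 0<ε → let (N , hx) = cauchy x ε 0<ε in
      N , λ m n N≤m N≤n → ℚₚ.≤-trans (∣∣∣-∣∣∣≤ (seq x m) (seq x n)) (hx m n N≤m N≤n)
  }

-- The largest of 0, δ, 2δ, …, Bδ whose k-th power is at most a
-- (0 if there is none).
gridRoot : ℕ → ℚ → ℚ → ℕ → ℚ
gridRoot k δ a zero    = 0ℚ
gridRoot k δ a (suc B) with (ι (suc B) ℚ.* δ) ^ℚ k ℚₚ.≤? a
... | yes _ = ι (suc B) ℚ.* δ
... | no  _ = gridRoot k δ a B

-- approxRoot k a n ≤ a^(1/k) < approxRoot k a n + 1/(n+1) for a ≥ 0 and k ≥ 1:
-- the search bound B = (∣↥a∣ + 1)(n + 1) is large enough since a < ∣↥a∣ + 1.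
approxRoot : ℕ → ℚ → ℕ → ℚ
approxRoot k a n = gridRoot k (mesh n) a (suc ℤ.∣ ↥ a ∣ ℕ.* suc n)

module _ (k : ℕ) where

  gridRoot-nonNeg : ∀ {δ} a B → 0ℚ ℚ.≤ δ → 0ℚ ℚ.≤ gridRoot k δ a B
  gridRoot-nonNeg a zero    0≤δ = ℚₚ.≤-refl
  gridRoot-nonNeg {δ} a (suc B) 0≤δ with (ι (suc B) ℚ.* δ) ^ℚ k ℚₚ.≤? a
  ... | yes _ = 0≤* (0≤ι (suc B)) 0≤δ
  ... | no  _ = gridRoot-nonNeg a B 0≤δ

  approxRoot-nonNeg : ∀ a n → 0ℚ ℚ.≤ approxRoot k a n
  approxRoot-nonNeg a n =
    gridRoot-nonNeg a (suc ℤ.∣ ↥ a ∣ ℕ.* suc n) (ℚₚ.<⇒≤ (0<mesh n))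

module _ (k : ℕ) where

  gridRoot-lower : ∀ {δ a} B → 0ℚ ℚ.≤ a → gridRoot (suc k) δ a B ^ℚ suc k ℚ.≤ a
  gridRoot-lower {a = a} zero 0≤a = ≡.subst (ℚ._≤ a) (≡.sym (ℚₚ.*-zeroˡ (0ℚ ^ℚ k))) 0≤a
  gridRoot-lower {δ} {a} (suc B) 0≤a with (ι (suc B) ℚ.* δ) ^ℚ suc k ℚₚ.≤? a
  ... | yes h = h
  ... | no  _ = gridRoot-lower B 0≤a

  approxRoot-lower : ∀ a n → 0ℚ ℚ.≤ a → approxRoot (suc k) a n ^ℚ suc k ℚ.≤ a
  approxRoot-lower a n = gridRoot-lower (suc ℤ.∣ ↥ a ∣ ℕ.* suc n)

  ι-suc-* : ∀ B δ → ι (suc B) ℚ.* δ ≡ ι B ℚ.* δ ℚ.+ δ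
  ι-suc-* B δ = ≡.trans (≡.cong (ℚ._* δ) (ι-suc B))
    (solve 2 (λ b d → (con 1ℚ :+ b) :* d := b :* d :+ d) refl (ι B) δ)
    where open +-*-Solver

  gridRoot-upper : ∀ {δ a} B → a ℚ.< (ι (suc B) ℚ.* δ) ^ℚ suc k →
    a ℚ.< (gridRoot (suc k) δ a B ℚ.+ δ) ^ℚ suc k
  gridRoot-upper {δ} {a} zero a< =
    ≡.subst (λ c → a ℚ.< c ^ℚ suc k) (≡.trans (ℚₚ.*-identityˡ δ) (≡.sym (ℚₚ.+-identityˡ δ))) a<
  gridRoot-upper {δ} {a} (suc B) a< with (ι (suc B) ℚ.* δ) ^ℚ suc k ℚₚ.≤? a
  ... | yes _ = ≡.subst (λ c → a ℚ.< c ^ℚ suc k) (ι-suc-* (suc B) δ) a<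
  ... | no ≰a = gridRoot-upper B (ℚₚ.≰⇒> ≰a)

  approxRoot-upper : ∀ a n → a ℚ.< (approxRoot (suc k) a n ℚ.+ mesh n) ^ℚ suc k
  approxRoot-upper a n = gridRoot-upper (suc A ℕ.* suc n)
    (ℚₚ.<-≤-trans a<ιA+1 (ℚₚ.≤-trans ιA+1≤ (a≤^ k 1≤)))
    where
    A = ℤ.∣ ↥ a ∣
    a<ιA+1 : a ℚ.< ι (suc A)
    a<ιA+1 = ℚₚ.≤-<-trans (p≤ι∣↥p∣ a)
      (≡.subst₂ ℚ._<_ (ℚₚ.+-identityˡ (ι A)) (≡.sym (ι-suc A)) (ℚₚ.+-monoˡ-< (ι A) 0<1))
    ιA+1≤ : ι (suc A) ℚ.≤ ι (suc (suc A ℕ.* suc n)) ℚ.* mesh n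
    ιA+1≤ = ≡.subst₂ ℚ._≤_ eq (≡.sym (ι-suc-* (suc A ℕ.* suc n) (mesh n)))
      (≤-+ʳ (ℚₚ.<⇒≤ (0<mesh n)))
      where
      eq : ι (suc A ℕ.* suc n) ℚ.* mesh n ≡ ι (suc A)
      eq = begin
        ι (suc A ℕ.* suc n) ℚ.* mesh n           ≡⟨ ≡.cong (ℚ._* mesh n) (ι-* (suc A) (suc n)) ⟩
        ι (suc A) ℚ.* ι (suc n) ℚ.* mesh n       ≡⟨ ℚₚ.*-assoc (ι (suc A)) (ι (suc n)) (mesh n) ⟩
        ι (suc A) ℚ.* (ι (suc n) ℚ.* mesh n)     ≡⟨ ≡.cong (ι (suc A) ℚ.*_) (ι*mesh n) ⟩
        ι (suc A) ℚ.* 1ℚ                         ≡⟨ ℚₚ.*-identityʳ (ι (suc A)) ⟩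
        ι (suc A)                                ∎
        where open ≡.≡-Reasoning
    1≤ : 1ℚ ℚ.≤ ι (suc (suc A ℕ.* suc n)) ℚ.* mesh n
    1≤ = ℚₚ.≤-trans (≡.subst (1ℚ ℚ.≤_) (≡.sym (ι-suc A)) (≤-+ʳ (0≤ι A))) ιA+1≤

-- root k x = x^(1/k) for x ≥ 0 and k ≥ 1.  Negative arguments have root 0,
-- and root 0 is the constant 0.
root : ℕ → ℝ → ℝ
root zero    x = 0ᴿ
root (suc k) x = record { seq = r ; cauchy = bound }
  where
  a : ℕ → ℚ
  a n = seq x n ℚ.⊔ 0ℚ
  r : ℕ → ℚ
  r n = approxRoot (suc k) (a n) n

  bound : ∀ ε → 0ℚ ℚ.< ε → ∃ λ N → ∀ m n → N ℕ.≤ m → N ℕ.≤ n → ℚ.∣ r m ℚ.- r n ∣ ℚ.≤ ε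
  bound ε 0<ε = N ℕ.⊔ D , λ m n h h′ →
    ≤⇒∣∣≤ {r m} {r n} {ε} (half m n (N≤ h) (N≤ h′) (D≤ h′)) (half n m (N≤ h′) (N≤ h) (D≤ h))
    where
    e : ℚ
    e = ½ ℚ.* ε
    0<e : 0ℚ ℚ.< e
    0<e = 0<½* 0<ε
    0<η : 0ℚ ℚ.< e ^ℚ suc k
    0<η = 0<^ (suc k) {e} 0<e
    hx = cauchy x (e ^ℚ suc k) 0<η
    N = proj₁ hx
    D = ↧ₙ e
    N≤ : ∀ {m} → N ℕ.⊔ D ℕ.≤ m → N ℕ.≤ m
    N≤ = ℕₚ.m⊔n≤o⇒m≤o N D
    D≤ : ∀ {m} → N ℕ.⊔ D ℕ.≤ m → D ℕ.≤ m
    D≤ = ℕₚ.m⊔n≤o⇒n≤o N D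
    half : ∀ m n → N ℕ.≤ m → N ℕ.≤ n → D ℕ.≤ n → r m ℚ.≤ r n ℚ.+ ε
    half m n N≤m N≤n D≤n = ≡.subst (r m ℚ.≤_) (+½+½ (r n) ε)
      (roots-close k {r n} {r m} {mesh n} {e} {a n} {a m}
        (approxRoot-nonNeg (suc k) (a n) n) (ℚₚ.<⇒≤ (0<mesh n)) (ℚₚ.<⇒≤ 0<e) (mesh≤ {e} n 0<e D≤n)
        (approxRoot-upper k (a n) n)
        (approxRoot-lower k (a m) m (ℚₚ.p≤q⊔p (seq x m) 0ℚ))
        (⊔0-close {seq x m} {seq x n} 0<η (proj₂ hx m n N≤m N≤n)))

√ : ℝ → ℝ
√ = root 2

infix 4 _=Θ_

_=Θ_ : ∀ {i} {I : Set i} → (I → ℝ) → (I → ℝ) → Set i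
f =Θ g = ∃₂ λ c C → 0ᴿ <ᴿ c × 0ᴿ <ᴿ C × (∀ i → c *ᴿ g i ≤ᴿ f i × f i ≤ᴿ C *ᴿ g i)

-- n^(-1/k), with the convention 0^(-1/k) = 0
_^-1/_ : ℕ → ℕ → ℝ
zero  ^-1/ k = 0ᴿ
suc n ^-1/ k = root k (fromℚ (mesh n))

-- Presented as setoids, so that quotients exist; elements may have repetitions.
record FiniteSet : Set₁ where
  field
    decSetoid  : DecSetoid 0ℓ 0ℓ
    elements   : List (DecSetoid.Carrier decSetoid)
    enumerates : IsEnumeration (DecSetoid.setoid decSetoid) elements

  open DecSetoid decSetoid public using (Carrier; _≈_; _≟_; setoid)

  representatives : List Carrier
  representatives = deduplicate _≟_ elements

  card : ℕ
  card = length representatives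

  nth : Fin card → Carrier
  nth = lookup representatives

  index : Carrier → Fin card
  index x = Any.index (deduplicate⁺ decSetoid enumerates x)

  nth-index : ∀ x → x ≈ nth (index x)
  nth-index x = lookup-index (deduplicate⁺ decSetoid enumerates x)

  nth-injective : ∀ {i j} → nth i ≈ nth j → i ≡ j
  nth-injective = go (deduplicate-! decSetoid elements) _ _
    where
    open DecSetoid decSetoid using (sym)
    All-lookup : ∀ {P : U.Pred Carrier 0ℓ} {xs} → All P xs → ∀ i → P (lookup xs i)
    All-lookup (px ∷ _)   Fin.zero    = px
    All-lookup (_  ∷ pxs) (Fin.suc i) = All-lookup pxs i
    go : ∀ {xs} → Unique setoid xs → ∀ i j → lookup xs i ≈ lookup xs j → i ≡ j
    go (_  ∷ _)   Fin.zero    Fin.zero    _  = refl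
    go (x∉ ∷ _)   Fin.zero    (Fin.suc j) eq = contradiction eq (All-lookup x∉ j)
    go (x∉ ∷ _)   (Fin.suc i) Fin.zero    eq = contradiction (sym eq) (All-lookup x∉ i)
    go (_  ∷ xs!) (Fin.suc i) (Fin.suc j) eq = ≡.cong Fin.suc (go xs! i j eq)

  numbering : Inverse setoid (≡.setoid (Fin card))
  numbering = record
    { to        = index
    ; from      = nth
    ; to-cong   = λ {x} {y} x≈y → nth-injective (trans (sym (nth-index x)) (trans x≈y (nth-index y)))
    ; from-cong = λ { refl → DecSetoid.refl decSetoid }
    ; inverse   = (λ {i} {x} x≈i → nth-injective (trans (sym (nth-index x)) x≈i))
                , (λ { {x} refl → sym (nth-index x) })
    }
    where open DecSetoid decSetoid using (sym; trans)

module _ (S : FiniteSet) where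
  open FiniteSet S

  subset : {P : U.Pred Carrier 0ℓ} → U.Decidable P → (∀ {x y} → x ≈ y → P x → P y) → FiniteSet
  subset {P} P? P-resp = record
    { decSetoid  = On.decSetoid decSetoid (proj₁ {B = P})
    ; elements   = restrict elements
    ; enumerates = λ (x , px) → restrict-∈ px (enumerates x)
    }
    where
    restrict : List Carrier → List (Σ Carrier P)
    restrict []       = []
    restrict (x ∷ xs) with P? x
    ... | yes px = (x , px) ∷ restrict xs
    ... | no  _  = restrict xs
    restrict-∈ : ∀ {x xs} → P x → Any (x ≈_) xs → Any (λ y → x ≈ proj₁ y) (restrict xs)
    restrict-∈ {xs = y ∷ _} px (here x≈y) with P? y
    ... | yes _   = here x≈y
    ... | no  ¬py = contradiction (P-resp x≈y px) ¬py
    restrict-∈ {xs = y ∷ _} px (there x∈) with P? y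
    ... | yes _   = there (restrict-∈ px x∈)
    ... | no  _   = restrict-∈ px x∈

  quotient : {_∼_ : Rel Carrier 0ℓ} → IsEquivalence _∼_ → Decidable _∼_ →
             (∀ {x y} → x ≈ y → x ∼ y) → FiniteSet
  quotient ∼-equiv _∼?_ ≈⇒∼ = record
    { decSetoid  = record { isDecEquivalence = record { isEquivalence = ∼-equiv ; _≟_ = _∼?_ } }
    ; elements   = elements
    ; enumerates = λ x → Any.map ≈⇒∼ (enumerates x)
    }

record Graph : Set₁ where
  field
    vertices   : FiniteSet
  open FiniteSet vertices public
    renaming (Carrier to Vertex; card to order; nth to vertex) using (_≈_)
  field
    Adjacent   : Rel Vertex 0ℓ
    adjacent?  : Decidable Adjacent
    adj-resp   : ∀ {u u′ v v′} → u ≈ u′ → v ≈ v′ → Adjacent u v → Adjacent u′ v′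
    adj-sym    : ∀ {u v} → Adjacent u v → Adjacent v u
    adj-irrefl : ∀ {v} → ¬ Adjacent v v

module _ (G : Graph) where
  open Graph G

  inducedSubgraph : {P : U.Pred Vertex 0ℓ} → U.Decidable P →
                    (∀ {u v} → u ≈ v → P u → P v) → Graph
  inducedSubgraph P? P-resp = record
    { vertices   = subset vertices P? P-resp
    ; Adjacent   = Adjacent on proj₁
    ; adjacent?  = λ u v → adjacent? (proj₁ u) (proj₁ v)
    ; adj-resp   = adj-resp
    ; adj-sym    = adj-sym
    ; adj-irrefl = adj-irrefl
    }

  -- The chosen vertices are automatically distinct since adjacency is irreflexive.
  CompleteFree : ℕ → Set
  CompleteFree r = ¬ ∃ λ (f : Fin r → Vertex) → ∀ i j → i ≢ j → Adjacent (f i) (f j)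

  -- Each edge is listed once, by its pair of vertex numbers in increasing order.
  edges : List (Fin order × Fin order)
  edges = filter (λ (i , j) → (i Finₚ.<? j) ×-dec adjacent? (vertex i) (vertex j))
            (cartesianProduct (allFin order) (allFin order))

  -- The second summand counts the edges inside X ∩ Y a second time.
  edgeCount : Subset order → Subset order → ℕ
  edgeCount X Y =
    length (filter (λ (i , j) → ((i ∈? X) ×-dec (j ∈? Y)) ⊎-dec ((j ∈? X) ×-dec (i ∈? Y))) edges)
    ℕ.+ length (filter (λ (i , j) → (i ∈? (X ∩ Y)) ×-dec (j ∈? (X ∩ Y))) edges)

  Jumbled : ℝ → ℝ → Set
  Jumbled p α =
    0ᴿ ≤ᴿ p × p ≤ᴿ 1ᴿ × 0ᴿ ≤ᴿ α ×
    (∀ (X Y : Subset order) →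
      absᴿ (fromℕ (edgeCount X Y) -ᴿ p *ᴿ fromℕ ∣ X ∣ *ᴿ fromℕ ∣ Y ∣)
        ≤ᴿ α *ᴿ √ (fromℕ ∣ X ∣ *ᴿ fromℕ ∣ Y ∣))

-- For a finite carrier, _≈_ is decidable and the apartness relation of a
-- Heyting field is necessarily its complement.
record FiniteField (q : ℕ) : Set₁ where
  field
    heytingField : HeytingField 0ℓ 0ℓ 0ℓ

  commutativeRing : CommutativeRing 0ℓ 0ℓ
  commutativeRing = record { isCommutativeRing = HeytingField.isCommutativeRing heytingField }

  open CommutativeRing commutativeRing public
  open HeytingField heytingField public using (_#_; #⇒invertible; invertible⇒#; tight)

  field
    numbering : Inverse setoid (≡.setoid (Fin q))

  finite : FiniteSet
  finite = record
    { decSetoid  = record { isDecEquivalence = record { isEquivalence = isEquivalence ; _≟_ = dec } }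
    ; elements   = map (Inverse.from numbering) (allFin q)
    ; enumerates = λ x → Anyₚ.map⁺ (Any.map
        (λ { refl → sym (Inverse.strictlyInverseʳ numbering x) }) (∈-allFin (Inverse.to numbering x)))
    }
    where
    dec : Decidable _≈_
    dec x y = map′
      (λ eq → trans (sym (Inverse.strictlyInverseʳ numbering x))
        (trans (Inverse.from-cong numbering eq) (Inverse.strictlyInverseʳ numbering y)))
      (Inverse.to-cong numbering)
      (Inverse.to numbering x Finₚ.≟ Inverse.to numbering y)

  infix 4 _≟_
  _≟_ : Decidable _≈_
  _≟_ = FiniteSet._≟_ finite

  ∃? : {P : U.Pred Carrier 0ℓ} → U.Decidable P → (∀ {x y} → x ≈ y → P x → P y) → Dec (∃ P)
  ∃? P? P-resp = map′
    (λ (i , pi) → Inverse.from numbering i , pi)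
    (λ (x , px) → Inverse.to numbering x , P-resp (sym (Inverse.strictlyInverseʳ numbering x)) px)
    (Finₚ.any? (λ i → P? (Inverse.from numbering i)))

  1≉0 : ¬ 1# ≈ 0#
  1≉0 1≈0 = proj₂ (tight 1# 0#) 1≈0 (invertible⇒#
    (1# , trans (*-identityˡ _) 1-0≈1 , trans (*-identityʳ _) 1-0≈1))
    where
    1-0≈1 : 1# - 0# ≈ 1#
    1-0≈1 = trans (+-congˡ (RingProperties.-0#≈0# ring)) (+-identityʳ 1#)

  inverse : ∀ x → ¬ x ≈ 0# → ∃ λ y → x * y ≈ 1#
  inverse x x≉0 with ∃? (λ y → x * y ≟ 1#) (λ y≈z xy≈1 → trans (*-congˡ (sym y≈z)) xy≈1)
  ... | yes inv = inv
  ... | no ¬inv = contradiction (proj₁ (tight x 0#) ¬x#0) x≉0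
    where
    x-0≈x : x - 0# ≈ x
    x-0≈x = trans (+-congˡ (RingProperties.-0#≈0# ring)) (+-identityʳ x)
    ¬x#0 : ¬ x # 0#
    ¬x#0 x#0 = let (y , _ , xy≈1) = #⇒invertible x#0 in
      ¬inv (y , trans (*-congʳ (sym x-0≈x)) xy≈1)

  unit⇒≉0 : ∀ {x y} → x * y ≈ 1# → ¬ x ≈ 0#
  unit⇒≉0 {x} {y} xy≈1 x≈0 = 1≉0 (trans (sym xy≈1) (trans (*-congʳ x≈0) (zeroˡ y)))

  *-≉0 : ∀ {x y} → ¬ x ≈ 0# → ¬ y ≈ 0# → ¬ x * y ≈ 0#
  *-≉0 {x} {y} x≉0 y≉0 xy≈0 = let (z , xz≈1) = inverse x x≉0 in
    y≉0 (trans (sym (*-identityˡ y)) (trans (*-congʳ (trans (sym xz≈1) (*-comm x z)))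
      (trans (*-assoc z x y) (trans (*-congˡ xy≈0) (zeroʳ z)))))

-- t is the dimension of the vector space: PG and AK below are PG(t-1,q) and AK(t-1,q).
module _ {q : ℕ} (F : FiniteField q) (t : ℕ) where
  open FiniteField F
  open Sum semiring using (sum; sum-cong-≋; *-distribˡ-sum)
  open VectorEquality setoid using (_≋_; ≋-isEquivalence)

  vectors : FiniteSet
  vectors = record
    { decSetoid  = record
      { isDecEquivalence = record
        { isEquivalence = ≋-isEquivalence t
        ; _≟_           = λ x y → Finₚ.all? (λ i → x i ≟ y i)
        }
      }
    ; elements   = map (λ k i → Inverse.from numbering (finToFun k i)) (allFin (q ℕ.^ t))
    ; enumerates = λ x → Anyₚ.map⁺ (Any.map
        (λ { refl i → sym (trans
          (Inverse.from-cong numbering (finToFun-funToFin (λ j → Inverse.to numbering (x j)) i))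
          (Inverse.strictlyInverseʳ numbering (x i))) })
        (∈-allFin (funToFin (λ j → Inverse.to numbering (x j)))))
    }

  infixl 8 _·_
  _·_ : Vector Carrier t → Vector Carrier t → Carrier
  x · y = sum (λ i → x i * y i)

  0ᵥ : Vector Carrier t
  0ᵥ _ = 0#

  infix 4 _∼_
  _∼_ : Rel (Vector Carrier t) 0ℓ
  x ∼ y = ∃ λ a → ¬ a ≈ 0# × x ≋ (λ i → a * y i)

  Absolute : Vector Carrier t → Set
  Absolute x = x · x ≈ 0#

  NonSquare : Vector Carrier t → Set
  NonSquare x = ∀ a → ¬ x · x ≈ a * a

  ·-cong : ∀ {x x′ y y′} → x ≋ x′ → y ≋ y′ → x · y ≈ x′ · y′
  ·-cong x≋x′ y≋y′ = sum-cong-≋ (λ i → *-cong (x≋x′ i) (y≋y′ i))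

  ·-comm : ∀ x y → x · y ≈ y · x
  ·-comm x y = sum-cong-≋ (λ i → *-comm (x i) (y i))

  ·-scaleˡ : ∀ a x y → (λ i → a * x i) · y ≈ a * (x · y)
  ·-scaleˡ a x y = trans (sum-cong-≋ (λ i → *-assoc a (x i) (y i)))
    (sym (*-distribˡ-sum a (λ i → x i * y i)))

  ·-scale : ∀ {x x′ y y′ a b} → x ≋ (λ i → a * x′ i) → y ≋ (λ i → b * y′ i) →
            x · y ≈ a * (b * (x′ · y′))
  ·-scale {x} {x′} {y} {y′} {a} {b} x≋ax′ y≋by′ = begin
    x · y                              ≈⟨ ·-cong x≋ax′ y≋by′ ⟩
    (λ i → a * x′ i) · (λ i → b * y′ i) ≈⟨ ·-scaleˡ a x′ (λ i → b * y′ i) ⟩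
    a * (x′ · (λ i → b * y′ i))        ≈⟨ *-congˡ (·-comm x′ (λ i → b * y′ i)) ⟩
    a * ((λ i → b * y′ i) · x′)        ≈⟨ *-congˡ (·-scaleˡ b y′ x′) ⟩
    a * (b * (y′ · x′))                ≈⟨ *-congˡ (*-congˡ (·-comm y′ x′)) ⟩
    a * (b * (x′ · y′))                ∎
    where open import Relation.Binary.Reasoning.Setoid setoid

  ≋⇒∼ : ∀ {x y} → x ≋ y → x ∼ y
  ≋⇒∼ {y = y} x≋y = 1# , 1≉0 , λ i → trans (x≋y i) (sym (*-identityˡ (y i)))

  ∼-isEquivalence : IsEquivalence _∼_
  ∼-isEquivalence = record
    { refl  = ≋⇒∼ (λ _ → FiniteField.refl F)
    ; sym   = ∼-sym
    ; trans = λ { (a , a≉0 , x≋ay) (b , b≉0 , y≋bz) → a * b , *-≉0 a≉0 b≉0 ,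
        λ i → trans (x≋ay i) (trans (*-congˡ (y≋bz i)) (sym (*-assoc a b _))) }
    }
    where
    ∼-sym : ∀ {x y} → x ∼ y → y ∼ x
    ∼-sym {x} {y} (a , a≉0 , x≋ay) = let (b , ab≈1) = inverse a a≉0 ; ba≈1 = trans (*-comm b a) ab≈1 in
      b , unit⇒≉0 ba≈1 , λ i → sym (trans (*-congˡ (x≋ay i)) (trans (sym (*-assoc b a (y i)))
        (trans (*-congʳ ba≈1) (*-identityˡ (y i)))))

  infix 4 _∼?_
  _∼?_ : Decidable _∼_
  x ∼? y = ∃? (λ a → ¬? (a ≟ 0#) ×-dec Finₚ.all? (λ i → x i ≟ a * y i))
    (λ a≈b (a≉0 , x≋ay) → (λ b≈0 → a≉0 (trans a≈b b≈0)) , λ i → trans (x≋ay i) (*-congʳ a≈b))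

  orthogonal-resp : ∀ {x x′ y y′} → x ∼ x′ → y ∼ y′ → x · y ≈ 0# → x′ · y′ ≈ 0#
  orthogonal-resp {x′ = x′} {y′ = y′} x∼x′ y∼y′ xy≈0 =
    let (a , _ , x′≋ax) = IsEquivalence.sym ∼-isEquivalence x∼x′
        (b , _ , y′≋by) = IsEquivalence.sym ∼-isEquivalence y∼y′
    in trans (·-scale x′≋ax y′≋by) (trans (*-congˡ (trans (*-congˡ xy≈0) (zeroʳ b))) (zeroʳ a))

  nonSquare-resp : ∀ {x y} → x ∼ y → NonSquare x → NonSquare y
  nonSquare-resp {x} {y} (a , _ , x≋ay) x-ns b yy≈bb = x-ns (a * b) (begin
    x · x              ≈⟨ ·-scale x≋ay x≋ay ⟩
    a * (a * (y · y))  ≈⟨ *-congˡ (*-congˡ yy≈bb) ⟩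
    a * (a * (b * b))  ≈⟨ *-congˡ (sym (*-assoc a b b)) ⟩
    a * (a * b * b)    ≈⟨ *-congˡ (*-comm (a * b) b) ⟩
    a * (b * (a * b))  ≈⟨ sym (*-assoc a b (a * b)) ⟩
    a * b * (a * b)    ∎)
    where open import Relation.Binary.Reasoning.Setoid setoid

  nonSquare? : U.Decidable NonSquare
  nonSquare? x = map′ (λ ¬∃ a eq → ¬∃ (a , eq)) (λ ns (a , eq) → ns a eq)
    (¬? (∃? (λ a → x · x ≟ a * a) (λ a≈b eq → trans eq (*-cong a≈b a≈b))))

  PG : FiniteSet
  PG = quotient
    (subset vectors {P = λ x → ¬ x ≋ 0ᵥ} (λ x → ¬? (Finₚ.all? (λ i → x i ≟ 0#)))
      (λ x≋y x≉0 y≋0 → x≉0 (λ i → trans (x≋y i) (y≋0 i))))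
    (On.isEquivalence proj₁ ∼-isEquivalence)
    (λ x y → proj₁ x ∼? proj₁ y)
    ≋⇒∼

  AK : Graph
  AK = record
    { vertices   = subset PG {P = λ x → ¬ Absolute (proj₁ x)} (λ x → ¬? (proj₁ x · proj₁ x ≟ 0#))
        (λ x∼y x-na yy≈0 → let y∼x = IsEquivalence.sym ∼-isEquivalence x∼y in
          x-na (orthogonal-resp y∼x y∼x yy≈0))
    ; Adjacent   = λ x y → proj₁ (proj₁ x) · proj₁ (proj₁ y) ≈ 0#
    ; adjacent?  = λ x y → proj₁ (proj₁ x) · proj₁ (proj₁ y) ≟ 0#
    ; adj-resp   = orthogonal-resp
    ; adj-sym    = λ {x} {y} xy≈0 → trans (·-comm (proj₁ (proj₁ y)) (proj₁ (proj₁ x))) xy≈0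
    ; adj-irrefl = λ {x} → proj₂ x
    }

  X⊠ : FiniteSet
  X⊠ = subset vectors nonSquare? (λ x≋y → nonSquare-resp (≋⇒∼ x≋y))

  X⊠/∼ : FiniteSet
  X⊠/∼ = quotient X⊠ (On.isEquivalence proj₁ ∼-isEquivalence) (λ x y → proj₁ x ∼? proj₁ y) ≋⇒∼

  AK⊠ : Graph
  AK⊠ = inducedSubgraph AK {P = λ x → NonSquare (proj₁ (proj₁ x))}
    (λ x → nonSquare? (proj₁ (proj₁ x))) nonSquare-resp

IsPrimePower : ℕ → Set
IsPrimePower q = ∃₂ λ ℓ k → Prime ℓ × q ≡ ℓ ℕ.^ suc k

record OddFiniteField : Set₁ where
  field
    q          : ℕ
    primePower : IsPrimePower q
    odd        : ¬ 2 ∣ q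
    𝔽          : FiniteField q

{-# OPTIONS --safe #-}
module Submission where

-- Take p = 1/q and α = √(q^(t−2)).
--
-- Jumbledness.  For points x_i put δ_i(v) = q[x_i · v = 0] − 1.  Non-proportional points give independent
-- linear forms, so ∑_v δ_i(v) δ_j(v) = 0 for i ≠ j, while it is (q − 1)q^t for i = j; hence F = ∑_{i ∈ X} δ_i satisfies
-- ∑_v F(v)² = |X|(q − 1)q^t.  Every point has q − 1 representatives v and F is constant on them, so the sum of F² over the
-- points is at most |X|q^t, and Cauchy–Schwarz over Y gives (q e(X,Y) − |X||Y|)² ≤ |X||Y|q^t.
--
-- K_t-freeness.  Scaling t pairwise orthogonal non-square vectors to a common norm g gives a basis in which the form
-- is g(y₁² + … + y_t²), so y₁² + … + y_t² takes the values 1 and g equally often.  In the convolution algebra of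
-- functions on F_q modulo constants, the square of the function counting square roots is a nonzero multiple of the unit;
-- so the same would hold with t replaced by t − 2, …, 1, which is absurd since g is not a square.
--
-- Number of points.  For fixed c ≠ 0 the hyperbola z² = x² + c has q − 1 points, so x² + c is a non-square for at
-- least (q − 1)/2 values of x; therefore at least q^t/9 vectors are non-square.

open import Defs
open import Level using (0ℓ)
open import Algebra.Structures using (IsCommutativeSemiring; IsCommutativeRing)
import Algebra.Properties.Ring as RingProperties
import Algebra.Properties.Semiring.Sum as Sum
import Algebra.Solver.Ring.NaturalCoefficients.Default as Solver
open import Data.Bool.Base using (if_then_else_)
open import Data.Fin.Base as Fin using (Fin)
import Data.Fin.Properties as Finₚ
open import Data.Fin.Subset using (Subset; inside; outside; ∣_∣; _∩_)
open import Data.Fin.Subset.Properties using (_∈?_; x∈p∩q⁺; x∈p∩q⁻; drop-there)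
import Data.Integer.Base as ℤ
open ℤ using (ℤ)
import Data.Integer.Properties as ℤₚ
import Data.Integer.Tactic.RingSolver as ℤ-Solver
open import Data.List.Base using (List; []; _∷_; _++_; map; allFin; cartesianProduct; filter; length)
open import Data.List.Properties using (length-map; length-tabulate; map-tabulate)
open import Data.Nat.Base as ℕ using (ℕ; zero; suc; _≤_; _∸_; z≤n; s≤s)
open import Data.Nat.Divisibility using (_∣_; divides; _∣0; ∣-refl)
import Data.Nat.Properties as ℕₚ
open import Data.Nat.Tactic.RingSolver using (solve-∀)
open import Data.Product.Base using (∃; ∃₂; _×_; _,_; proj₁; proj₂; uncurry)
open import Data.Product.Relation.Binary.Pointwise.NonDependent using (×-decSetoid)
open import Data.Rational.Base as ℚ using (ℚ; 0ℚ; 1ℚ; ½; ↧ₙ_)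
import Data.Rational.Properties as ℚₚ
open import Data.Rational.Solver using (module +-*-Solver)
open import Data.Sum.Base using (_⊎_; inj₁; inj₂; [_,_])
open import Data.Vec.Base using ([]; _∷_; there)
open import Data.Vec.Functional as V using (Vector)
import Data.Vec.Functional.Relation.Binary.Equality.Setoid as VectorEquality
open import Function.Base using (id)
open import Function.Bundles using (Inverse)
open import Relation.Binary.Bundles using (DecSetoid)
open import Relation.Binary.Definitions using (Decidable; tri<; tri≈; tri>)
open import Relation.Binary.PropositionalEquality as ≡ using (_≡_; _≢_; cong; cong₂; subst; subst₂)
import Relation.Binary.Reasoning.Setoid as SetoidReasoning
open import Relation.Nullary.Decidable using (Dec; does; yes; no; _×-dec_; _⊎-dec_; ¬?)
open import Relation.Nullary.Negation using (¬_; contradiction)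
import Relation.Unary as U

-- Sums over lists and finite sets

-- The familiar argument for K_t-freeness compares determinants: the Gram matrix of t vectors of the
-- space has a square determinant, whereas a product of t non-squares is a non-square when t is odd.
-- The count of norm values takes the part of this determinant, and the oddness of t lets the
-- descent by 2 end at t = 1. All cardinalities are sums of indicators in ℕ. Hence an identity with
-- a negative term appears with that term moved to the other side, and changes of variables appear
-- as injections that bound one sum by another. Inequalities stay squared and integral until the
-- very end; only then do they pass to ℚ and to approximate roots. The size of n is governed by
-- `q^(t-1)/9 ≤ n ≤ 2 q^(t-1)`. The upper bound comes from `q/(q-1) ≤ 2`, and the 9 from the
-- smallest field, q = 3. So np has the order of `q^(t-2)`, which is α². The constants behind Θ are
-- rational stand-ins for roots of 9 and 2, independent of q.

module ListSum {R : Set} {add mul : R → R → R} {0# 1# : R}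
  (isCommutativeSemiring : IsCommutativeSemiring _≡_ add mul 0# 1#) where

  private
    module R = IsCommutativeSemiring isCommutativeSemiring

    interchange : ∀ a b c d → add (add a b) (add c d) ≡ add (add a c) (add b d)
    interchange a b c d = ≡.trans (R.+-assoc a b _) (≡.trans
      (cong (add a) (≡.trans (≡.sym (R.+-assoc b c d)) (≡.trans (cong (λ e → add e d) (R.+-comm b c)) (R.+-assoc c b d))))
      (≡.sym (R.+-assoc a c _)))

  ∑ : {A : Set} → List A → (A → R) → R
  ∑ []       f = 0#
  ∑ (x ∷ xs) f = add (f x) (∑ xs f)

  module _ {A : Set} where

    ∑-cong : (xs : List A) {f g : A → R} → (∀ x → f x ≡ g x) → ∑ xs f ≡ ∑ xs g
    ∑-cong []       f≗g = ≡.refl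
    ∑-cong (x ∷ xs) f≗g = cong₂ add (f≗g x) (∑-cong xs f≗g)

    ∑-zero : (xs : List A) → ∑ xs (λ _ → 0#) ≡ 0#
    ∑-zero []       = ≡.refl
    ∑-zero (x ∷ xs) = ≡.trans (R.+-identityˡ _) (∑-zero xs)

    ∑-+ : (xs : List A) (f g : A → R) → ∑ xs (λ x → add (f x) (g x)) ≡ add (∑ xs f) (∑ xs g)
    ∑-+ []       f g = ≡.sym (R.+-identityˡ 0#)
    ∑-+ (x ∷ xs) f g = ≡.trans (cong (add _) (∑-+ xs f g)) (interchange _ _ _ _)

    ∑-*ˡ : (xs : List A) (c : R) (f : A → R) → ∑ xs (λ x → mul c (f x)) ≡ mul c (∑ xs f)
    ∑-*ˡ []       c f = ≡.sym (R.zeroʳ c)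
    ∑-*ˡ (x ∷ xs) c f = ≡.trans (cong (add _) (∑-*ˡ xs c f)) (≡.sym (R.distribˡ c _ _))

    ∑-*ʳ : (xs : List A) (f : A → R) (c : R) → ∑ xs (λ x → mul (f x) c) ≡ mul (∑ xs f) c
    ∑-*ʳ xs f c = ≡.trans (∑-cong xs (λ x → R.*-comm (f x) c)) (≡.trans (∑-*ˡ xs c f) (R.*-comm c _))

    ∑-++ : (xs ys : List A) (f : A → R) → ∑ (xs ++ ys) f ≡ add (∑ xs f) (∑ ys f)
    ∑-++ []       ys f = ≡.sym (R.+-identityˡ _)
    ∑-++ (x ∷ xs) ys f = ≡.trans (cong (add _) (∑-++ xs ys f)) (≡.sym (R.+-assoc _ _ _))

  ∑-map : {A B : Set} (g : A → B) (xs : List A) (f : B → R) → ∑ (map g xs) f ≡ ∑ xs (λ x → f (g x))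
  ∑-map g []       f = ≡.refl
  ∑-map g (x ∷ xs) f = cong (add _) (∑-map g xs f)

  ∑-allFin-suc : ∀ {n} (f : Fin (suc n) → R) → ∑ (allFin (suc n)) f ≡ add (f Fin.zero) (∑ (allFin n) (λ i → f (Fin.suc i)))
  ∑-allFin-suc f = cong (add _) (≡.trans (cong (λ is → ∑ is f) (≡.sym (map-tabulate id Fin.suc))) (∑-map Fin.suc (allFin _) f))

  module _ {A B : Set} where

    ∑-comm : (xs : List A) (ys : List B) (f : A → B → R) →
             ∑ xs (λ x → ∑ ys (f x)) ≡ ∑ ys (λ y → ∑ xs (λ x → f x y))
    ∑-comm []       ys f = ≡.sym (∑-zero ys)
    ∑-comm (x ∷ xs) ys f = ≡.trans (cong (add _) (∑-comm xs ys f)) (≡.sym (∑-+ ys (f x) _))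

    ∑-cartesianProduct : (xs : List A) (ys : List B) (f : A × B → R) →
                         ∑ (cartesianProduct xs ys) f ≡ ∑ xs (λ x → ∑ ys (λ y → f (x , y)))
    ∑-cartesianProduct []       ys f = ≡.refl
    ∑-cartesianProduct (x ∷ xs) ys f = ≡.trans (∑-++ (map (x ,_) ys) _ f)
      (cong₂ add (∑-map (x ,_) ys f) (∑-cartesianProduct xs ys f))

    ∑-*-∑ : (xs : List A) (ys : List B) (f : A → R) (g : B → R) →
            mul (∑ xs f) (∑ ys g) ≡ ∑ xs (λ x → ∑ ys (λ y → mul (f x) (g y)))
    ∑-*-∑ xs ys f g = ≡.trans (≡.sym (∑-*ʳ xs f _)) (∑-cong xs (λ x → ≡.sym (∑-*ˡ ys (f x) g)))

open ListSum ℕₚ.+-*-isCommutativeSemiring public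

module _ {A : Set} where

  ∑-mono : (xs : List A) {f g : A → ℕ} → (∀ x → f x ≤ g x) → ∑ xs f ≤ ∑ xs g
  ∑-mono []       f≤g = z≤n
  ∑-mono (x ∷ xs) f≤g = ℕₚ.+-mono-≤ (f≤g x) (∑-mono xs f≤g)

  ∑-const : (xs : List A) (c : ℕ) → ∑ xs (λ _ → c) ≡ length xs ℕ.* c
  ∑-const []       c = ≡.refl
  ∑-const (x ∷ xs) c = cong (c ℕ.+_) (∑-const xs c)

  ∑-≡0 : (xs : List A) {f : A → ℕ} → (∀ x → f x ≡ 0) → ∑ xs f ≡ 0
  ∑-≡0 xs f≡0 = ≡.trans (∑-cong xs f≡0) (∑-zero xs)

  -- Since f ≤ g pointwise, the truncated differences are true ones. The conclusion stays a sum
  -- because a list says nothing about elements outside it; `∑≡⇒≗` makes it pointwise.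
  ∑-cong-equality : (xs : List A) {f g : A → ℕ} → (∀ x → f x ≤ g x) → ∑ xs g ≤ ∑ xs f →
                    ∑ xs (λ x → g x ℕ.∸ f x) ≡ 0
  ∑-cong-equality xs {f} {g} f≤g ∑g≤∑f = ℕₚ.n≤0⇒n≡0 (ℕₚ.+-cancelʳ-≤ (∑ xs f) _ 0 (begin
    ∑ xs (λ x → g x ℕ.∸ f x) ℕ.+ ∑ xs f    ≡⟨ ∑-+ xs _ f ⟨
    ∑ xs (λ x → g x ℕ.∸ f x ℕ.+ f x)       ≡⟨ ∑-cong xs (λ x → ℕₚ.m∸n+n≡m (f≤g x)) ⟩
    ∑ xs g                               ≤⟨ ∑g≤∑f ⟩
    ∑ xs f                               ∎))
    where open ℕₚ.≤-Reasoning

-- The Iverson bracket. Solution sets are never formed; their sizes are sums of brackets over all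
-- candidates.
⟦_⟧ : {P : Set} → Dec P → ℕ
⟦ P? ⟧ = if does P? then 1 else 0

module _ {P : Set} where

  ⟦⟧-yes : (P? : Dec P) → P → ⟦ P? ⟧ ≡ 1
  ⟦⟧-yes (yes _) p = ≡.refl
  ⟦⟧-yes (no ¬p) p = contradiction p ¬p

  ⟦⟧-no : (P? : Dec P) → ¬ P → ⟦ P? ⟧ ≡ 0
  ⟦⟧-no (yes p) ¬p = contradiction p ¬p
  ⟦⟧-no (no _)  ¬p = ≡.refl

  ⟦⟧≤1 : (P? : Dec P) → ⟦ P? ⟧ ≤ 1
  ⟦⟧≤1 (yes _) = s≤s z≤n
  ⟦⟧≤1 (no _)  = z≤n

  ⟦⟧-idem : (P? : Dec P) → ⟦ P? ⟧ ℕ.* ⟦ P? ⟧ ≡ ⟦ P? ⟧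
  ⟦⟧-idem (yes _) = ≡.refl
  ⟦⟧-idem (no _)  = ≡.refl

  ⟦⟧-¬ : (P? : Dec P) → ⟦ P? ⟧ ℕ.+ ⟦ ¬? P? ⟧ ≡ 1
  ⟦⟧-¬ (yes _) = ≡.refl
  ⟦⟧-¬ (no _)  = ≡.refl

⟦⟧-mono : {P Q : Set} (P? : Dec P) (Q? : Dec Q) → (P → Q) → ⟦ P? ⟧ ≤ ⟦ Q? ⟧
⟦⟧-mono (yes p) Q? p⇒q = ℕₚ.≤-reflexive (≡.sym (⟦⟧-yes Q? (p⇒q p)))
⟦⟧-mono (no _)  Q? p⇒q = z≤n

⟦⟧-cong : {P Q : Set} (P? : Dec P) (Q? : Dec Q) → (P → Q) → (Q → P) → ⟦ P? ⟧ ≡ ⟦ Q? ⟧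
⟦⟧-cong P? Q? p⇒q q⇒p = ℕₚ.≤-antisym (⟦⟧-mono P? Q? p⇒q) (⟦⟧-mono Q? P? q⇒p)

⟦⟧-× : {P Q : Set} (P? : Dec P) (Q? : Dec Q) → ⟦ P? ×-dec Q? ⟧ ≡ ⟦ P? ⟧ ℕ.* ⟦ Q? ⟧
⟦⟧-× (yes _) (yes _) = ≡.refl
⟦⟧-× (yes _) (no _)  = ≡.refl
⟦⟧-× (no _)  _       = ≡.refl

∑-filter : {A : Set} {P : U.Pred A 0ℓ} (P? : U.Decidable P) (xs : List A) (f : A → ℕ) →
           ∑ (filter P? xs) f ≡ ∑ xs (λ x → ⟦ P? x ⟧ ℕ.* f x)
∑-filter P? []       f = ≡.refl
∑-filter P? (x ∷ xs) f with P? x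
... | yes _ = cong₂ ℕ._+_ (≡.sym (ℕₚ.+-identityʳ (f x))) (∑-filter P? xs f)
... | no  _ = ∑-filter P? xs f

-- In contrast to a `FiniteSet`, whose elements may repeat, the list meets each class of `_≈_`
-- exactly once. The condition `once` says this in the form in which it is used: the delta function
-- at x has total 1.
record Enumerated : Set₁ where
  field
    decSetoid : DecSetoid 0ℓ 0ℓ
  open DecSetoid decSetoid public using (Carrier; _≈_; _≟_)
    renaming (refl to ≈-refl; sym to ≈-sym; trans to ≈-trans)
  field
    list : List Carrier
    once : ∀ x → ∑ list (λ y → ⟦ y ≟ x ⟧) ≡ 1

  Respects : (Carrier → ℕ) → Set
  Respects f = ∀ {x y} → x ≈ y → f x ≡ f y

  ∑-δ : ∀ x {f} → Respects f → ∑ list (λ y → ⟦ y ≟ x ⟧ ℕ.* f y) ≡ f x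
  ∑-δ x {f} f-resp = begin
    ∑ list (λ y → ⟦ y ≟ x ⟧ ℕ.* f y)   ≡⟨ ∑-cong list (λ y → select (y ≟ x)) ⟩
    ∑ list (λ y → ⟦ y ≟ x ⟧ ℕ.* f x)   ≡⟨ ∑-*ʳ list _ (f x) ⟩
    ∑ list (λ y → ⟦ y ≟ x ⟧) ℕ.* f x   ≡⟨ cong (ℕ._* f x) (once x) ⟩
    1 ℕ.* f x                          ≡⟨ ℕₚ.*-identityˡ (f x) ⟩
    f x                              ∎
    where
    open ≡.≡-Reasoning
    select : ∀ {y} (y≟x : Dec (y ≈ x)) → ⟦ y≟x ⟧ ℕ.* f y ≡ ⟦ y≟x ⟧ ℕ.* f x
    select (yes y≈x) = cong (1 ℕ.*_) (f-resp y≈x)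
    select (no _)    = ≡.refl

  term≤∑ : ∀ x {f} → Respects f → f x ≤ ∑ list f
  term≤∑ x {f} f-resp = begin
    f x                              ≡⟨ ∑-δ x f-resp ⟨
    ∑ list (λ y → ⟦ y ≟ x ⟧ ℕ.* f y)   ≤⟨ ∑-mono list (λ y → ℕₚ.*-monoˡ-≤ (f y) (⟦⟧≤1 (y ≟ x))) ⟩
    ∑ list (λ y → 1 ℕ.* f y)           ≡⟨ ∑-cong list (λ y → ℕₚ.*-identityˡ (f y)) ⟩
    ∑ list f                         ∎
    where open ℕₚ.≤-Reasoning

  -- The difference at a single x is at most the sum of all the differences, which is 0.
  ∑≡⇒≗ : ∀ {f g} → Respects f → Respects g → (∀ x → f x ≤ g x) → ∑ list f ≡ ∑ list g → ∀ x → f x ≡ g x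
  ∑≡⇒≗ {f} {g} f-resp g-resp f≤g ∑f≡∑g x = ℕₚ.≤-antisym (f≤g x) (ℕₚ.m∸n≡0⇒m≤n (ℕₚ.n≤0⇒n≡0 (begin
    g x ℕ.∸ f x                    ≤⟨ term≤∑ x (λ x≈y → cong₂ ℕ._∸_ (g-resp x≈y) (f-resp x≈y)) ⟩
    ∑ list (λ y → g y ℕ.∸ f y)     ≡⟨ ∑-cong-equality list f≤g (ℕₚ.≤-reflexive (≡.sym ∑f≡∑g)) ⟩
    0                              ∎)))
    where open ℕₚ.≤-Reasoning

  -- The sum s counts the x with P x, and s² the pairs of such x, all of which are diagonal; so s² ≤ s.
  atMostOne : ∀ {P : U.Pred Carrier 0ℓ} (P? : U.Decidable P) → (∀ {x y} → P x → P y → x ≈ y) →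
              ∑ list (λ x → ⟦ P? x ⟧) ≤ 1
  atMostOne P? unique = square≤⇒≤1 (begin
    ∑ list (λ x → ⟦ P? x ⟧) ℕ.* ∑ list (λ y → ⟦ P? y ⟧)
      ≡⟨ ∑-*-∑ list list _ _ ⟩
    ∑ list (λ x → ∑ list (λ y → ⟦ P? x ⟧ ℕ.* ⟦ P? y ⟧))
      ≤⟨ ∑-mono list (λ x → ∑-mono list (λ y → diagonal x y)) ⟩
    ∑ list (λ x → ∑ list (λ y → ⟦ y ≟ x ⟧ ℕ.* ⟦ P? x ⟧))
      ≡⟨ ∑-cong list (λ x → ≡.trans (∑-*ʳ list _ _) (≡.trans (cong (ℕ._* ⟦ P? x ⟧) (once x)) (ℕₚ.*-identityˡ _))) ⟩
    ∑ list (λ x → ⟦ P? x ⟧)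
      ∎)
    where
    open ℕₚ.≤-Reasoning
    square≤⇒≤1 : ∀ {s} → s ℕ.* s ≤ s → s ≤ 1
    square≤⇒≤1 {zero}  _ = z≤n
    square≤⇒≤1 {suc s} h = ℕₚ.*-cancelˡ-≤ (suc s) (ℕₚ.≤-trans h (ℕₚ.≤-reflexive (≡.sym (ℕₚ.*-identityʳ _))))
    diagonal : ∀ x y → ⟦ P? x ⟧ ℕ.* ⟦ P? y ⟧ ≤ ⟦ y ≟ x ⟧ ℕ.* ⟦ P? x ⟧
    diagonal x y with P? x | P? y
    ... | yes p | yes p′ = ℕₚ.≤-reflexive (≡.sym (cong (ℕ._* 1) (⟦⟧-yes (y ≟ x) (unique p′ p))))
    ... | yes _ | no _   = z≤n
    ... | no _  | _      = z≤n

module _ (A B : Enumerated) where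
  private
    module A = Enumerated A
    module B = Enumerated B

  -- Double counting of the pairs (x , y) with P x and y ≈ φ x: each such x lies in one pair, each y
  -- in at most one.
  ∑-injection : ∀ {P : U.Pred A.Carrier 0ℓ} (P? : U.Decidable P) (φ : A.Carrier → B.Carrier) →
                (∀ {x y} → P x → P y → φ x B.≈ φ y → x A.≈ y) →
                ∀ {f} → B.Respects f →
                ∑ A.list (λ x → ⟦ P? x ⟧ ℕ.* f (φ x)) ≤ ∑ B.list f
  ∑-injection P? φ injective {f} f-resp = begin
    ∑ A.list (λ x → ⟦ P? x ⟧ ℕ.* f (φ x))
      ≡⟨ ∑-cong A.list (λ x → ≡.trans (cong (⟦ P? x ⟧ ℕ.*_) (≡.sym (B.∑-δ (φ x) f-resp))) (≡.sym (∑-*ˡ B.list ⟦ P? x ⟧ _))) ⟩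
    ∑ A.list (λ x → ∑ B.list (λ y → ⟦ P? x ⟧ ℕ.* (⟦ y B.≟ φ x ⟧ ℕ.* f y)))
      ≡⟨ ∑-comm A.list B.list _ ⟩
    ∑ B.list (λ y → ∑ A.list (λ x → ⟦ P? x ⟧ ℕ.* (⟦ y B.≟ φ x ⟧ ℕ.* f y)))
      ≡⟨ ∑-cong B.list (λ y → ≡.trans (∑-cong A.list (λ x → collect x y)) (∑-*ʳ A.list _ (f y))) ⟩
    ∑ B.list (λ y → ∑ A.list (λ x → ⟦ P? x ×-dec (y B.≟ φ x) ⟧) ℕ.* f y)
      ≤⟨ ∑-mono B.list (λ y → ℕₚ.*-monoˡ-≤ (f y) (A.atMostOne (λ x → P? x ×-dec (y B.≟ φ x))
           (λ (px , y≈φx) (px′ , y≈φx′) → injective px px′ (B.≈-trans (B.≈-sym y≈φx) y≈φx′)))) ⟩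
    ∑ B.list (λ y → 1 ℕ.* f y)
      ≡⟨ ∑-cong B.list (λ y → ℕₚ.*-identityˡ (f y)) ⟩
    ∑ B.list f
      ∎
    where
    open ℕₚ.≤-Reasoning
    collect : ∀ x y → ⟦ P? x ⟧ ℕ.* (⟦ y B.≟ φ x ⟧ ℕ.* f y) ≡ ⟦ P? x ×-dec (y B.≟ φ x) ⟧ ℕ.* f y
    collect x y = ≡.trans (≡.sym (ℕₚ.*-assoc ⟦ P? x ⟧ _ _)) (cong (ℕ._* f y) (≡.sym (⟦⟧-× (P? x) (y B.≟ φ x))))

module _ (A : Enumerated) where
  open Enumerated A

  ∑-injective : (φ : Carrier → Carrier) → (∀ {x y} → φ x ≈ φ y → x ≈ y) →
                ∀ {f} → Respects f → ∑ list (λ x → f (φ x)) ≤ ∑ list f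
  ∑-injective φ injective f-resp = ℕₚ.≤-trans
    (ℕₚ.≤-reflexive (∑-cong list (λ x → ≡.sym (ℕₚ.*-identityˡ _))))
    (∑-injection A A {P = λ x → x ≈ x} (λ x → yes ≈-refl) φ (λ _ _ → injective) f-resp)

  ∑-bijective : (φ ψ : Carrier → Carrier) → (∀ {x y} → x ≈ y → φ x ≈ φ y) →
                (∀ {x y} → x ≈ y → ψ x ≈ ψ y) → (∀ x → φ (ψ x) ≈ x) → (∀ x → ψ (φ x) ≈ x) →
                ∀ {f} → Respects f → ∑ list (λ x → f (φ x)) ≡ ∑ list f
  ∑-bijective φ ψ φ-cong ψ-cong φψ ψφ {f} f-resp = ℕₚ.≤-antisym
    (∑-injective φ (λ {x} {y} e → ≈-trans (≈-sym (ψφ x)) (≈-trans (ψ-cong e) (ψφ y))) f-resp)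
    (ℕₚ.≤-trans (ℕₚ.≤-reflexive (∑-cong list (λ x → ≡.sym (f-resp (φψ x)))))
      (∑-injective ψ (λ {x} {y} e → ≈-trans (≈-sym (φψ x)) (≈-trans (φ-cong e) (φψ y)))
        (λ x≈y → f-resp (φ-cong x≈y))))

∑-allFin-δ : ∀ {n} (i : Fin n) → ∑ (allFin n) (λ j → ⟦ j Finₚ.≟ i ⟧) ≡ 1
∑-allFin-δ {suc n} i = ≡.trans (∑-allFin-suc (λ j → ⟦ j Finₚ.≟ i ⟧)) (split i)
  where
  split : ∀ i → ⟦ Fin.zero Finₚ.≟ i ⟧ ℕ.+ ∑ (allFin n) (λ j → ⟦ Fin.suc j Finₚ.≟ i ⟧) ≡ 1
  split Fin.zero    = cong suc (∑-≡0 (allFin n) (λ _ → ≡.refl))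
  split (Fin.suc i) = ≡.trans
    (∑-cong (allFin n) (λ j → ⟦⟧-cong (Fin.suc j Finₚ.≟ Fin.suc i) (j Finₚ.≟ i) Finₚ.suc-injective (cong Fin.suc)))
    (∑-allFin-δ i)

finEnumerated : ℕ → Enumerated
finEnumerated n = record
  { decSetoid = Finₚ.≡-decSetoid n
  ; list      = allFin n
  ; once      = ∑-allFin-δ
  }

infixr 4 _⊗_
_⊗_ : Enumerated → Enumerated → Enumerated
A ⊗ B = record
  { decSetoid = ×-decSetoid A.decSetoid B.decSetoid
  ; list      = cartesianProduct A.list B.list
  ; once      = λ (x , y) → begin
      ∑ (cartesianProduct A.list B.list) _
        ≡⟨ ∑-cartesianProduct A.list B.list _ ⟩
      ∑ A.list (λ x′ → ∑ B.list (λ y′ → ⟦ (x′ A.≟ x) ×-dec (y′ B.≟ y) ⟧))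
        ≡⟨ ∑-cong A.list (λ x′ → ∑-cong B.list (λ y′ → ⟦⟧-× (x′ A.≟ x) (y′ B.≟ y))) ⟩
      ∑ A.list (λ x′ → ∑ B.list (λ y′ → ⟦ x′ A.≟ x ⟧ ℕ.* ⟦ y′ B.≟ y ⟧))
        ≡⟨ ∑-*-∑ A.list B.list _ _ ⟨
      ∑ A.list (λ x′ → ⟦ x′ A.≟ x ⟧) ℕ.* ∑ B.list (λ y′ → ⟦ y′ B.≟ y ⟧)
        ≡⟨ cong₂ ℕ._*_ (A.once x) (B.once y) ⟩
      1
        ∎
  }
  where
  module A = Enumerated A
  module B = Enumerated B
  open ≡.≡-Reasoning

module _ (A : DecSetoid 0ℓ 0ℓ) {n : ℕ} (numbering : Inverse (DecSetoid.setoid A) (≡.setoid (Fin n))) where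
  private
    module A = DecSetoid A
    open Inverse numbering

  numbered : Enumerated
  numbered = record
    { decSetoid = A
    ; list      = map from (allFin n)
    ; once      = λ x → ≡.trans (∑-map from (allFin n) _) (≡.trans
        (∑-cong (allFin n) (λ i → ⟦⟧-cong (from i A.≟ x) (i Finₚ.≟ to x)
          (λ eq → ≡.trans (≡.sym (strictlyInverseˡ i)) (to-cong eq))
          (λ { ≡.refl → strictlyInverseʳ x })))
        (∑-allFin-δ (to x)))
    }

  length-numbered : length (map from (allFin n)) ≡ n
  length-numbered = ≡.trans (length-map from (allFin n)) (length-tabulate id)

-- Finite fields of odd order

module Field {q : ℕ} (F : FiniteField q) where
  open FiniteField F public hiding (_≟_)

  -- Abstract, so that ⟦ x ≟ y ⟧ does not unfold to the numbering of the field.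
  abstract
    infix 4 _≟_
    _≟_ : Decidable _≈_
    _≟_ = FiniteField._≟_ F

  decSetoid : DecSetoid 0ℓ 0ℓ
  decSetoid = record { isDecEquivalence = record { isEquivalence = isEquivalence ; _≟_ = _≟_ } }
  open RingProperties ring public using (-‿distribˡ-*; -‿distribʳ-*; -‿involutive; -0#≈0#; +-cancelˡ; +-cancelʳ)
  module ≈-Reasoning = SetoidReasoning setoid
  open Solver commutativeSemiring public using (solve; _:=_; _:+_; _:*_; con)

  scalars : Enumerated
  scalars = numbered decSetoid numbering

  𝔽 : List Carrier
  𝔽 = Enumerated.list scalars

  length-𝔽 : length 𝔽 ≡ q
  length-𝔽 = length-numbered decSetoid numbering

  open Enumerated scalars public using () renaming (Respects to Respects₁)

  zero-product : ∀ {x y} → x * y ≈ 0# → x ≈ 0# ⊎ y ≈ 0#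
  zero-product {x} {y} xy≈0 with x ≟ 0# | y ≟ 0#
  ... | yes x≈0 | _       = inj₁ x≈0
  ... | no _    | yes y≈0 = inj₂ y≈0
  ... | no x≉0  | no y≉0  = contradiction xy≈0 (*-≉0 x≉0 y≉0)

  *-cancelˡ : ∀ a {x y} → ¬ a ≈ 0# → a * x ≈ a * y → x ≈ y
  *-cancelˡ a {x} {y} a≉0 ax≈ay = let (b , ab≈1) = inverse a a≉0 in begin
    x            ≈⟨ unscale b ab≈1 x ⟨
    b * (a * x)  ≈⟨ *-congˡ ax≈ay ⟩
    b * (a * y)  ≈⟨ unscale b ab≈1 y ⟩
    y            ∎
    where
    open ≈-Reasoning
    unscale : ∀ b → a * b ≈ 1# → ∀ z → b * (a * z) ≈ z
    unscale b ab≈1 z = trans (sym (*-assoc b a z)) (trans (*-congʳ (trans (*-comm b a) ab≈1)) (*-identityˡ z))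

  x+y≈0⇒x≈-y : ∀ {x y} → x + y ≈ 0# → x ≈ - y
  x+y≈0⇒x≈-y {x} {y} e = +-cancelʳ y _ _ (trans e (sym (-‿inverseˡ y)))

  x-y≈0⇒x≈y : ∀ {x y} → x - y ≈ 0# → x ≈ y
  x-y≈0⇒x≈y {x} {y} e = trans (x+y≈0⇒x≈-y e) (-‿involutive y)

  x+[y-x]≈y : ∀ x y → x + (y - x) ≈ y
  x+[y-x]≈y x y = trans (+-comm x (y - x)) (trans (+-assoc y (- x) x) (trans (+-congˡ (-‿inverseˡ x)) (+-identityʳ y)))

  difference-of-squares : ∀ x y → (x - y) * (x + y) + y * y ≈ x * x
  difference-of-squares x y = begin
    (x - y) * (x + y) + y * y
      -- The semiring solver has no negation, so `- y` enters as the variable n, and n + y is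
      -- cancelled in the next steps.
      ≈⟨ solve 3 (λ x y n → (x :+ n) :* (x :+ y) :+ y :* y := x :* x :+ (x :+ y) :* (n :+ y)) refl x y (- y) ⟩
    x * x + (x + y) * (- y + y)          ≈⟨ +-congˡ (*-congˡ (-‿inverseˡ y)) ⟩
    x * x + (x + y) * 0#                 ≈⟨ +-congˡ (zeroʳ _) ⟩
    x * x + 0#                           ≈⟨ +-identityʳ _ ⟩
    x * x                                ∎
    where open ≈-Reasoning

  square-roots : ∀ {x y} → x * x ≈ y * y → x ≈ y ⊎ x ≈ - y
  square-roots {x} {y} xx≈yy with zero-product {x - y} {x + y}
    (+-cancelʳ (y * y) _ _ (trans (difference-of-squares x y) (trans xx≈yy (sym (+-identityˡ _)))))
  ... | inj₁ e = inj₁ (x-y≈0⇒x≈y e)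
  ... | inj₂ e = inj₂ (x+y≈0⇒x≈-y e)

  neg-square : ∀ x → - x * - x ≈ x * x
  neg-square x = trans (sym (-‿distribˡ-* x (- x))) (trans (-‿cong (sym (-‿distribʳ-* x x))) (-‿involutive _))

  square≈0 : ∀ {x} → x * x ≈ 0# → x ≈ 0#
  square≈0 e = [ (λ z → z) , (λ z → z) ] (zero-product e)

  module OddField (q-odd : ¬ 2 ∣ q) where

    -- If 1 + 1 = 0 then x ↦ x + 1 is a fixed-point-free involution.
    1+1≉0 : ¬ 1# + 1# ≈ 0#
    1+1≉0 1+1≈0 = q-odd (divides (∑ 𝔽 up) (≡.sym (begin
      ∑ 𝔽 up ℕ.* 2                          ≡⟨ double (∑ 𝔽 up) ⟩
      ∑ 𝔽 up ℕ.+ ∑ 𝔽 up                     ≡⟨ cong (∑ 𝔽 up ℕ.+_) up≡down ⟩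
      ∑ 𝔽 up ℕ.+ ∑ 𝔽 (λ x → up (x + 1#))    ≡⟨ ∑-+ 𝔽 up _ ⟨
      ∑ 𝔽 (λ x → up x ℕ.+ up (x + 1#))      ≡⟨ ∑-cong 𝔽 up+down ⟩
      ∑ 𝔽 (λ _ → 1)                         ≡⟨ ∑-const 𝔽 1 ⟩
      length 𝔽 ℕ.* 1                        ≡⟨ ℕₚ.*-identityʳ _ ⟩
      length 𝔽                              ≡⟨ length-𝔽 ⟩
      q                                     ∎)))
      where
      open ≡.≡-Reasoning
      number = Inverse.to numbering
      -- Comparing numbers picks one element from each orbit {x , x + 1}, so q is twice the number
      -- of elements picked.
      up : Carrier → ℕ
      up x = ⟦ number x Finₚ.<? number (x + 1#) ⟧
      double : ∀ n → n ℕ.* 2 ≡ n ℕ.+ n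
      double = solve-∀
      up-resp : Respects₁ up
      up-resp x≈y = cong₂ (λ i j → ⟦ i Finₚ.<? j ⟧) (Inverse.to-cong numbering x≈y) (Inverse.to-cong numbering (+-congʳ x≈y))
      shift² : ∀ x → x + 1# + 1# ≈ x
      shift² x = trans (+-assoc x 1# 1#) (trans (+-congˡ 1+1≈0) (+-identityʳ x))
      up≡down : ∑ 𝔽 up ≡ ∑ 𝔽 (λ x → up (x + 1#))
      up≡down = ≡.sym (∑-bijective scalars (_+ 1#) (_+ 1#) +-congʳ +-congʳ shift² shift² up-resp)
      up+down : ∀ x → up x ℕ.+ up (x + 1#) ≡ 1
      up+down x rewrite Inverse.to-cong numbering (shift² x)
        with Finₚ.<-cmp (number x) (number (x + 1#))
      ... | tri< a _ c = cong₂ ℕ._+_ (⟦⟧-yes (_ Finₚ.<? _) a) (⟦⟧-no (_ Finₚ.<? _) c)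
      ... | tri> a _ c = cong₂ ℕ._+_ (⟦⟧-no (_ Finₚ.<? _) a) (⟦⟧-yes (_ Finₚ.<? _) c)
      ... | tri≈ _ e _ = contradiction (+-cancelˡ x _ _ (trans (sym (x≈x+1 e)) (sym (+-identityʳ x)))) 1≉0
        where
        x≈x+1 : number x ≡ number (x + 1#) → x ≈ x + 1#
        x≈x+1 e = trans (sym (Inverse.strictlyInverseʳ numbering x))
          (trans (Inverse.from-cong numbering e) (Inverse.strictlyInverseʳ numbering (x + 1#)))

    x+x≈0⇒x≈0 : ∀ {x} → x + x ≈ 0# → x ≈ 0#
    x+x≈0⇒x≈0 {x} x+x≈0 with zero-product {1# + 1#} {x}
      (trans (solve 1 (λ x → (con 1 :+ con 1) :* x := x :+ x) refl x) x+x≈0)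
    ... | inj₁ e = contradiction e 1+1≉0
    ... | inj₂ e = e

    3≤q : 3 ≤ q
    3≤q = bound q-odd (λ { ≡.refl → contradiction (Inverse.to numbering 0#) λ () }) q≢1
      where
      bound : ∀ {q} → ¬ 2 ∣ q → q ≢ 0 → q ≢ 1 → 3 ≤ q
      bound {0} _ h _ = contradiction ≡.refl h
      bound {1} _ _ h = contradiction ≡.refl h
      bound {2} h _ _ = contradiction ∣-refl h
      bound {suc (suc (suc _))} _ _ _ = s≤s (s≤s (s≤s z≤n))
      Fin1 : (i j : Fin 1) → i ≡ j
      Fin1 Fin.zero Fin.zero = ≡.refl
      q≢1 : q ≢ 1
      q≢1 e = 1≉0 (trans (sym (Inverse.strictlyInverseʳ numbering 1#)) (trans
        (Inverse.from-cong numbering (subst (λ n → (i j : Fin n) → i ≡ j) (≡.sym e) Fin1 _ _))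
        (Inverse.strictlyInverseʳ numbering 0#)))

    q-1 : ℕ
    q-1 = q ℕ.∸ 1

    1+q-1 : 1 ℕ.+ q-1 ≡ q
    1+q-1 = ℕₚ.m+[n∸m]≡n (ℕₚ.≤-trans (s≤s z≤n) 3≤q)

    -- This is 1 + χ(c) for the quadratic character χ, so that sums of characters stay in ℕ.
    sqrtCount : Carrier → ℕ
    sqrtCount c = ∑ 𝔽 (λ z → ⟦ z * z ≟ c ⟧)

    sqrtCount-resp : Respects₁ sqrtCount
    sqrtCount-resp c≈d = ∑-cong 𝔽 (λ z → ⟦⟧-cong (z * z ≟ _) (z * z ≟ _)
      (λ e → trans e c≈d) (λ e → trans e (sym c≈d)))

    sqrtCount-0 : ∀ {c} → c ≈ 0# → sqrtCount c ≡ 1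
    sqrtCount-0 c≈0 = ≡.trans (∑-cong 𝔽 (λ z → ⟦⟧-cong (z * z ≟ _) (z ≟ 0#)
      (λ e → square≈0 (trans e c≈0)) (λ e → trans (*-cong e e) (trans (zeroˡ 0#) (sym c≈0)))))
      (Enumerated.once scalars 0#)

    sqrtCount-square : ∀ {c} z → c ≈ z * z → ¬ c ≈ 0# → sqrtCount c ≡ 2
    sqrtCount-square {c} z c≈zz c≉0 = ≡.trans (∑-cong 𝔽 two-roots) (≡.trans (∑-+ 𝔽 _ _)
      (cong₂ ℕ._+_ (Enumerated.once scalars z) (Enumerated.once scalars (- z))))
      where
      z≉-z : ¬ z ≈ - z
      z≉-z e = c≉0 (trans c≈zz (trans (*-congʳ (x+x≈0⇒x≈0 (trans (+-congˡ e) (-‿inverseʳ z)))) (zeroˡ z)))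
      two-roots : ∀ y → ⟦ y * y ≟ c ⟧ ≡ ⟦ y ≟ z ⟧ ℕ.+ ⟦ y ≟ - z ⟧
      two-roots y with y ≟ z | y ≟ - z
      ... | yes e | yes e′ = contradiction (trans (sym e) e′) z≉-z
      ... | yes e | no _   = ⟦⟧-yes (_ ≟ _) (trans (*-cong e e) (sym c≈zz))
      ... | no _  | yes e  = ⟦⟧-yes (_ ≟ _) (trans (*-cong e e) (trans (neg-square z) (sym c≈zz)))
      ... | no h  | no h′  = ⟦⟧-no (_ ≟ _) (λ e → [ h , h′ ] (square-roots (trans e c≈zz)))

    IsNonSquare : Carrier → Set
    IsNonSquare c = ∀ a → ¬ c ≈ a * a

    sqrtCount-nonSquare : ∀ {c} → IsNonSquare c → sqrtCount c ≡ 0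
    sqrtCount-nonSquare ns = ∑-≡0 𝔽 (λ z → ⟦⟧-no (_ ≟ _) (λ e → ns z (sym e)))

    isSquare? : ∀ c → (∃ λ z → c ≈ z * z) ⊎ IsNonSquare c
    isSquare? c with ∃? (λ z → c ≟ z * z) (λ a≈b e → trans e (*-cong a≈b a≈b))
    ... | yes ez = inj₁ ez
    ... | no ¬ez = inj₂ (λ z e → ¬ez (z , e))

    sqrtCount≤2 : ∀ c → sqrtCount c ≤ 2
    sqrtCount≤2 c with c ≟ 0# | isSquare? c
    ... | yes c≈0 | _            = ℕₚ.≤-trans (ℕₚ.≤-reflexive (sqrtCount-0 c≈0)) (s≤s z≤n)
    ... | no c≉0  | inj₁ (z , e) = ℕₚ.≤-reflexive (sqrtCount-square z e c≉0)
    ... | no c≉0  | inj₂ ns      = ℕₚ.≤-trans (ℕₚ.≤-reflexive (sqrtCount-nonSquare ns)) z≤n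

    -- Each z is a square root of exactly one c. Thus `sqrtCount` has mean value 1, that is, χ sums
    -- to 0.
    ∑-sqrtCount : ∑ 𝔽 sqrtCount ≡ q
    ∑-sqrtCount = ≡.trans (∑-comm 𝔽 𝔽 _) (≡.trans (∑-cong 𝔽 (λ z → ≡.trans
      (∑-cong 𝔽 (λ c → ⟦⟧-cong (z * z ≟ c) (c ≟ z * z) sym sym)) (Enumerated.once scalars (z * z))))
      (≡.trans (∑-const 𝔽 1) (≡.trans (ℕₚ.*-identityʳ _) length-𝔽)))

-- Vectors over a finite field

module VectorSpace {q : ℕ} (F : FiniteField q) where
  open Field F public
  open Sum semiring public using (sum; sum-cong-≋; sum-remove; sum-replicate-zero; *-distribˡ-sum; ∑-distrib-+)
    renaming (∑-comm to sum-comm)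
  open VectorEquality setoid public using (_≋_; ≋-isEquivalence)

  infixl 8 _∙_
  _∙_ : ∀ {t} → Vector Carrier t → Vector Carrier t → Carrier
  _∙_ {t} = _·_ F t

  -- Built by recursion on t, so that a sum over vectors splits off its coordinates one at a time.
  vecs : ∀ t → List (Vector Carrier t)
  vecs zero    = V.[] ∷ []
  vecs (suc t) = map (uncurry V._∷_) (cartesianProduct 𝔽 (vecs t))

  ∑-vecs-suc : ∀ t (f : Vector Carrier (suc t) → ℕ) →
               ∑ (vecs (suc t)) f ≡ ∑ 𝔽 (λ a → ∑ (vecs t) (λ v → f (a V.∷ v)))
  ∑-vecs-suc t f = ≡.trans (∑-map _ (cartesianProduct 𝔽 (vecs t)) f) (∑-cartesianProduct 𝔽 (vecs t) _)

  ∑-𝔽-const : ∀ c → ∑ 𝔽 (λ _ → c) ≡ q ℕ.* c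
  ∑-𝔽-const c = ≡.trans (∑-const 𝔽 c) (cong (ℕ._* c) length-𝔽)

  ∑-vecs-const : ∀ t c → ∑ (vecs t) (λ _ → c) ≡ q ℕ.^ t ℕ.* c
  ∑-vecs-const zero    c = ≡.refl
  ∑-vecs-const (suc t) c = ≡.trans (∑-vecs-suc t _) (≡.trans (∑-cong 𝔽 (λ _ → ∑-vecs-const t c))
    (≡.trans (∑-𝔽-const _) (≡.sym (ℕₚ.*-assoc q (q ℕ.^ t) c))))

  abstract
    infix 4 _≋?_
    _≋?_ : ∀ {t} → Decidable (_≋_ {t})
    x ≋? y = Finₚ.all? (λ i → x i ≟ y i)

  vectorSpace : ℕ → Enumerated
  vectorSpace t = record
    { decSetoid = record { isDecEquivalence = record { isEquivalence = ≋-isEquivalence t ; _≟_ = _≋?_ } }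
    ; list      = vecs t
    ; once      = once t
    }
    where
    open ≡.≡-Reasoning
    once : ∀ t x → ∑ (vecs t) (λ y → ⟦ y ≋? x ⟧) ≡ 1
    once zero    x = cong (ℕ._+ 0) (⟦⟧-yes (V.[] ≋? x) (λ ()))
    once (suc t) x = begin
      ∑ (vecs (suc t)) (λ y → ⟦ y ≋? x ⟧)
        ≡⟨ ∑-vecs-suc t _ ⟩
      ∑ 𝔽 (λ a → ∑ (vecs t) (λ v → ⟦ a V.∷ v ≋? x ⟧))
        ≡⟨ ∑-cong 𝔽 (λ a → ∑-cong (vecs t) (λ v → ≡.trans
             (⟦⟧-cong (a V.∷ v ≋? x) ((a ≟ x Fin.zero) ×-dec (v ≋? V.tail x))
               (λ e → e Fin.zero , λ i → e (Fin.suc i))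
               (λ { (e , e′) → λ { Fin.zero → e ; (Fin.suc i) → e′ i } }))
             (⟦⟧-× (a ≟ x Fin.zero) (v ≋? V.tail x)))) ⟩
      ∑ 𝔽 (λ a → ∑ (vecs t) (λ v → ⟦ a ≟ x Fin.zero ⟧ ℕ.* ⟦ v ≋? V.tail x ⟧))
        ≡⟨ ∑-*-∑ 𝔽 (vecs t) _ _ ⟨
      ∑ 𝔽 (λ a → ⟦ a ≟ x Fin.zero ⟧) ℕ.* ∑ (vecs t) (λ v → ⟦ v ≋? V.tail x ⟧)
        ≡⟨ cong₂ ℕ._*_ (Enumerated.once scalars (x Fin.zero)) (once t (V.tail x)) ⟩
      1 ∎

  module _ {t : ℕ} where

    ∙-cong : ∀ {x x′ y y′ : Vector Carrier t} → x ≋ x′ → y ≋ y′ → x ∙ y ≈ x′ ∙ y′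
    ∙-cong = ·-cong F t

    ∙-comm : ∀ (x y : Vector Carrier t) → x ∙ y ≈ y ∙ x
    ∙-comm = ·-comm F t

    ∙-scaleˡ : ∀ a (x y : Vector Carrier t) → (λ i → a * x i) ∙ y ≈ a * (x ∙ y)
    ∙-scaleˡ = ·-scaleˡ F t

    ∙-scaleʳ : ∀ a (x y : Vector Carrier t) → x ∙ (λ i → a * y i) ≈ a * (x ∙ y)
    ∙-scaleʳ a x y = trans (∙-comm x _) (trans (∙-scaleˡ a y x) (*-congˡ (∙-comm y x)))

    ∙-+ʳ : ∀ (x y z : Vector Carrier t) → x ∙ (λ i → y i + z i) ≈ x ∙ y + x ∙ z
    ∙-+ʳ x y z = trans (sum-cong-≋ (λ i → distribˡ (x i) (y i) (z i))) (∑-distrib-+ (λ i → x i * y i) (λ i → x i * z i))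

  sum-single : ∀ {n} (f : Vector Carrier n) k → (∀ i → i ≢ k → f i ≈ 0#) → sum f ≈ f k
  sum-single {suc n} f k f≈0 = trans (sum-remove {i = k} f) (trans
    (+-congˡ (trans (sum-cong-≋ (λ i → f≈0 (Fin.punchIn k i) (Finₚ.punchInᵢ≢i k i))) (sum-replicate-zero n)))
    (+-identityʳ (f k)))

  combination : ∀ {s t} → (Fin s → Vector Carrier t) → Vector Carrier s → Vector Carrier t
  combination w y j = sum (λ i → y i * w i j)

  ∙-combination : ∀ {s t} (x : Vector Carrier t) (w : Fin s → Vector Carrier t) y →
                  x ∙ combination w y ≈ sum (λ i → y i * (x ∙ w i))
  ∙-combination x w y = begin
    sum (λ j → x j * sum (λ i → y i * w i j))
      ≈⟨ sum-cong-≋ (λ j → *-distribˡ-sum (x j) (λ i → y i * w i j)) ⟩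
    sum (λ j → sum (λ i → x j * (y i * w i j)))
      ≈⟨ sum-comm (λ j i → x j * (y i * w i j)) ⟩
    sum (λ i → sum (λ j → x j * (y i * w i j)))
      ≈⟨ sum-cong-≋ (λ i → sum-cong-≋ (λ j → solve 3 (λ a b c → a :* (b :* c) := b :* (a :* c)) refl (x j) (y i) (w i j))) ⟩
    sum (λ i → sum (λ j → y i * (x j * w i j)))
      ≈⟨ sum-cong-≋ (λ i → *-distribˡ-sum (y i) (λ j → x j * w i j)) ⟨
    sum (λ i → y i * (x ∙ w i)) ∎
    where open ≈-Reasoning

  -- Pairing with `w k` recovers the k-th coordinate up to the factor g, which makes `combination w`
  -- injective. On a finite space this stands in for the w i forming a basis.
  module OrthogonalBasis {t} (w : Fin t → Vector Carrier t) (g : Carrier) (g≉0 : ¬ g ≈ 0#)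
    (orthogonal : ∀ i j → i ≢ j → w i ∙ w j ≈ 0#) (norm : ∀ i → w i ∙ w i ≈ g) where

    coordinate : ∀ y k → w k ∙ combination w y ≈ y k * g
    coordinate y k = trans (∙-combination (w k) w y) (trans
      (sum-single (λ i → y i * (w k ∙ w i)) k
        (λ i i≢k → trans (*-congˡ (orthogonal k i (λ k≡i → i≢k (≡.sym k≡i)))) (zeroʳ _)))
      (*-congˡ (norm k)))

    combination-injective : ∀ {y y′} → combination w y ≋ combination w y′ → y ≋ y′
    combination-injective {y} {y′} e k = *-cancelˡ g g≉0 (trans (*-comm g (y k)) (trans (sym (coordinate y k)) (trans
      (∙-cong {x = w k} (λ _ → refl) e) (trans (coordinate y′ k) (*-comm (y′ k) g)))))

    combination-norm : ∀ y → combination w y ∙ combination w y ≈ g * (y ∙ y)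
    combination-norm y = begin
      combination w y ∙ combination w y              ≈⟨ ∙-combination (combination w y) w y ⟩
      sum (λ k → y k * (combination w y ∙ w k))
        ≈⟨ sum-cong-≋ (λ k → *-congˡ (trans (∙-comm (combination w y) (w k)) (coordinate y k))) ⟩
      sum (λ k → y k * (y k * g))
        ≈⟨ sum-cong-≋ (λ k → solve 2 (λ a g → a :* (a :* g) := g :* (a :* a)) refl (y k) g) ⟩
      sum (λ k → g * (y k * y k))                    ≈⟨ *-distribˡ-sum g (λ k → y k * y k) ⟨
      g * (y ∙ y)                                    ∎
      where open ≈-Reasoning

-- Values of the form x₁² + … + x_t²

module NormCounts {q : ℕ} (F : FiniteField q) (q-odd : ¬ 2 ∣ q) where
  open VectorSpace F public
  open OddField q-odd public

  ∑-≉0 : ∑ 𝔽 (λ a → ⟦ ¬? (a ≟ 0#) ⟧) ≡ q-1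
  ∑-≉0 = ℕₚ.suc-injective (begin
    1 ℕ.+ ∑ 𝔽 (λ a → ⟦ ¬? (a ≟ 0#) ⟧)
      ≡⟨ cong (ℕ._+ ∑ 𝔽 (λ a → ⟦ ¬? (a ≟ 0#) ⟧)) (Enumerated.once scalars 0#) ⟨
    ∑ 𝔽 (λ a → ⟦ a ≟ 0# ⟧) ℕ.+ ∑ 𝔽 (λ a → ⟦ ¬? (a ≟ 0#) ⟧)
      ≡⟨ ≡.trans (≡.sym (∑-+ 𝔽 _ _)) (∑-cong 𝔽 (λ a → ⟦⟧-¬ (a ≟ 0#))) ⟩
    ∑ 𝔽 (λ _ → 1)                                               ≡⟨ ≡.trans (∑-𝔽-const 1) (ℕₚ.*-identityʳ q) ⟩
    q                                                           ≡⟨ 1+q-1 ⟨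
    1 ℕ.+ q-1                                                   ∎)
    where open ≡.≡-Reasoning

  *-bijective : ∀ u → ¬ u ≈ 0# → ∀ {f} → Respects₁ f → ∑ 𝔽 (λ x → f (u * x)) ≡ ∑ 𝔽 f
  *-bijective u u≉0 = let (v , uv≈1) = inverse u u≉0 in
    ∑-bijective scalars (u *_) (v *_) *-congˡ *-congˡ (cancel u v uv≈1) (cancel v u (trans (*-comm v u) uv≈1))
    where
    cancel : ∀ a b → a * b ≈ 1# → ∀ x → a * (b * x) ≈ x
    cancel a b ab≈1 x = trans (sym (*-assoc a b x)) (trans (*-congʳ ab≈1) (*-identityˡ x))

  -- Substituting s z for z matches the roots of s² d with those of d.
  sqrtCount-*square : ∀ s → ¬ s ≈ 0# → ∀ d → sqrtCount (s * s * d) ≡ sqrtCount d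
  sqrtCount-*square s s≉0 d = ≡.trans
    (≡.sym (*-bijective s s≉0 (λ {x} {y} x≈y → ⟦⟧-cong (x * x ≟ s * s * d) (y * y ≟ s * s * d)
      (trans (sym (*-cong x≈y x≈y))) (trans (*-cong x≈y x≈y)))))
    (∑-cong 𝔽 (λ z → ⟦⟧-cong (s * z * (s * z) ≟ s * s * d) (z * z ≟ d)
      (λ e → *-cancelˡ (s * s) (*-≉0 s≉0 s≉0) (trans (sym (rearrange s z)) e))
      (λ e → trans (rearrange s z) (*-congˡ e))))
    where
    rearrange : ∀ s z → s * z * (s * z) ≈ s * s * (z * z)
    rearrange = solve 2 (λ s z → s :* z :* (s :* z) := s :* s :* (z :* z)) refl

  nonSquare⇒≉0 : ∀ {g} → IsNonSquare g → ¬ g ≈ 0#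
  nonSquare⇒≉0 g-ns g≈0 = g-ns 0# (trans g≈0 (sym (zeroˡ 0#)))

  nonSquare-*square : ∀ {g} → IsNonSquare g → ∀ z → ¬ z ≈ 0# → IsNonSquare (g * (z * z))
  nonSquare-*square {g} g-ns z z≉0 a e = let (w , zw≈1) = inverse z z≉0 in g-ns (a * w) (begin
    g                               ≈⟨ *-identityʳ g ⟨
    g * 1#                          ≈⟨ *-congˡ (trans (sym (*-identityˡ 1#)) (sym (*-cong zw≈1 zw≈1))) ⟩
    g * (z * w * (z * w))
      ≈⟨ solve 3 (λ g z w → g :* (z :* w :* (z :* w)) := g :* (z :* z) :* (w :* w)) refl g z w ⟩
    g * (z * z) * (w * w)           ≈⟨ *-congʳ e ⟩
    a * a * (w * w)                 ≈⟨ solve 2 (λ a w → a :* a :* (w :* w) := a :* w :* (a :* w)) refl a w ⟩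
    a * w * (a * w)                 ∎)
    where open ≈-Reasoning

  -- This is χ(g d) = - χ(d). The sum is at most 2 for every d, since g times a nonzero square is a
  -- non-square; as `sqrtCount` has mean 1, the sum has mean 2 over all d, so equality holds
  -- everywhere.
  sqrtCount-complement : ∀ {g} → IsNonSquare g → ∀ d → sqrtCount d ℕ.+ sqrtCount (g * d) ≡ 2
  sqrtCount-complement {g} g-ns = Enumerated.∑≡⇒≗ scalars
    (λ x≈y → cong₂ ℕ._+_ (sqrtCount-resp x≈y) (sqrtCount-resp (*-congˡ x≈y))) (λ _ → ≡.refl)
    at-most-2 (begin
      ∑ 𝔽 (λ d → sqrtCount d ℕ.+ sqrtCount (g * d))        ≡⟨ ∑-+ 𝔽 sqrtCount _ ⟩
      ∑ 𝔽 sqrtCount ℕ.+ ∑ 𝔽 (λ d → sqrtCount (g * d))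
        ≡⟨ cong (∑ 𝔽 sqrtCount ℕ.+_) (*-bijective g (nonSquare⇒≉0 g-ns) sqrtCount-resp) ⟩
      ∑ 𝔽 sqrtCount ℕ.+ ∑ 𝔽 sqrtCount                      ≡⟨ cong₂ ℕ._+_ ∑-sqrtCount ∑-sqrtCount ⟩
      q ℕ.+ q                                              ≡⟨ double q ⟩
      q ℕ.* 2                                              ≡⟨ ∑-𝔽-const 2 ⟨
      ∑ 𝔽 (λ _ → 2)                                        ∎)
    where
    open ≡.≡-Reasoning
    double : ∀ n → n ℕ.+ n ≡ n ℕ.* 2
    double = solve-∀
    at-most-2 : ∀ d → sqrtCount d ℕ.+ sqrtCount (g * d) ≤ 2
    at-most-2 d with d ≟ 0# | isSquare? d
    ... | yes d≈0 | _            = ℕₚ.≤-reflexive (cong₂ ℕ._+_ (sqrtCount-0 d≈0) (sqrtCount-0 (trans (*-congˡ d≈0) (zeroʳ g))))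
    ... | no _    | inj₂ d-ns    = ℕₚ.≤-trans (ℕₚ.≤-reflexive (cong (ℕ._+ sqrtCount (g * d)) (sqrtCount-nonSquare d-ns))) (sqrtCount≤2 (g * d))
    ... | no d≉0  | inj₁ (z , e) = ℕₚ.≤-reflexive (cong₂ ℕ._+_ (sqrtCount-square z e d≉0) (sqrtCount-nonSquare
            (λ a e′ → nonSquare-*square g-ns z (λ z≈0 → d≉0 (trans e (trans (*-congʳ z≈0) (zeroˡ z)))) a
              (trans (*-congˡ (sym e)) e′))))

  -- The non-squares form a single coset of the nonzero squares: if g/h were a non-square, both
  -- counts in `sqrtCount-complement` for h at the point g/h would vanish instead of adding up to 2.
  nonSquare-ratio : ∀ {g h} → IsNonSquare g → IsNonSquare h → ∃ λ s → s * s * h ≈ g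
  nonSquare-ratio {g} {h} g-ns h-ns with inverse h (nonSquare⇒≉0 h-ns)
  ... | k , hk≈1 with isSquare? (k * g)
  ...   | inj₁ (s , kg≈ss) = s , trans (*-congʳ (sym kg≈ss)) (h*kg h k g hk≈1)
    where
    h*kg : ∀ h k g → h * k ≈ 1# → k * g * h ≈ g
    h*kg h k g hk≈1 = trans (solve 3 (λ h k g → k :* g :* h := h :* k :* g) refl h k g) (trans (*-congʳ hk≈1) (*-identityˡ g))
  ...   | inj₂ kg-ns = contradiction (≡.trans (≡.sym (cong₂ ℕ._+_ (sqrtCount-nonSquare kg-ns)
            (sqrtCount-nonSquare (λ a e → g-ns a (trans (sym (h*kg h k g hk≈1)) e))))) (sqrtCount-complement h-ns (k * g))) λ ()
    where
    h*kg : ∀ h k g → h * k ≈ 1# → h * (k * g) ≈ g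
    h*kg h k g hk≈1 = trans (sym (*-assoc h k g)) (trans (*-congʳ hk≈1) (*-identityˡ g))

  -- Representations as a sum of two squares

  sumOfTwoSquares : Carrier → ℕ
  sumOfTwoSquares c = ∑ 𝔽 (λ a → ∑ 𝔽 (λ b → ⟦ a * a + b * b ≟ c ⟧))

  sumOfTwoSquares-convolution : ∀ c → sumOfTwoSquares c ≡ ∑ 𝔽 (λ d → sqrtCount d ℕ.* sqrtCount (c - d))
  sumOfTwoSquares-convolution c = begin
    ∑ 𝔽 (λ a → ∑ 𝔽 (λ b → ⟦ a * a + b * b ≟ c ⟧))
      ≡⟨ ∑-cong 𝔽 (λ a → ∑-cong 𝔽 (λ b → ⟦⟧-cong (a * a + b * b ≟ c) (b * b ≟ c - a * a) (solveFor a b) (unsolveFor a b))) ⟩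
    ∑ 𝔽 (λ a → sqrtCount (c - a * a))
      ≡⟨ ∑-cong 𝔽 (λ a → Enumerated.∑-δ scalars (a * a) (λ x≈y → sqrtCount-resp (+-congˡ (-‿cong x≈y)))) ⟨
    ∑ 𝔽 (λ a → ∑ 𝔽 (λ d → ⟦ d ≟ a * a ⟧ ℕ.* sqrtCount (c - d)))
      ≡⟨ ∑-comm 𝔽 𝔽 _ ⟩
    ∑ 𝔽 (λ d → ∑ 𝔽 (λ a → ⟦ d ≟ a * a ⟧ ℕ.* sqrtCount (c - d)))
      ≡⟨ ∑-cong 𝔽 (λ d → ≡.trans (∑-*ʳ 𝔽 _ _) (cong (ℕ._* sqrtCount (c - d))
           (∑-cong 𝔽 (λ a → ⟦⟧-cong (d ≟ a * a) (a * a ≟ d) sym sym)))) ⟩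
    ∑ 𝔽 (λ d → sqrtCount d ℕ.* sqrtCount (c - d))
      ∎
    where
    open ≡.≡-Reasoning
    solveFor : ∀ a b → a * a + b * b ≈ c → b * b ≈ c - a * a
    solveFor a b e = +-cancelˡ (a * a) _ _ (trans e (sym (x+[y-x]≈y (a * a) c)))
    unsolveFor : ∀ a b → b * b ≈ c - a * a → a * a + b * b ≈ c
    unsolveFor a b e = trans (+-congˡ e) (x+[y-x]≈y (a * a) c)

  sumOfTwoSquares-scale : ∀ u → ¬ u ≈ 0# → sumOfTwoSquares u ≡
                          ∑ 𝔽 (λ d → sqrtCount (u * d) ℕ.* sqrtCount (u * (1# - d)))
  sumOfTwoSquares-scale u u≉0 = ≡.trans (sumOfTwoSquares-convolution u) (≡.trans
    (≡.sym (*-bijective u u≉0 (λ x≈y → cong₂ ℕ._*_ (sqrtCount-resp x≈y) (sqrtCount-resp (+-congˡ (-‿cong x≈y))))))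
    (∑-cong 𝔽 (λ d → cong (sqrtCount (u * d) ℕ.*_) (sqrtCount-resp (factor u d)))))
    where
    factor : ∀ u d → u - u * d ≈ u * (1# - d)
    factor u d = trans (+-cong (sym (*-identityʳ u)) (-‿distribʳ-* u d)) (sym (distribˡ u 1# (- d)))

  -- For u a nonsquare, (2 − r)(2 − s) = 4 − 2r − 2s + rs, and the sqrtCounts r and s have mean value 1.
  sumOfTwoSquares-nonzero : ∀ u → ¬ u ≈ 0# → sumOfTwoSquares u ≡ sumOfTwoSquares 1#
  sumOfTwoSquares-nonzero u u≉0 with isSquare? u
  ... | inj₁ (s , u≈ss) = begin
    sumOfTwoSquares u                                                   ≡⟨ sumOfTwoSquares-scale u u≉0 ⟩
    ∑ 𝔽 (λ d → sqrtCount (u * d) ℕ.* sqrtCount (u * (1# - d)))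
      ≡⟨ ∑-cong 𝔽 (λ d → cong₂ ℕ._*_ (unscale d) (unscale (1# - d))) ⟩
    ∑ 𝔽 (λ d → sqrtCount d ℕ.* sqrtCount (1# - d))                      ≡⟨ sumOfTwoSquares-convolution 1# ⟨
    sumOfTwoSquares 1#                                                  ∎
    where
    open ≡.≡-Reasoning
    s≉0 : ¬ s ≈ 0#
    s≉0 s≈0 = u≉0 (trans u≈ss (trans (*-congʳ s≈0) (zeroˡ s)))
    unscale : ∀ d → sqrtCount (u * d) ≡ sqrtCount d
    unscale d = ≡.trans (sqrtCount-resp (*-congʳ u≈ss)) (sqrtCount-*square s s≉0 d)
  -- The sum of 2 (r + s) over all d is 4 q by the mean values. Adding it on the left and 4 q on the
  -- right turns the expansion of (2 - r) (2 - s) into an identity in ℕ.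
  ... | inj₂ u-ns = ℕₚ.+-cancelʳ-≡ (q ℕ.* 4) _ _ (begin
    sumOfTwoSquares u ℕ.+ q ℕ.* 4
      ≡⟨ cong₂ ℕ._+_ (sumOfTwoSquares-scale u u≉0) (≡.sym means) ⟩
    ∑ 𝔽 (λ d → sqrtCount (u * d) ℕ.* sqrtCount (u * (1# - d))) ℕ.+ ∑ 𝔽 (λ d → 2 ℕ.* (sqrtCount d ℕ.+ sqrtCount (1# - d)))
      ≡⟨ ∑-+ 𝔽 _ _ ⟨
    ∑ 𝔽 (λ d → sqrtCount (u * d) ℕ.* sqrtCount (u * (1# - d)) ℕ.+ 2 ℕ.* (sqrtCount d ℕ.+ sqrtCount (1# - d)))
      ≡⟨ ∑-cong 𝔽 (λ d → complements (sqrtCount d) (sqrtCount (u * d)) (sqrtCount (1# - d)) (sqrtCount (u * (1# - d)))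
           (sqrtCount-complement u-ns d) (sqrtCount-complement u-ns (1# - d))) ⟩
    ∑ 𝔽 (λ d → sqrtCount d ℕ.* sqrtCount (1# - d) ℕ.+ 4)
      ≡⟨ ∑-+ 𝔽 _ _ ⟩
    ∑ 𝔽 (λ d → sqrtCount d ℕ.* sqrtCount (1# - d)) ℕ.+ ∑ 𝔽 (λ _ → 4)
      ≡⟨ cong₂ ℕ._+_ (≡.sym (sumOfTwoSquares-convolution 1#)) (∑-𝔽-const 4) ⟩
    sumOfTwoSquares 1# ℕ.+ q ℕ.* 4
      ∎)
    where
    open ≡.≡-Reasoning
    complements : ∀ r r′ s s′ → r ℕ.+ r′ ≡ 2 → s ℕ.+ s′ ≡ 2 → r′ ℕ.* s′ ℕ.+ 2 ℕ.* (r ℕ.+ s) ≡ r ℕ.* s ℕ.+ 4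
    complements r r′ s s′ r+r′≡2 s+s′≡2 = begin
      r′ ℕ.* s′ ℕ.+ 2 ℕ.* (r ℕ.+ s)
        ≡⟨ cong (λ n → r′ ℕ.* s′ ℕ.+ n) (≡.trans (ℕₚ.*-distribˡ-+ 2 r s) (cong₂ (λ m n → m ℕ.* r ℕ.+ n ℕ.* s) (≡.sym s+s′≡2) (≡.sym r+r′≡2))) ⟩
      r′ ℕ.* s′ ℕ.+ ((s ℕ.+ s′) ℕ.* r ℕ.+ (r ℕ.+ r′) ℕ.* s)      ≡⟨ expand r r′ s s′ ⟩
      r ℕ.* s ℕ.+ (r ℕ.+ r′) ℕ.* (s ℕ.+ s′)                      ≡⟨ cong₂ (λ m n → r ℕ.* s ℕ.+ m ℕ.* n) r+r′≡2 s+s′≡2 ⟩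
      r ℕ.* s ℕ.+ 4                                              ∎
      where
      expand : ∀ r r′ s s′ → r′ ℕ.* s′ ℕ.+ ((s ℕ.+ s′) ℕ.* r ℕ.+ (r ℕ.+ r′) ℕ.* s) ≡ r ℕ.* s ℕ.+ (r ℕ.+ r′) ℕ.* (s ℕ.+ s′)
      expand = solve-∀
    reflect : ∀ d → 1# - (1# - d) ≈ d
    reflect d = +-cancelʳ (1# - d) _ _ (trans (trans (+-assoc 1# _ _) (trans (+-congˡ (-‿inverseˡ (1# - d))) (+-identityʳ 1#)))
      (sym (x+[y-x]≈y d 1#)))
    means : ∑ 𝔽 (λ d → 2 ℕ.* (sqrtCount d ℕ.+ sqrtCount (1# - d))) ≡ q ℕ.* 4
    means = begin
      ∑ 𝔽 (λ d → 2 ℕ.* (sqrtCount d ℕ.+ sqrtCount (1# - d)))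
        ≡⟨ ≡.trans (∑-*ˡ 𝔽 2 _) (cong (2 ℕ.*_) (∑-+ 𝔽 sqrtCount _)) ⟩
      2 ℕ.* (∑ 𝔽 sqrtCount ℕ.+ ∑ 𝔽 (λ d → sqrtCount (1# - d)))    ≡⟨ cong (λ n → 2 ℕ.* (∑ 𝔽 sqrtCount ℕ.+ n))
           (∑-bijective scalars (λ d → 1# - d) (λ d → 1# - d) (λ e → +-congˡ (-‿cong e)) (λ e → +-congˡ (-‿cong e)) reflect reflect sqrtCount-resp) ⟩
      2 ℕ.* (∑ 𝔽 sqrtCount ℕ.+ ∑ 𝔽 sqrtCount)                     ≡⟨ cong (λ n → 2 ℕ.* (n ℕ.+ n)) ∑-sqrtCount ⟩
      2 ℕ.* (q ℕ.+ q)                                             ≡⟨ quadruple q ⟩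
      q ℕ.* 4                                                     ∎
      where
      quadruple : ∀ n → 2 ℕ.* (n ℕ.+ n) ≡ n ℕ.* 4
      quadruple = solve-∀

  -- Otherwise all q values agree with their mean q, whereas the value at 0 is 1 or 2q − 1.
  sumOfTwoSquares-0≢1 : sumOfTwoSquares 0# ≢ sumOfTwoSquares 1#
  sumOfTwoSquares-0≢1 m₀≡m₁ = q≢1 (by-minus-one (isSquare? (- 1#)))
    where
    open ≡.≡-Reasoning
    q≢1 : q ≢ 1
    q≢1 q≡1 = ℕₚ.<⇒≱ {1} {3} (s≤s (s≤s z≤n)) (subst (3 ≤_) q≡1 3≤q)
    q≢0 : q ≢ 0
    q≢0 q≡0 = ℕₚ.<⇒≱ {0} {3} (s≤s z≤n) (subst (3 ≤_) q≡0 3≤q)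
    total : ∑ 𝔽 sumOfTwoSquares ≡ q ℕ.* q
    total = begin
      ∑ 𝔽 (λ c → ∑ 𝔽 (λ a → ∑ 𝔽 (λ b → ⟦ a * a + b * b ≟ c ⟧)))  ≡⟨ ∑-comm 𝔽 𝔽 _ ⟩
      ∑ 𝔽 (λ a → ∑ 𝔽 (λ c → ∑ 𝔽 (λ b → ⟦ a * a + b * b ≟ c ⟧)))
        ≡⟨ ∑-cong 𝔽 (λ a → ≡.trans (∑-comm 𝔽 𝔽 _) (∑-cong 𝔽 (λ b → ≡.trans
           (∑-cong 𝔽 (λ c → ⟦⟧-cong (_ ≟ c) (c ≟ _) sym sym)) (Enumerated.once scalars _)))) ⟩
      ∑ 𝔽 (λ a → ∑ 𝔽 (λ b → 1))
        ≡⟨ ≡.trans (∑-cong 𝔽 (λ _ → ≡.trans (∑-𝔽-const 1) (ℕₚ.*-identityʳ q))) (∑-𝔽-const q) ⟩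
      q ℕ.* q                                                    ∎
    constant : ∀ c → sumOfTwoSquares c ≡ sumOfTwoSquares 0#
    constant c with c ≟ 0#
    ... | yes c≈0 = ∑-cong 𝔽 (λ a → ∑-cong 𝔽 (λ b → ⟦⟧-cong (_ ≟ c) (_ ≟ 0#) (λ e → trans e c≈0) (λ e → trans e (sym c≈0))))
    ... | no c≉0  = ≡.trans (sumOfTwoSquares-nonzero c c≉0) (≡.sym m₀≡m₁)
    m₀≡q : sumOfTwoSquares 0# ≡ q
    m₀≡q = ℕₚ.*-cancelˡ-≡ _ _ q {{ℕ.≢-nonZero q≢0}}
      (≡.trans (≡.sym (≡.trans (∑-cong 𝔽 constant) (∑-𝔽-const _))) total)
    0-d : ∀ d → 0# - d ≈ - 1# * d
    0-d d = trans (+-identityˡ _) (trans (-‿cong (sym (*-identityˡ d))) (-‿distribˡ-* 1# d))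
    m₀ : sumOfTwoSquares 0# ≡ ∑ 𝔽 (λ d → sqrtCount d ℕ.* sqrtCount (- 1# * d))
    m₀ = ≡.trans (sumOfTwoSquares-convolution 0#) (∑-cong 𝔽 (λ d → cong (sqrtCount d ℕ.*_) (sqrtCount-resp (0-d d))))
    -1≉0 : ¬ - 1# ≈ 0#
    -1≉0 e = 1≉0 (trans (sym (-‿involutive 1#)) (trans (-‿cong e) -0#≈0#))
    value : ∀ d → (d ≈ 0# × sqrtCount d ≡ 1) ⊎ (¬ d ≈ 0# × (sqrtCount d ≡ 0 ⊎ sqrtCount d ≡ 2))
    value d with d ≟ 0# | isSquare? d
    ... | yes d≈0 | _            = inj₁ (d≈0 , sqrtCount-0 d≈0)
    ... | no d≉0  | inj₁ (z , e) = inj₂ (d≉0 , inj₂ (sqrtCount-square z e d≉0))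
    ... | no d≉0  | inj₂ ns      = inj₂ (d≉0 , inj₁ (sqrtCount-nonSquare ns))
    by-minus-one : (∃ λ i → - 1# ≈ i * i) ⊎ IsNonSquare (- 1#) → q ≡ 1
    -- Now d and - d have the same count r, and r² + [d = 0] = 2 r for each of r = 0, 1, 2, where r
    -- = 1 exactly at d = 0. Summing over d gives q + 1 = 2 q.
    by-minus-one (inj₁ (i , -1≈ii)) = ≡.sym (ℕₚ.+-cancelˡ-≡ q _ _ (begin
      q ℕ.+ 1
        ≡⟨ cong₂ ℕ._+_ (≡.trans (≡.sym m₀≡q) m₀) (≡.sym (Enumerated.once scalars 0#)) ⟩
      ∑ 𝔽 (λ d → sqrtCount d ℕ.* sqrtCount (- 1# * d)) ℕ.+ ∑ 𝔽 (λ d → ⟦ d ≟ 0# ⟧)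
        ≡⟨ ∑-+ 𝔽 _ _ ⟨
      ∑ 𝔽 (λ d → sqrtCount d ℕ.* sqrtCount (- 1# * d) ℕ.+ ⟦ d ≟ 0# ⟧)
        ≡⟨ ∑-cong 𝔽 (λ d → ≡.trans (cong (λ n → sqrtCount d ℕ.* n ℕ.+ ⟦ d ≟ 0# ⟧) (same d)) (byCase d (value d))) ⟩
      ∑ 𝔽 (λ d → sqrtCount d ℕ.+ sqrtCount d)
        ≡⟨ ≡.trans (∑-+ 𝔽 _ _) (cong₂ ℕ._+_ ∑-sqrtCount ∑-sqrtCount) ⟩
      q ℕ.+ q
        ∎))
      where
      same : ∀ d → sqrtCount (- 1# * d) ≡ sqrtCount d
      same d = ≡.trans (sqrtCount-resp (*-congʳ -1≈ii))
        (sqrtCount-*square i (λ i≈0 → -1≉0 (trans -1≈ii (trans (*-congʳ i≈0) (zeroˡ i)))) d)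
      byCase : ∀ d → _ → sqrtCount d ℕ.* sqrtCount d ℕ.+ ⟦ d ≟ 0# ⟧ ≡ sqrtCount d ℕ.+ sqrtCount d
      byCase d (inj₁ (d≈0 , e))        rewrite e | ⟦⟧-yes (d ≟ 0#) d≈0 = ≡.refl
      byCase d (inj₂ (d≉0 , inj₁ e))   rewrite e | ⟦⟧-no (d ≟ 0#) d≉0  = ≡.refl
      byCase d (inj₂ (d≉0 , inj₂ e))   rewrite e | ⟦⟧-no (d ≟ 0#) d≉0  = ≡.refl
    -- The counts at d and - d add up to 2, so they are 1 and 1 at d = 0 and otherwise 0 and 2 in
    -- some order: the product is [d = 0].
    by-minus-one (inj₂ -1-ns) = begin
      q                                                   ≡⟨ ≡.trans (≡.sym m₀≡q) m₀ ⟩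
      ∑ 𝔽 (λ d → sqrtCount d ℕ.* sqrtCount (- 1# * d))
        ≡⟨ ∑-cong 𝔽 (λ d → byCase d (value d) (sqrtCount-complement -1-ns d)) ⟩
      ∑ 𝔽 (λ d → ⟦ d ≟ 0# ⟧)                              ≡⟨ Enumerated.once scalars 0# ⟩
      1                                                   ∎
      where
      byCase : ∀ d → _ → sqrtCount d ℕ.+ sqrtCount (- 1# * d) ≡ 2 → sqrtCount d ℕ.* sqrtCount (- 1# * d) ≡ ⟦ d ≟ 0# ⟧
      byCase d (inj₁ (d≈0 , e))        sum≡2 rewrite e | ⟦⟧-yes (d ≟ 0#) d≈0 = ≡.trans (ℕₚ.*-identityˡ _) (ℕₚ.suc-injective sum≡2)
      byCase d (inj₂ (d≉0 , inj₁ e))   sum≡2 rewrite e | ⟦⟧-no (d ≟ 0#) d≉0  = ≡.refl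
      byCase d (inj₂ (d≉0 , inj₂ e))   sum≡2 rewrite e | ⟦⟧-no (d ≟ 0#) d≉0  = cong (2 ℕ.*_) (ℕₚ.suc-injective (ℕₚ.suc-injective sum≡2))

  normCount : ℕ → Carrier → ℕ
  normCount t c = ∑ (vecs t) (λ v → ⟦ v ∙ v ≟ c ⟧)

  normCount-1 : ∀ c → normCount 1 c ≡ sqrtCount c
  normCount-1 c = ≡.trans (∑-vecs-suc 0 _) (∑-cong 𝔽 (λ a → ≡.trans (ℕₚ.+-identityʳ _)
    (⟦⟧-cong (a * a + 0# ≟ c) (a * a ≟ c) (trans (sym (+-identityʳ _))) (trans (+-identityʳ _)))))

  -- When the other t coordinates form v, the two split off have `sumOfTwoSquares (c - v ∙ v)`
  -- possible values, which is m₀ if v ∙ v = c and m₁ otherwise. The term - m₁ `normCount t c` is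
  -- moved to the left.
  normCount-2+ : ∀ t c → normCount (2 ℕ.+ t) c ℕ.+ normCount t c ℕ.* sumOfTwoSquares 1# ≡
                         normCount t c ℕ.* sumOfTwoSquares 0# ℕ.+ q ℕ.^ t ℕ.* sumOfTwoSquares 1#
  normCount-2+ t c = begin
    normCount (2 ℕ.+ t) c ℕ.+ normCount t c ℕ.* m₁
      ≡⟨ cong₂ ℕ._+_ unfolded (≡.sym (∑-*ʳ (vecs t) _ m₁)) ⟩
    ∑ (vecs t) (λ v → sumOfTwoSquares (c - v ∙ v)) ℕ.+ ∑ (vecs t) (λ v → ⟦ v ∙ v ≟ c ⟧ ℕ.* m₁)
      ≡⟨ ∑-+ (vecs t) _ _ ⟨
    ∑ (vecs t) (λ v → sumOfTwoSquares (c - v ∙ v) ℕ.+ ⟦ v ∙ v ≟ c ⟧ ℕ.* m₁)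
      ≡⟨ ∑-cong (vecs t) (λ v → by-value (v ∙ v)) ⟩
    ∑ (vecs t) (λ v → ⟦ v ∙ v ≟ c ⟧ ℕ.* m₀ ℕ.+ m₁)
      ≡⟨ ∑-+ (vecs t) _ _ ⟩
    ∑ (vecs t) (λ v → ⟦ v ∙ v ≟ c ⟧ ℕ.* m₀) ℕ.+ ∑ (vecs t) (λ _ → m₁)
      ≡⟨ cong₂ ℕ._+_ (∑-*ʳ (vecs t) _ m₀) (∑-vecs-const t m₁) ⟩
    normCount t c ℕ.* m₀ ℕ.+ q ℕ.^ t ℕ.* m₁
      ∎
    where
    open ≡.≡-Reasoning
    m₀ = sumOfTwoSquares 0#
    m₁ = sumOfTwoSquares 1#
    sumOfTwoSquares-resp : ∀ {x y} → x ≈ y → sumOfTwoSquares x ≡ sumOfTwoSquares y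
    sumOfTwoSquares-resp x≈y = ∑-cong 𝔽 (λ a → ∑-cong 𝔽 (λ b → ⟦⟧-cong (_ ≟ _) (_ ≟ _) (λ e → trans e x≈y) (λ e → trans e (sym x≈y))))
    by-value : ∀ n → sumOfTwoSquares (c - n) ℕ.+ ⟦ n ≟ c ⟧ ℕ.* m₁ ≡ ⟦ n ≟ c ⟧ ℕ.* m₀ ℕ.+ m₁
    by-value n with n ≟ c
    ... | yes n≈c = cong₂ ℕ._+_ (≡.trans (sumOfTwoSquares-resp (trans (+-congˡ (-‿cong n≈c)) (-‿inverseʳ c))) (≡.sym (ℕₚ.*-identityˡ m₀))) (ℕₚ.*-identityˡ m₁)
    ... | no n≉c  = ≡.trans (ℕₚ.+-identityʳ _) (sumOfTwoSquares-nonzero (c - n) (λ e → n≉c (sym (x-y≈0⇒x≈y e))))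
    move : ∀ a b n → a * a + (b * b + n) ≈ a * a + b * b + n
    move a b n = sym (+-assoc _ _ n)
    unfolded : normCount (2 ℕ.+ t) c ≡ ∑ (vecs t) (λ v → sumOfTwoSquares (c - v ∙ v))
    unfolded = begin
      normCount (2 ℕ.+ t) c
        ≡⟨ ≡.trans (∑-vecs-suc (suc t) _) (∑-cong 𝔽 (λ a → ∑-vecs-suc t _)) ⟩
      ∑ 𝔽 (λ a → ∑ 𝔽 (λ b → ∑ (vecs t) (λ v → ⟦ a * a + (b * b + v ∙ v) ≟ c ⟧)))
        ≡⟨ ≡.trans (∑-cong 𝔽 (λ a → ∑-comm 𝔽 (vecs t) _)) (∑-comm 𝔽 (vecs t) _) ⟩
      ∑ (vecs t) (λ v → ∑ 𝔽 (λ a → ∑ 𝔽 (λ b → ⟦ a * a + (b * b + v ∙ v) ≟ c ⟧)))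
        ≡⟨ ∑-cong (vecs t) (λ v → ∑-cong 𝔽 (λ a → ∑-cong 𝔽 (λ b → ⟦⟧-cong (_ ≟ c) (_ ≟ c - v ∙ v)
             (λ e → +-cancelˡ (v ∙ v) _ _ (trans (+-comm _ _) (trans (sym (move a b (v ∙ v))) (trans e (sym (x+[y-x]≈y (v ∙ v) c))))))
             (λ e → trans (move a b (v ∙ v)) (trans (+-comm _ _) (trans (+-congˡ e) (x+[y-x]≈y (v ∙ v) c))))))) ⟩
      ∑ (vecs t) (λ v → sumOfTwoSquares (c - v ∙ v))
        ∎

  -- By normCount-2+, the difference of two values is multiplied by sumOfTwoSquares 0# − sumOfTwoSquares 1# ≠ 0 as t grows by 2.
  normCount-odd : ∀ k {g} → IsNonSquare g → normCount (1 ℕ.+ k ℕ.* 2) 1# ≢ normCount (1 ℕ.+ k ℕ.* 2) g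
  normCount-odd zero {g} g-ns e = contradiction
    (≡.trans (≡.sym (sqrtCount-square 1# (sym (*-identityˡ 1#)) 1≉0)) (≡.trans (≡.sym (normCount-1 1#)) (≡.trans e
      (≡.trans (normCount-1 g) (sqrtCount-nonSquare g-ns))))) λ ()
  normCount-odd (suc k) {g} g-ns e = normCount-odd k g-ns (cross _ _ _ _ sumOfTwoSquares-0≢1
    (shuffle (normCount (1 ℕ.+ suc k ℕ.* 2) 1#) (normCount (1 ℕ.+ k ℕ.* 2) 1#) (normCount (1 ℕ.+ k ℕ.* 2) g)
      (sumOfTwoSquares 0#) (sumOfTwoSquares 1#) (q ℕ.^ (1 ℕ.+ k ℕ.* 2) ℕ.* sumOfTwoSquares 1#) e (normCount-2+ (1 ℕ.+ k ℕ.* 2) 1#) (normCount-2+ (1 ℕ.+ k ℕ.* 2) g)))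
    where
    -- The hypothesis is (a - b) (m - n) = 0. Lowering m and n together keeps it until one of them
    -- is 0.
    cross : ∀ m n a b → m ≢ n → a ℕ.* m ℕ.+ b ℕ.* n ≡ b ℕ.* m ℕ.+ a ℕ.* n → a ≡ b
    cross zero    zero    a b m≢n e = contradiction ≡.refl m≢n
    cross zero    (suc n) a b m≢n e = ≡.sym (ℕₚ.*-cancelʳ-≡ b a (suc n)
      (≡.trans (cong (ℕ._+ b ℕ.* suc n) (≡.sym (ℕₚ.*-zeroʳ a))) (≡.trans e (cong (ℕ._+ a ℕ.* suc n) (ℕₚ.*-zeroʳ b)))))
    cross (suc m) zero    a b m≢n e = ℕₚ.*-cancelʳ-≡ a b (suc m)
      (≡.trans (≡.sym (ℕₚ.+-identityʳ _)) (≡.trans (cong (a ℕ.* suc m ℕ.+_) (≡.sym (ℕₚ.*-zeroʳ b))) (≡.trans e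
        (≡.trans (cong (b ℕ.* suc m ℕ.+_) (ℕₚ.*-zeroʳ a)) (ℕₚ.+-identityʳ _)))))
    cross (suc m) (suc n) a b m≢n e = cross m n a b (λ m≡n → m≢n (cong suc m≡n))
      (ℕₚ.+-cancelˡ-≡ (a ℕ.+ b) _ _ (≡.trans (split a b m n) (≡.trans e (≡.trans (≡.sym (split b a m n)) (cong (ℕ._+ (b ℕ.* m ℕ.+ a ℕ.* n)) (ℕₚ.+-comm b a))))))
      where
      split : ∀ a b m n → a ℕ.+ b ℕ.+ (a ℕ.* m ℕ.+ b ℕ.* n) ≡ a ℕ.* (1 ℕ.+ m) ℕ.+ b ℕ.* (1 ℕ.+ n)
      split = solve-∀
    -- Subtracting the two recurrences removes r and the common value x = y, leaving (a - b) (m - n)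
    -- = 0 without negative terms.
    shuffle : ∀ x {y} a b m n r → x ≡ y → x ℕ.+ a ℕ.* n ≡ a ℕ.* m ℕ.+ r → y ℕ.+ b ℕ.* n ≡ b ℕ.* m ℕ.+ r →
              a ℕ.* m ℕ.+ b ℕ.* n ≡ b ℕ.* m ℕ.+ a ℕ.* n
    shuffle x a b m n r ≡.refl e e′ = ℕₚ.+-cancelʳ-≡ (x ℕ.+ r) _ _ (begin
      a ℕ.* m ℕ.+ b ℕ.* n ℕ.+ (x ℕ.+ r)         ≡⟨ swap (a ℕ.* m) (b ℕ.* n) x r ⟩
      (a ℕ.* m ℕ.+ r) ℕ.+ (x ℕ.+ b ℕ.* n)       ≡⟨ cong₂ ℕ._+_ (≡.sym e) e′ ⟩
      (x ℕ.+ a ℕ.* n) ℕ.+ (b ℕ.* m ℕ.+ r)       ≡⟨ swap′ (b ℕ.* m) (a ℕ.* n) x r ⟩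
      b ℕ.* m ℕ.+ a ℕ.* n ℕ.+ (x ℕ.+ r)         ∎)
      where
      open ≡.≡-Reasoning
      swap : ∀ c d x r → c ℕ.+ d ℕ.+ (x ℕ.+ r) ≡ (c ℕ.+ r) ℕ.+ (x ℕ.+ d)
      swap = solve-∀
      swap′ : ∀ c d x r → (x ℕ.+ d) ℕ.+ (c ℕ.+ r) ≡ c ℕ.+ d ℕ.+ (x ℕ.+ r)
      swap′ = solve-∀

-- Pairwise orthogonal non-square vectors

module _ {q : ℕ} (F : FiniteField q) (q-odd : ¬ 2 ∣ q) where
  open NormCounts F q-odd

  normCount-resp : ∀ t → Respects₁ (normCount t)
  normCount-resp t c≈d = ∑-cong (vecs t) (λ v → ⟦⟧-cong (_ ≟ _) (_ ≟ _) (λ e → trans e c≈d) (λ e → trans e (sym c≈d)))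

  -- An injective similarity with factor g carries the vectors of norm c to vectors of norm g c. It
  -- serves both for the change of basis and for multiplication by a scalar.
  normCount-mono : ∀ {t} (φ : Vector Carrier t → Vector Carrier t) → (∀ {x y} → φ x ≋ φ y → x ≋ y) →
                   ∀ g → (∀ v → φ v ∙ φ v ≈ g * (v ∙ v)) → ∀ c → normCount t c ≤ normCount t (g * c)
  normCount-mono {t} φ injective g norm c = ℕₚ.≤-trans
    (∑-mono (vecs t) (λ v → ⟦⟧-mono (v ∙ v ≟ c) (φ v ∙ φ v ≟ g * c) (λ e → trans (norm v) (*-congˡ e))))
    (∑-injective (vectorSpace t) φ injective (λ x≋y → ⟦⟧-cong (_ ≟ _) (_ ≟ _)
      (trans (sym (∙-cong x≋y x≋y))) (trans (∙-cong x≋y x≋y))))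

  -- Rescaling t pairwise orthogonal vectors to a common norm g makes them a basis in which the form is g times the
  -- standard one, so that normCount t 1# = normCount t g.
  ¬orthogonal-nonSquare-basis : ∀ k → let t = 1 ℕ.+ k ℕ.* 2 in (v : Fin t → Vector Carrier t) →
    (∀ i → IsNonSquare (v i ∙ v i)) → ¬ (∀ i j → i ≢ j → v i ∙ v j ≈ 0#)
  ¬orthogonal-nonSquare-basis k v v-ns orthogonal = normCount-odd k g-ns (ℕₚ.≤-antisym 1≤g g≤1)
    where
    t = 1 ℕ.+ k ℕ.* 2
    g = v Fin.zero ∙ v Fin.zero
    g-ns : IsNonSquare g
    g-ns = v-ns Fin.zero
    g≉0 = nonSquare⇒≉0 g-ns
    s : Fin t → Carrier
    s i = proj₁ (nonSquare-ratio g-ns (v-ns i))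
    w : Fin t → Vector Carrier t
    w i j = s i * v i j
    w∙w : ∀ i j → w i ∙ w j ≈ s i * (s j * (v i ∙ v j))
    w∙w i j = trans (∙-scaleˡ (s i) (v i) (w j)) (*-congˡ (∙-scaleʳ (s j) (v i) (v j)))
    open OrthogonalBasis w g g≉0
      (λ i j i≢j → trans (w∙w i j) (trans (*-congˡ (trans (*-congˡ (orthogonal i j i≢j)) (zeroʳ _))) (zeroʳ _)))
      (λ i → trans (w∙w i i) (trans (sym (*-assoc _ _ _)) (proj₂ (nonSquare-ratio g-ns (v-ns i)))))
    g·_≤ : ∀ c → normCount t c ≤ normCount t (g * c)
    g·_≤ = normCount-mono (combination w) combination-injective g combination-norm
    h = proj₁ (inverse g g≉0)
    gh≈1 = proj₂ (inverse g g≉0)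
    h≉0 : ¬ h ≈ 0#
    h≉0 = unit⇒≉0 (trans (*-comm h g) gh≈1)
    1≤g : normCount t 1# ≤ normCount t g
    1≤g = ℕₚ.≤-trans (g·_≤ 1#) (ℕₚ.≤-reflexive (normCount-resp t (*-identityʳ g)))
    hhgg≈1 : h * h * (g * g) ≈ 1#
    hhgg≈1 = trans (solve 2 (λ h g → h :* h :* (g :* g) := g :* h :* (g :* h)) refl h g)
      (trans (*-cong gh≈1 gh≈1) (*-identityˡ 1#))
    g≤1 : normCount t g ≤ normCount t 1#
    -- The change of basis takes norm g to norm g², and the scalar h = 1/g takes norm g² to norm 1;
    -- so the reverse inequality comes from injections as well, with no inverse of the basis map.
    g≤1 = ℕₚ.≤-trans (g·_≤ g) (ℕₚ.≤-trans
      (normCount-mono {t} (λ x i → h * x i) (λ e i → *-cancelˡ h h≉0 (e i)) (h * h)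
        (λ x → trans (∙-scaleˡ h x (λ i → h * x i)) (trans (*-congˡ (∙-scaleʳ h x x)) (sym (*-assoc h h _)))) (g * g))
      (ℕₚ.≤-reflexive (normCount-resp t hhgg≈1)))

  AK⊠-completeFree : ∀ k → CompleteFree (AK⊠ F (1 ℕ.+ k ℕ.* 2)) (1 ℕ.+ k ℕ.* 2)
  AK⊠-completeFree k (f , adjacent) = ¬orthogonal-nonSquare-basis k
    (λ i → proj₁ (proj₁ (proj₁ (f i)))) (λ i → proj₂ (f i)) adjacent

  -- The number of non-square vectors

  abstract
    isNonSquare? : ∀ c → Dec (IsNonSquare c)
    isNonSquare? c with isSquare? c
    ... | inj₁ (z , e) = no (λ ns → ns z e)
    ... | inj₂ ns      = yes ns

  -- (x , z) ↦ z − x is injective on this curve, and nowhere 0, since (z − x)(z + x) = c.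
  hyperbola : ∀ {c} → ¬ c ≈ 0# → suc (∑ 𝔽 (λ x → sqrtCount (x * x + c))) ≤ q
  hyperbola {c} c≉0 = begin
    suc (∑ 𝔽 (λ x → ∑ 𝔽 (λ z → ⟦ z * z ≟ x * x + c ⟧)))
      ≡⟨ cong suc (∑-cartesianProduct 𝔽 𝔽 _) ⟨
    suc (∑ (cartesianProduct 𝔽 𝔽) (λ (x , z) → ⟦ z * z ≟ x * x + c ⟧))
      ≡⟨ cong suc (∑-cong (cartesianProduct 𝔽 𝔽) (λ (x , z) → nonzero x z (z * z ≟ x * x + c))) ⟩
    suc (∑ (cartesianProduct 𝔽 𝔽) (λ (x , z) → ⟦ z * z ≟ x * x + c ⟧ ℕ.* ⟦ ¬? (z - x ≟ 0#) ⟧))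
      ≤⟨ s≤s (∑-injection (scalars ⊗ scalars) scalars (λ (x , z) → z * z ≟ x * x + c) (λ (x , z) → z - x) injective
           {λ u → ⟦ ¬? (u ≟ 0#) ⟧} (λ u≈v → ⟦⟧-cong (¬? (_ ≟ 0#)) (¬? (_ ≟ 0#)) (λ h e → h (trans u≈v e)) (λ h e → h (trans (sym u≈v) e)))) ⟩
    suc (∑ 𝔽 (λ u → ⟦ ¬? (u ≟ 0#) ⟧))
      ≡⟨ ≡.trans (cong suc ∑-≉0) 1+q-1 ⟩
    q ∎
    where
    open ℕₚ.≤-Reasoning
    product≈c : ∀ {x z} → z * z ≈ x * x + c → (z - x) * (z + x) ≈ c
    product≈c {x} {z} e = +-cancelʳ (x * x) _ _ (trans (difference-of-squares z x) (trans e (+-comm _ c)))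
    difference≉0 : ∀ {x z} → z * z ≈ x * x + c → ¬ z - x ≈ 0#
    difference≉0 e e′ = c≉0 (trans (sym (product≈c e)) (trans (*-congʳ e′) (zeroˡ _)))
    nonzero : ∀ x z (d : Dec (z * z ≈ x * x + c)) → ⟦ d ⟧ ≡ ⟦ d ⟧ ℕ.* ⟦ ¬? (z - x ≟ 0#) ⟧
    nonzero x z (yes e) = ≡.sym (≡.trans (ℕₚ.*-identityˡ _) (⟦⟧-yes (¬? (z - x ≟ 0#)) (difference≉0 e)))
    nonzero x z (no _)  = ≡.refl
    injective : ∀ {p p′ : Carrier × Carrier} → let (x , z) = p ; (x′ , z′) = p′ in
      z * z ≈ x * x + c → z′ * z′ ≈ x′ * x′ + c → z - x ≈ z′ - x′ → x ≈ x′ × z ≈ z′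
    -- The value u = z - x determines z + x = c / u, hence 2 z, hence z because the characteristic
    -- is odd.
    injective {x , z} {x′ , z′} e e′ d≈d′ = x≈x′ , z≈z′
      where
      s≈s′ : z + x ≈ z′ + x′
      s≈s′ = *-cancelˡ (z - x) (difference≉0 e) (trans (product≈c e) (trans (sym (product≈c e′)) (*-congʳ (sym d≈d′))))
      2z : ∀ z x → z + z ≈ (z - x) + (z + x)
      2z z x = sym (trans (solve 3 (λ z x n → (z :+ n) :+ (z :+ x) := (z :+ z) :+ (n :+ x)) refl z x (- x))
        (trans (+-congˡ (-‿inverseˡ x)) (+-identityʳ _)))
      z≈z′ : z ≈ z′
      z≈z′ = *-cancelˡ (1# + 1#) 1+1≉0 (trans (double z) (trans (trans (2z z x) (trans (+-cong d≈d′ s≈s′) (sym (2z z′ x′)))) (sym (double z′))))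
        where
        double : ∀ z → (1# + 1#) * z ≈ z + z
        double = solve 1 (λ z → (con 1 :+ con 1) :* z := z :+ z) refl
      x≈x′ : x ≈ x′
      x≈x′ = +-cancelˡ z _ _ (trans s≈s′ (+-congʳ (sym z≈z′)))

  ∑-square+ : ∀ c → ∑ 𝔽 (λ x → ⟦ x * x + c ≟ 0# ⟧) ≤ 2
  ∑-square+ c = ℕₚ.≤-trans (ℕₚ.≤-reflexive (∑-cong 𝔽 (λ x → ⟦⟧-cong (x * x + c ≟ 0#) (x * x ≟ - c)
    x+y≈0⇒x≈-y (λ e → trans (+-congʳ e) (-‿inverseˡ c))))) (sqrtCount≤2 (- c))

  -- Every value e = x² + c satisfies 2 ≤ `sqrtCount e` + [e = 0] + 2 [e is a non-square]. Summed
  -- over x, the first term gives at most q - 1 by `hyperbola` and the second at most 2.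
  nonSquares-on-line : ∀ c → ¬ c ≈ 0# → q ≤ 1 ℕ.+ 2 ℕ.* ∑ 𝔽 (λ x → ⟦ isNonSquare? (x * x + c) ⟧)
  nonSquares-on-line c c≉0 = cancel (hyperbola c≉0) (∑-square+ c) (begin
    q ℕ.* 2
      ≡⟨ ∑-𝔽-const 2 ⟨
    ∑ 𝔽 (λ _ → 2)
      ≤⟨ ∑-mono 𝔽 (λ x → classify (x * x + c)) ⟩
    ∑ 𝔽 (λ x → sqrtCount (x * x + c) ℕ.+ (⟦ x * x + c ≟ 0# ⟧ ℕ.+ 2 ℕ.* ⟦ isNonSquare? (x * x + c) ⟧))
      ≡⟨ ≡.trans (∑-+ 𝔽 _ _) (cong (∑ 𝔽 (λ x → sqrtCount (x * x + c)) ℕ.+_) (≡.trans (∑-+ 𝔽 _ _)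
           (cong (∑ 𝔽 (λ x → ⟦ x * x + c ≟ 0# ⟧) ℕ.+_) (∑-*ˡ 𝔽 2 _)))) ⟩
    ∑ 𝔽 (λ x → sqrtCount (x * x + c)) ℕ.+ (∑ 𝔽 (λ x → ⟦ x * x + c ≟ 0# ⟧) ℕ.+ 2 ℕ.* ∑ 𝔽 (λ x → ⟦ isNonSquare? (x * x + c) ⟧))
      ∎)
    where
    open ℕₚ.≤-Reasoning
    classify : ∀ e → 2 ≤ sqrtCount e ℕ.+ (⟦ e ≟ 0# ⟧ ℕ.+ 2 ℕ.* ⟦ isNonSquare? e ⟧)
    classify e with isSquare? e
    ... | inj₂ ns = ℕₚ.≤-trans (ℕₚ.≤-reflexive (cong (2 ℕ.*_) (≡.sym (⟦⟧-yes (isNonSquare? e) ns))))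
                      (ℕₚ.≤-trans (ℕₚ.m≤n+m _ ⟦ e ≟ 0# ⟧) (ℕₚ.m≤n+m _ (sqrtCount e)))
    ... | inj₁ (z , e≈zz) with e ≟ 0#
    ...   | yes e≈0 = ℕₚ.+-mono-≤ (ℕₚ.≤-reflexive (≡.sym (sqrtCount-0 e≈0))) (s≤s z≤n)
    ...   | no e≉0  = ℕₚ.≤-trans (ℕₚ.≤-reflexive (≡.sym (sqrtCount-square z e≈zz e≉0))) (ℕₚ.m≤m+n _ _)
    cancel : ∀ {q s z a} → suc s ≤ q → z ≤ 2 → q ℕ.* 2 ≤ s ℕ.+ (z ℕ.+ a) → q ≤ 1 ℕ.+ a
    cancel {q} {s} {z} {a} s<q z≤2 h = ℕₚ.+-cancelˡ-≤ (suc q) _ _ (begin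
      suc q ℕ.+ q              ≡⟨ double q ⟩
      suc (q ℕ.* 2)            ≤⟨ s≤s h ⟩
      suc s ℕ.+ (z ℕ.+ a)      ≤⟨ ℕₚ.+-mono-≤ s<q (ℕₚ.+-monoˡ-≤ a z≤2) ⟩
      q ℕ.+ (2 ℕ.+ a)          ≡⟨ shift q a ⟩
      suc q ℕ.+ (1 ℕ.+ a)      ∎)
      where
      double : ∀ q → suc q ℕ.+ q ≡ suc (q ℕ.* 2)
      double = solve-∀
      shift : ∀ q a → q ℕ.+ (2 ℕ.+ a) ≡ suc q ℕ.+ (1 ℕ.+ a)
      shift = solve-∀

  -- A line with c = 0 carries no non-square at all. A second free coordinate y repairs this for
  -- every d, since c = y² + d vanishes for at most two values of y.
  nonSquares-on-plane : ∀ d → q ℕ.* q ≤ 9 ℕ.* ∑ 𝔽 (λ y → ∑ 𝔽 (λ x → ⟦ isNonSquare? (x * x + (y * y + d)) ⟧))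
  nonSquares-on-plane d = arithmetic (∑ 𝔽 (λ y → ∑ 𝔽 (λ x → ⟦ isNonSquare? (x * x + (y * y + d)) ⟧))) 3≤q few-zeros (begin
    (q ℕ.∸ 1) ℕ.* ∑ 𝔽 (λ y → ⟦ ¬? (y * y + d ≟ 0#) ⟧)
      ≡⟨ ∑-*ˡ 𝔽 (q ℕ.∸ 1) _ ⟨
    ∑ 𝔽 (λ y → (q ℕ.∸ 1) ℕ.* ⟦ ¬? (y * y + d ≟ 0#) ⟧)
      ≤⟨ ∑-mono 𝔽 (λ y → line (y * y + d) (y * y + d ≟ 0#)) ⟩
    ∑ 𝔽 (λ y → 2 ℕ.* ∑ 𝔽 (λ x → ⟦ isNonSquare? (x * x + (y * y + d)) ⟧))
      ≡⟨ ∑-*ˡ 𝔽 2 _ ⟩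
    2 ℕ.* ∑ 𝔽 (λ y → ∑ 𝔽 (λ x → ⟦ isNonSquare? (x * x + (y * y + d)) ⟧))
      ∎)
    where
    open ℕₚ.≤-Reasoning
    line : ∀ e (e≟0 : Dec (e ≈ 0#)) → (q ℕ.∸ 1) ℕ.* ⟦ ¬? e≟0 ⟧ ≤ 2 ℕ.* ∑ 𝔽 (λ x → ⟦ isNonSquare? (x * x + e) ⟧)
    line e (yes _)  = ℕₚ.≤-trans (ℕₚ.≤-reflexive (ℕₚ.*-zeroʳ (q ℕ.∸ 1))) z≤n
    line e (no e≉0) = ℕₚ.≤-trans (ℕₚ.≤-reflexive (ℕₚ.*-identityʳ _)) (ℕₚ.∸-monoˡ-≤ 1 (nonSquares-on-line e e≉0))
    few-zeros : q ≤ 2 ℕ.+ ∑ 𝔽 (λ y → ⟦ ¬? (y * y + d ≟ 0#) ⟧)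
    few-zeros = begin
      q                             ≡⟨ ≡.trans (∑-𝔽-const 1) (ℕₚ.*-identityʳ q) ⟨
      ∑ 𝔽 (λ _ → 1)                 ≡⟨ ≡.trans (≡.sym (∑-cong 𝔽 (λ y → ⟦⟧-¬ (y * y + d ≟ 0#)))) (∑-+ 𝔽 _ _) ⟩
      _                             ≤⟨ ℕₚ.+-monoˡ-≤ _ (∑-square+ d) ⟩
      _                             ∎
    -- The hypotheses give (q - 1) (q - 2) ≤ 2 c, and 2 q² ≤ 9 (q - 1) (q - 2) holds for all q ≥ 3
    -- with equality at q = 3, which is the origin of the 9. In the proof q is 3 + r.
    arithmetic : ∀ {q b} c → 3 ≤ q → q ≤ 2 ℕ.+ b → (q ℕ.∸ 1) ℕ.* b ≤ 2 ℕ.* c → q ℕ.* q ≤ 9 ℕ.* c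
    arithmetic {suc (suc (suc r))} {b} c (s≤s (s≤s (s≤s _))) (s≤s (s≤s r<b)) h = ℕₚ.*-cancelˡ-≤ 2 (begin
      2 ℕ.* ((3 ℕ.+ r) ℕ.* (3 ℕ.+ r))                        ≤⟨ ℕₚ.m≤m+n _ (15 ℕ.* r ℕ.+ 7 ℕ.* (r ℕ.* r)) ⟩
      2 ℕ.* ((3 ℕ.+ r) ℕ.* (3 ℕ.+ r)) ℕ.+ (15 ℕ.* r ℕ.+ 7 ℕ.* (r ℕ.* r))  ≡⟨ expand r ⟩
      9 ℕ.* ((2 ℕ.+ r) ℕ.* (1 ℕ.+ r))                        ≤⟨ ℕₚ.*-monoʳ-≤ 9 (ℕₚ.*-monoʳ-≤ (2 ℕ.+ r) r<b) ⟩
      9 ℕ.* ((2 ℕ.+ r) ℕ.* b)                                ≤⟨ ℕₚ.*-monoʳ-≤ 9 h ⟩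
      9 ℕ.* (2 ℕ.* c)                                        ≡⟨ swap c ⟩
      2 ℕ.* (9 ℕ.* c)                                        ∎)
      where
      expand : ∀ r → 2 ℕ.* ((3 ℕ.+ r) ℕ.* (3 ℕ.+ r)) ℕ.+ (15 ℕ.* r ℕ.+ 7 ℕ.* (r ℕ.* r)) ≡ 9 ℕ.* ((2 ℕ.+ r) ℕ.* (1 ℕ.+ r))
      expand = solve-∀
      swap : ∀ c → 9 ℕ.* (2 ℕ.* c) ≡ 2 ℕ.* (9 ℕ.* c)
      swap = solve-∀

  -- The t coordinates beyond the first two merely supply d = v ∙ v for `nonSquares-on-plane`.
  nonSquareVectors-lower : ∀ t → q ℕ.^ (2 ℕ.+ t) ≤ 9 ℕ.* ∑ (vecs (2 ℕ.+ t)) (λ v → ⟦ isNonSquare? (v ∙ v) ⟧)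
  nonSquareVectors-lower t = begin
    q ℕ.* (q ℕ.* q ℕ.^ t)
      ≡⟨ ≡.trans (≡.sym (ℕₚ.*-assoc q q _)) (≡.trans (ℕₚ.*-comm (q ℕ.* q) _) (≡.sym (∑-vecs-const t _))) ⟩
    ∑ (vecs t) (λ _ → q ℕ.* q)
      ≤⟨ ∑-mono (vecs t) (λ v → nonSquares-on-plane (v ∙ v)) ⟩
    ∑ (vecs t) (λ v → 9 ℕ.* ∑ 𝔽 (λ y → ∑ 𝔽 (λ x → ⟦ isNonSquare? (x * x + (y * y + v ∙ v)) ⟧)))
      ≡⟨ ∑-*ˡ (vecs t) 9 _ ⟩
    9 ℕ.* ∑ (vecs t) (λ v → ∑ 𝔽 (λ y → ∑ 𝔽 (λ x → ⟦ isNonSquare? (x * x + (y * y + v ∙ v)) ⟧)))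
      ≡⟨ cong (9 ℕ.*_) (≡.trans (∑-comm (vecs t) 𝔽 _) (≡.trans (∑-cong 𝔽 (λ y → ∑-comm (vecs t) 𝔽 _)) (∑-comm 𝔽 𝔽 _))) ⟩
    9 ℕ.* ∑ 𝔽 (λ x → ∑ 𝔽 (λ y → ∑ (vecs t) (λ v → ⟦ isNonSquare? (x * x + (y * y + v ∙ v)) ⟧)))
      ≡⟨ cong (9 ℕ.*_) (≡.trans (∑-vecs-suc (suc t) _) (∑-cong 𝔽 (λ x → ∑-vecs-suc t _))) ⟨
    9 ℕ.* ∑ (vecs (2 ℕ.+ t)) (λ v → ⟦ isNonSquare? (v ∙ v) ⟧)
      ∎
    where open ℕₚ.≤-Reasoning

-- The second moment of the number of orthogonal points

private
  module ℤ∑ = ListSum (IsCommutativeRing.isCommutativeSemiring ℤₚ.+-*-isCommutativeRing)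
open ℤ∑ using () renaming (∑ to ∑ℤ)

pos-∑ : {A : Set} (xs : List A) (f : A → ℕ) → ℤ.+ (∑ xs f) ≡ ∑ℤ xs (λ x → ℤ.+ f x)
pos-∑ []       f = ≡.refl
pos-∑ (x ∷ xs) f = ≡.trans (ℤₚ.pos-+ (f x) (∑ xs f)) (cong (λ s → ℤ.+ f x ℤ.+ s) (pos-∑ xs f))

∑ℤ-mono : {A : Set} (xs : List A) {f g : A → ℤ} → (∀ x → f x ℤ.≤ g x) → ∑ℤ xs f ℤ.≤ ∑ℤ xs g
∑ℤ-mono []       f≤g = ℤₚ.≤-refl
∑ℤ-mono (x ∷ xs) f≤g = ℤₚ.+-mono-≤ (f≤g x) (∑ℤ-mono xs f≤g)

square≡∣∣ : ∀ i → i ℤ.* i ≡ ℤ.+ (ℤ.∣ i ∣ ℕ.* ℤ.∣ i ∣)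
square≡∣∣ (ℤ.+ n)      = ≡.sym (ℤₚ.pos-* n n)
square≡∣∣ (ℤ.-[1+ n ]) = ≡.refl

0≤square : ∀ i → ℤ.0ℤ ℤ.≤ i ℤ.* i
0≤square i = subst (ℤ.0ℤ ℤ.≤_) (≡.sym (square≡∣∣ i)) (ℤ.+≤+ z≤n)

-- Lagrange's identity: with U, V, W as below, the double sum of the squares of u x v y - u y v x
-- equals 2 (U V - W²).
cauchy-schwarz : {A : Set} (xs : List A) (u v : A → ℤ) →
  ∑ℤ xs (λ x → u x ℤ.* v x) ℤ.* ∑ℤ xs (λ x → u x ℤ.* v x) ℤ.≤
  ∑ℤ xs (λ x → u x ℤ.* u x) ℤ.* ∑ℤ xs (λ x → v x ℤ.* v x)
cauchy-schwarz xs u v = ℤₚ.*-cancelˡ-≤-pos _ _ (ℤ.+ 2) (ℤₚ.0≤i-j⇒j≤i (begin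
  ℤ.0ℤ
    ≡⟨ ≡.trans (ℤ∑.∑-cong xs (λ _ → ℤ∑.∑-zero xs)) (ℤ∑.∑-zero xs) ⟨
  ∑ℤ xs (λ x → ∑ℤ xs (λ y → ℤ.0ℤ))
    ≤⟨ ∑ℤ-mono xs (λ x → ∑ℤ-mono xs (λ y → 0≤square (u x ℤ.* v y ℤ.- u y ℤ.* v x))) ⟩
  ∑ℤ xs (λ x → ∑ℤ xs (λ y → (u x ℤ.* v y ℤ.- u y ℤ.* v x) ℤ.* (u x ℤ.* v y ℤ.- u y ℤ.* v x)))
    ≡⟨ ℤ∑.∑-cong xs (λ x → ≡.trans (ℤ∑.∑-cong xs (λ y → expand (u x) (v y) (u y) (v x))) (inner x)) ⟩
  ∑ℤ xs (λ x → u x ℤ.* u x ℤ.* V ℤ.+ v x ℤ.* v x ℤ.* U ℤ.+ u x ℤ.* v x ℤ.* (ℤ.- (ℤ.+ 2) ℤ.* W))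
    ≡⟨ ≡.trans (ℤ∑.∑-+ xs _ _) (cong₂ ℤ._+_ (≡.trans (ℤ∑.∑-+ xs _ _) (cong₂ ℤ._+_ (ℤ∑.∑-*ʳ xs _ V) (ℤ∑.∑-*ʳ xs _ U))) (ℤ∑.∑-*ʳ xs _ _)) ⟩
  U ℤ.* V ℤ.+ V ℤ.* U ℤ.+ W ℤ.* (ℤ.- (ℤ.+ 2) ℤ.* W)
    ≡⟨ collect U V W ⟩
  ℤ.+ 2 ℤ.* (U ℤ.* V) ℤ.- ℤ.+ 2 ℤ.* (W ℤ.* W)
    ∎))
  where
  open ℤₚ.≤-Reasoning
  U V W : ℤ
  U = ∑ℤ xs (λ x → u x ℤ.* u x)
  V = ∑ℤ xs (λ x → v x ℤ.* v x)
  W = ∑ℤ xs (λ x → u x ℤ.* v x)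
  expand : ∀ a b c d → (a ℤ.* b ℤ.- c ℤ.* d) ℤ.* (a ℤ.* b ℤ.- c ℤ.* d) ≡
    a ℤ.* a ℤ.* (b ℤ.* b) ℤ.+ d ℤ.* d ℤ.* (c ℤ.* c) ℤ.+ a ℤ.* d ℤ.* ℤ.- (ℤ.+ 2) ℤ.* (c ℤ.* b)
  expand = ℤ-Solver.solve-∀
  collect : ∀ U V W → U ℤ.* V ℤ.+ V ℤ.* U ℤ.+ W ℤ.* (ℤ.- (ℤ.+ 2) ℤ.* W) ≡ ℤ.+ 2 ℤ.* (U ℤ.* V) ℤ.- ℤ.+ 2 ℤ.* (W ℤ.* W)
  collect = ℤ-Solver.solve-∀
  inner : ∀ x → ∑ℤ xs (λ y → u x ℤ.* u x ℤ.* (v y ℤ.* v y) ℤ.+ v x ℤ.* v x ℤ.* (u y ℤ.* u y) ℤ.+ u x ℤ.* v x ℤ.* ℤ.- (ℤ.+ 2) ℤ.* (u y ℤ.* v y)) ≡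
    u x ℤ.* u x ℤ.* V ℤ.+ v x ℤ.* v x ℤ.* U ℤ.+ u x ℤ.* v x ℤ.* (ℤ.- (ℤ.+ 2) ℤ.* W)
  inner x = ≡.trans (ℤ∑.∑-+ xs _ _) (cong₂ ℤ._+_
    (≡.trans (ℤ∑.∑-+ xs _ _) (cong₂ ℤ._+_ (ℤ∑.∑-*ˡ xs (u x ℤ.* u x) _) (ℤ∑.∑-*ˡ xs (v x ℤ.* v x) _)))
    (≡.trans (ℤ∑.∑-*ˡ xs (u x ℤ.* v x ℤ.* ℤ.- (ℤ.+ 2)) _) (ℤₚ.*-assoc (u x ℤ.* v x) (ℤ.- (ℤ.+ 2)) W)))

-- Orthogonality to a family of points

module _ {q : ℕ} (F : FiniteField q) (q-odd : ¬ 2 ∣ q) (t : ℕ) where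
  open NormCounts F q-odd

  private
    V = vectorSpace t
    module Vecs = Enumerated V
    Vec = Vector Carrier t

  infixr 8 _⋆_
  _⋆_ : Carrier → Vec → Vec
  (a ⋆ x) i = a * x i

  -- Each v lies on exactly one of the q translates of the hyperplane x⊥ by multiples of u.
  hyperplane : ∀ (x u : Vec) → ¬ x ∙ u ≈ 0# → (f : Vec → ℕ) → Vecs.Respects f →
               (∀ a v → f (λ i → v i + (a ⋆ u) i) ≡ f v) →
               q ℕ.* ∑ (vecs t) (λ v → ⟦ x ∙ v ≟ 0# ⟧ ℕ.* f v) ≡ ∑ (vecs t) f
  hyperplane x u xu≉0 f f-resp f-invariant = begin
    q ℕ.* ∑ (vecs t) h                                                       ≡⟨ ∑-𝔽-const _ ⟨
    ∑ 𝔽 (λ a → ∑ (vecs t) h)                                                 ≡⟨ ∑-cong 𝔽 (λ a → translate a) ⟨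
    ∑ 𝔽 (λ a → ∑ (vecs t) (λ v → h (λ i → v i + (a ⋆ u) i)))                 ≡⟨ ∑-comm 𝔽 (vecs t) _ ⟩
    ∑ (vecs t) (λ v → ∑ 𝔽 (λ a → h (λ i → v i + (a ⋆ u) i)))
      ≡⟨ ∑-cong (vecs t) (λ v → ≡.trans (∑-cong 𝔽 (λ a → translated v a)) (≡.trans (∑-*ʳ 𝔽 _ (f v))
         (≡.trans (cong (ℕ._* f v) (Enumerated.once scalars _)) (ℕₚ.*-identityˡ (f v))))) ⟩
    ∑ (vecs t) f                                                             ∎
    where
    open ≡.≡-Reasoning
    h : Vec → ℕ
    h v = ⟦ x ∙ v ≟ 0# ⟧ ℕ.* f v
    h-resp : Vecs.Respects h
    h-resp {v} {w} v≋w = cong₂ ℕ._*_ (⟦⟧-cong (x ∙ v ≟ 0#) (x ∙ w ≟ 0#)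
      (trans (sym (∙-cong {x = x} (λ _ → refl) v≋w))) (trans (∙-cong {x = x} (λ _ → refl) v≋w))) (f-resp v≋w)
    cancel : ∀ v a b → a + b ≈ 0# → ∀ c → v + a * c + b * c ≈ v
    cancel v a b a+b≈0 c = trans (solve 4 (λ v a b c → v :+ a :* c :+ b :* c := v :+ (a :+ b) :* c) refl v a b c)
      (trans (+-congˡ (trans (*-congʳ a+b≈0) (zeroˡ c))) (+-identityʳ v))
    translate : ∀ a → ∑ (vecs t) (λ v → h (λ i → v i + (a ⋆ u) i)) ≡ ∑ (vecs t) h
    translate a = ∑-bijective V (λ v i → v i + a * u i) (λ v i → v i + - a * u i)
      (λ e i → +-congʳ (e i)) (λ e i → +-congʳ (e i))
      (λ v i → cancel (v i) (- a) a (-‿inverseˡ a) (u i)) (λ v i → cancel (v i) a (- a) (-‿inverseʳ a) (u i)) h-resp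
    k = proj₁ (inverse (x ∙ u) xu≉0)
    xu*k≈1 = proj₂ (inverse (x ∙ u) xu≉0)
    dot : ∀ v a → x ∙ (λ i → v i + (a ⋆ u) i) ≈ x ∙ v + a * (x ∙ u)
    dot v a = trans (∙-+ʳ x v (a ⋆ u)) (+-congˡ (∙-scaleʳ a x u))
    translated : ∀ v a → h (λ i → v i + (a ⋆ u) i) ≡ ⟦ a ≟ k * - (x ∙ v) ⟧ ℕ.* f v
    translated v a = cong₂ ℕ._*_ (⟦⟧-cong (x ∙ (λ i → v i + (a ⋆ u) i) ≟ 0#) (a ≟ k * - (x ∙ v))
      (λ e → *-cancelˡ (x ∙ u) xu≉0 (trans (*-comm (x ∙ u) a) (trans
        (x+y≈0⇒x≈-y (trans (+-comm (a * (x ∙ u)) (x ∙ v)) (trans (sym (dot v a)) e))) (sym (unscale v)))))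
      (λ e → trans (dot v a) (trans (+-congˡ (trans (*-congʳ e) (trans (*-comm (k * - (x ∙ v)) (x ∙ u)) (unscale v)))) (-‿inverseʳ (x ∙ v)))))
      (f-invariant a v)
      where
      unscale : ∀ v → (x ∙ u) * (k * - (x ∙ v)) ≈ - (x ∙ v)
      unscale v = trans (sym (*-assoc (x ∙ u) k (- (x ∙ v)))) (trans (*-congʳ xu*k≈1) (*-identityˡ (- (x ∙ v))))

  -- If x is not a multiple of y, some coordinate x j differs from that of the projection of x to the line of y,
  -- and u is the projection of the unit vector e j to y⊥.
  separate : ∀ (x y : Vec) → ¬ y ∙ y ≈ 0# → ¬ x ∙ x ≈ 0# → ¬ _∼_ F t x y → ∃ λ u → y ∙ u ≈ 0# × ¬ x ∙ u ≈ 0#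
  separate x y yy≉0 xx≉0 x≁y with Finₚ.any? (λ j → ¬? (x j ≟ (x ∙ y) * k * y j))
    where k = proj₁ (inverse (y ∙ y) yy≉0)
  ... | no same = contradiction (λ₀ , λ₀≉0 , x≋λ₀y) x≁y
    where
    k = proj₁ (inverse (y ∙ y) yy≉0)
    λ₀ = (x ∙ y) * k
    x≋λ₀y : x ≋ λ₀ ⋆ y
    x≋λ₀y j with x j ≟ λ₀ * y j
    ... | yes e = e
    ... | no ne = contradiction (j , ne) same
    λ₀≉0 : ¬ λ₀ ≈ 0#
    λ₀≉0 λ₀≈0 = xx≉0 (trans (∙-cong {y = x} x≋λ₀y (λ _ → refl)) (trans (∙-scaleˡ λ₀ y x) (trans (*-congʳ λ₀≈0) (zeroˡ (y ∙ x)))))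
  ... | yes (j , xj≉) = u , yu≈0 , xu≉0
    where
    k = proj₁ (inverse (y ∙ y) yy≉0)
    yyk≈1 = proj₂ (inverse (y ∙ y) yy≉0)
    e : Vec
    e i with i Finₚ.≟ j
    ... | yes _ = 1#
    ... | no _  = 0#
    ∙e : ∀ z → z ∙ e ≈ z j
    ∙e z = trans (sum-single (λ i → z i * e i) j off) on
      where
      off : ∀ i → i ≢ j → z i * e i ≈ 0#
      off i i≢j with i Finₚ.≟ j
      ... | yes i≡j = contradiction i≡j i≢j
      ... | no _    = zeroʳ (z i)
      on : z j * e j ≈ z j
      on with j Finₚ.≟ j
      ... | yes _  = *-identityʳ (z j)
      ... | no j≢j = contradiction ≡.refl j≢j
    c = - (k * y j)
    u : Vec
    u i = e i + (c ⋆ y) i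
    ∙u : ∀ z → z ∙ u ≈ z j - (k * y j) * (z ∙ y)
    ∙u z = trans (∙-+ʳ z e (c ⋆ y)) (+-cong (∙e z) (trans (∙-scaleʳ c z y) (sym (-‿distribˡ-* (k * y j) (z ∙ y)))))
    yu≈0 : y ∙ u ≈ 0#
    yu≈0 = trans (∙u y) (trans (+-congˡ (-‿cong (trans
      (solve 3 (λ k c n → k :* c :* n := n :* k :* c) refl k (y j) (y ∙ y)) (trans (*-congʳ yyk≈1) (*-identityˡ (y j)))))) (-‿inverseʳ (y j)))
    xu≉0 : ¬ x ∙ u ≈ 0#
    xu≉0 xu≈0 = xj≉ (trans (x-y≈0⇒x≈y (trans (sym (∙u x)) xu≈0))
      (solve 3 (λ k c n → k :* c :* n := n :* k :* c) refl k (y j) (x ∙ y)))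

  -- The family is instantiated twice: by the classes in `X⊠/∼`, to estimate n, and by the vertices
  -- of the graph, to count edges. Since x i is not absolute, x i itself is a direction transversal
  -- to its hyperplane.
  module Points {n : ℕ} (x : Fin n → Vec) (nonAbsolute : ∀ i → ¬ x i ∙ x i ≈ 0#)
    (distinct : ∀ {i j} → _∼_ F t (x i) (x j) → i ≡ j) where

    -- The vectors a ⋆ x i with a nonzero are pairwise different: `distinct` recovers i, and pairing
    -- with x i recovers a.
    ∑-multiples : ∀ {f} → Vecs.Respects f → ∑ 𝔽 (λ a → ∑ (allFin n) (λ i → ⟦ ¬? (a ≟ 0#) ⟧ ℕ.* f (a ⋆ x i))) ≤ ∑ (vecs t) f
    ∑-multiples f-resp = ℕₚ.≤-trans (ℕₚ.≤-reflexive (≡.sym (∑-cartesianProduct 𝔽 (allFin n) _)))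
      (∑-injection (scalars ⊗ finEnumerated n) V (λ (a , i) → ¬? (a ≟ 0#)) (λ (a , i) → a ⋆ x i) injective f-resp)
      where
      injective : ∀ {p p′ : Carrier × Fin n} → let (a , i) = p ; (b , j) = p′ in
        ¬ a ≈ 0# → ¬ b ≈ 0# → a ⋆ x i ≋ b ⋆ x j → a ≈ b × i ≡ j
      injective {a , i} {b , j} a≉0 b≉0 ax≋bx = a≈b i≡j ax≋bx , i≡j
        where
        k = proj₁ (inverse a a≉0)
        ak≈1 = proj₂ (inverse a a≉0)
        ka≈1 = trans (*-comm k a) ak≈1
        i≡j = distinct (k * b , *-≉0 (unit⇒≉0 ka≈1) b≉0 , λ l → trans (sym (trans (sym (*-assoc k a (x i l))) (trans (*-congʳ ka≈1) (*-identityˡ (x i l)))))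
          (trans (*-congˡ (ax≋bx l)) (sym (*-assoc k b (x j l)))))
        a≈b : i ≡ j → a ⋆ x i ≋ b ⋆ x j → a ≈ b
        a≈b ≡.refl e = *-cancelˡ (x i ∙ x i) (nonAbsolute i) (trans (*-comm (x i ∙ x i) a) (trans (sym (∙-scaleˡ a (x i) (x i)))
          (trans (∙-cong {y = x i} e (λ _ → refl)) (trans (∙-scaleˡ b (x i) (x i)) (*-comm b (x i ∙ x i))))))

    points-upper : q-1 ℕ.* n ≤ q ℕ.^ t
    points-upper = begin
      q-1 ℕ.* n
        ≡⟨ cong₂ ℕ._*_ ∑-≉0 (≡.trans (∑-const (allFin n) 1) (≡.trans (ℕₚ.*-identityʳ _) (length-tabulate (λ i → i)))) ⟨
      ∑ 𝔽 (λ a → ⟦ ¬? (a ≟ 0#) ⟧) ℕ.* ∑ (allFin n) (λ _ → 1)                    ≡⟨ ∑-*-∑ 𝔽 (allFin n) _ _ ⟩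
      ∑ 𝔽 (λ a → ∑ (allFin n) (λ i → ⟦ ¬? (a ≟ 0#) ⟧ ℕ.* 1))                    ≤⟨ ∑-multiples (λ _ → ≡.refl) ⟩
      ∑ (vecs t) (λ _ → 1)
        ≡⟨ ≡.trans (∑-vecs-const t 1) (ℕₚ.*-identityʳ _) ⟩
      q ℕ.^ t                                                                  ∎
      where open ℕₚ.≤-Reasoning

    -- A union bound over all vectors a ⋆ x i. With a = 0 included the factor is q, which
    -- `card-X⊠/∼-lower` cancels against a factor of the power of q.
    points-cover : {P : Vec → Set} (P? : U.Decidable P) → (∀ v → P v → ∃ λ i → _∼_ F t v (x i)) →
                   ∑ (vecs t) (λ v → ⟦ P? v ⟧) ≤ q ℕ.* n
    points-cover P? cover = begin
      ∑ (vecs t) (λ v → ⟦ P? v ⟧)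
        ≤⟨ ∑-mono (vecs t) (λ v → counted v (P? v)) ⟩
      ∑ (vecs t) (λ v → ∑ (cartesianProduct 𝔽 (allFin n)) (λ (a , i) → ⟦ v ≋? a ⋆ x i ⟧))
        ≡⟨ ∑-comm (vecs t) (cartesianProduct 𝔽 (allFin n)) _ ⟩
      ∑ (cartesianProduct 𝔽 (allFin n)) (λ (a , i) → ∑ (vecs t) (λ v → ⟦ v ≋? a ⋆ x i ⟧))
        ≡⟨ ∑-cong (cartesianProduct 𝔽 (allFin n)) (λ (a , i) → Vecs.once (a ⋆ x i)) ⟩
      ∑ (cartesianProduct 𝔽 (allFin n)) (λ _ → 1)                                ≡⟨ ∑-cartesianProduct 𝔽 (allFin n) _ ⟩
      ∑ 𝔽 (λ _ → ∑ (allFin n) (λ _ → 1))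
        ≡⟨ ≡.trans (∑-cong 𝔽 (λ _ → ≡.trans (∑-const (allFin n) 1) (≡.trans (ℕₚ.*-identityʳ _) (length-tabulate (λ i → i))))) (∑-𝔽-const n) ⟩
      q ℕ.* n                                                                    ∎
      where
      open ℕₚ.≤-Reasoning
      counted : ∀ v (Pv? : Dec _) → ⟦ Pv? ⟧ ≤ ∑ (cartesianProduct 𝔽 (allFin n)) (λ (a , i) → ⟦ v ≋? a ⋆ x i ⟧)
      counted v (no _)   = z≤n
      counted v (yes Pv) = let (i , a , _ , v≋ax) = cover v Pv in
        ℕₚ.≤-trans (ℕₚ.≤-reflexive (≡.sym (⟦⟧-yes (v ≋? a ⋆ x i) v≋ax)))
          (Enumerated.term≤∑ (scalars ⊗ finEnumerated n) (a , i) {λ (a , i) → ⟦ v ≋? a ⋆ x i ⟧}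
            (λ { {a , i} {b , .i} (a≈b , ≡.refl) → ⟦⟧-cong (v ≋? a ⋆ x i) (v ≋? b ⋆ x i)
              (λ e l → trans (e l) (*-congʳ a≈b)) (λ e l → trans (e l) (*-congʳ (sym a≈b))) }))

    orthogonal : Fin n → Vec → ℕ
    orthogonal i v = ⟦ x i ∙ v ≟ 0# ⟧

    orthogonality-resp : ∀ i → Vecs.Respects (orthogonal i)
    orthogonality-resp i {v} {w} v≋w = ⟦⟧-cong (x i ∙ v ≟ 0#) (x i ∙ w ≟ 0#)
      (trans (sym (∙-cong {x = x i} (λ _ → refl) v≋w))) (trans (∙-cong {x = x i} (λ _ → refl) v≋w))

    count-orthogonal : ∀ i → q ℕ.* ∑ (vecs t) (orthogonal i) ≡ q ℕ.^ t
    count-orthogonal i = ≡.trans (cong (q ℕ.*_) (∑-cong (vecs t) (λ v → ≡.sym (ℕₚ.*-identityʳ (orthogonal i v)))))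
      (≡.trans (hyperplane (x i) (x i) (nonAbsolute i) (λ _ → 1) (λ _ → ≡.refl) (λ _ _ → ≡.refl))
        (≡.trans (∑-vecs-const t 1) (ℕₚ.*-identityʳ _)))

    -- Translation along the vector u of `separate` fixes x j ∙ v and moves x i ∙ v through all
    -- scalars, so one q-th of the hyperplane of x j lies in that of x i.
    count-orthogonal₂ : ∀ i j → i ≢ j → q ℕ.* ∑ (vecs t) (λ v → orthogonal i v ℕ.* orthogonal j v) ≡ ∑ (vecs t) (orthogonal j)
    count-orthogonal₂ i j i≢j =
      let (u , ju≈0 , iu≉0) = separate (x i) (x j) (nonAbsolute j) (nonAbsolute i) (λ i∼j → i≢j (distinct i∼j)) in
      hyperplane (x i) u iu≉0 (orthogonal j) (orthogonality-resp j) (λ a v →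
        ⟦⟧-cong (x j ∙ (λ l → v l + (a ⋆ u) l) ≟ 0#) (x j ∙ v ≟ 0#) (trans (sym (same u ju≈0 a v))) (trans (same u ju≈0 a v)))
      where
      same : ∀ u → x j ∙ u ≈ 0# → ∀ a v → x j ∙ (λ l → v l + (a ⋆ u) l) ≈ x j ∙ v
      same u ju≈0 a v = trans (∙-+ʳ (x j) v (a ⋆ u)) (trans (+-congˡ (trans (∙-scaleʳ a (x j) u) (trans (*-congˡ ju≈0) (zeroʳ a)))) (+-identityʳ _))

    defect : Fin n → Vec → ℤ
    defect i v = ℤ.+ q ℤ.* ℤ.+ orthogonal i v ℤ.- ℤ.1ℤ

    defect-correlation : ∀ i j → ∑ℤ (vecs t) (λ v → defect i v ℤ.* defect j v) ≡ ℤ.+ (⟦ j Finₚ.≟ i ⟧ ℕ.* (q-1 ℕ.* q ℕ.^ t))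
    defect-correlation i j = begin
      ∑ℤ (vecs t) (λ v → defect i v ℤ.* defect j v)
        ≡⟨ ℤ∑.∑-cong (vecs t) (λ v → ≡.trans (expand (ℤ.+ q) (ℤ.+ orthogonal i v) (ℤ.+ orthogonal j v))
             (cong (λ z → ℤ.+ q ℤ.* ℤ.+ q ℤ.* z ℤ.+ ℤ.- (ℤ.+ q) ℤ.* ℤ.+ orthogonal i v ℤ.+ (ℤ.- (ℤ.+ q) ℤ.* ℤ.+ orthogonal j v ℤ.+ ℤ.1ℤ))
               (≡.sym (ℤₚ.pos-* (orthogonal i v) (orthogonal j v))))) ⟩
      ∑ℤ (vecs t) (λ v → ℤ.+ q ℤ.* ℤ.+ q ℤ.* ℤ.+ (orthogonal i v ℕ.* orthogonal j v) ℤ.+ ℤ.- (ℤ.+ q) ℤ.* ℤ.+ orthogonal i v ℤ.+ (ℤ.- (ℤ.+ q) ℤ.* ℤ.+ orthogonal j v ℤ.+ ℤ.1ℤ))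
        ≡⟨ ≡.trans (ℤ∑.∑-+ (vecs t) _ _) (cong₂ ℤ._+_
             (≡.trans (ℤ∑.∑-+ (vecs t) _ _) (cong₂ ℤ._+_
               (≡.trans (ℤ∑.∑-*ˡ (vecs t) (ℤ.+ q ℤ.* ℤ.+ q) _) (cong ((ℤ.+ q ℤ.* ℤ.+ q) ℤ.*_) (≡.sym (pos-∑ (vecs t) _))))
               (scaled i)))
             (≡.trans (ℤ∑.∑-+ (vecs t) _ _) (cong₂ ℤ._+_ (scaled j) (≡.trans (≡.sym (pos-∑ (vecs t) (λ _ → 1)))
               (cong ℤ.+_ (≡.trans (∑-vecs-const t 1) (ℕₚ.*-identityʳ (q ℕ.^ t)))))))) ⟩
      ℤ.+ q ℤ.* ℤ.+ q ℤ.* ℤ.+ N ℤ.+ ℤ.- (ℤ.+ (q ℕ.^ t)) ℤ.+ (ℤ.- (ℤ.+ (q ℕ.^ t)) ℤ.+ ℤ.+ (q ℕ.^ t))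
        ≡⟨ cong (ℤ._+ (ℤ.- (ℤ.+ (q ℕ.^ t)) ℤ.+ ℤ.+ (q ℕ.^ t))) (cong (ℤ._+ ℤ.- (ℤ.+ (q ℕ.^ t)))
             (≡.trans (cong (ℤ._* ℤ.+ N) (≡.sym (ℤₚ.pos-* q q))) (≡.trans (≡.sym (ℤₚ.pos-* (q ℕ.* q) N)) (cong ℤ.+_ (joint (j Finₚ.≟ i)))))) ⟩
      ℤ.+ (q ℕ.^ t ℕ.+ ⟦ j Finₚ.≟ i ⟧ ℕ.* (q-1 ℕ.* q ℕ.^ t)) ℤ.+ ℤ.- (ℤ.+ (q ℕ.^ t)) ℤ.+ (ℤ.- (ℤ.+ (q ℕ.^ t)) ℤ.+ ℤ.+ (q ℕ.^ t))
        ≡⟨ collect (ℤ.+ (q ℕ.^ t)) (ℤ.+ (⟦ j Finₚ.≟ i ⟧ ℕ.* (q-1 ℕ.* q ℕ.^ t))) ⟩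
      ℤ.+ (⟦ j Finₚ.≟ i ⟧ ℕ.* (q-1 ℕ.* q ℕ.^ t))
        ∎
      where
      open ≡.≡-Reasoning
      N = ∑ (vecs t) (λ v → orthogonal i v ℕ.* orthogonal j v)
      expand : ∀ Q o p → (Q ℤ.* o ℤ.- ℤ.1ℤ) ℤ.* (Q ℤ.* p ℤ.- ℤ.1ℤ) ≡
        Q ℤ.* Q ℤ.* (o ℤ.* p) ℤ.+ ℤ.- Q ℤ.* o ℤ.+ (ℤ.- Q ℤ.* p ℤ.+ ℤ.1ℤ)
      expand = ℤ-Solver.solve-∀
      collect : ∀ T K → T ℤ.+ K ℤ.+ ℤ.- T ℤ.+ (ℤ.- T ℤ.+ T) ≡ K
      collect = ℤ-Solver.solve-∀
      scaled : ∀ i → ∑ℤ (vecs t) (λ v → ℤ.- (ℤ.+ q) ℤ.* ℤ.+ orthogonal i v) ≡ ℤ.- (ℤ.+ (q ℕ.^ t))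
      scaled i = ≡.trans (ℤ∑.∑-*ˡ (vecs t) (ℤ.- (ℤ.+ q)) _) (≡.trans (cong (ℤ.- (ℤ.+ q) ℤ.*_) (≡.sym (pos-∑ (vecs t) (orthogonal i))))
        (≡.trans (≡.sym (ℤₚ.neg-distribˡ-* (ℤ.+ q) _)) (cong ℤ.-_ (≡.trans (≡.sym (ℤₚ.pos-* q _)) (cong ℤ.+_ (count-orthogonal i))))))
      -- For i = j the left side is q times q^t, written as q^t + (q - 1) q^t, so that one formula
      -- covers both cases and only the diagonal term survives the cancellation.
      joint : (j≟i : Dec (j ≡ i)) → q ℕ.* q ℕ.* N ≡ q ℕ.^ t ℕ.+ ⟦ j≟i ⟧ ℕ.* (q-1 ℕ.* q ℕ.^ t)
      joint (yes ≡.refl) = ≡.trans (ℕₚ.*-assoc q q N) (≡.trans (cong (q ℕ.*_) (≡.trans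
        (cong (q ℕ.*_) (∑-cong (vecs t) (λ v → ⟦⟧-idem (x i ∙ v ≟ 0#)))) (count-orthogonal i)))
        (≡.trans (cong (ℕ._* q ℕ.^ t) (≡.sym (1+q-1))) (cong (q ℕ.^ t ℕ.+_) (≡.sym (ℕₚ.*-identityˡ _)))))
      joint (no j≢i) = ≡.trans (ℕₚ.*-assoc q q N) (≡.trans (cong (q ℕ.*_) (count-orthogonal₂ i j (λ i≡j → j≢i (≡.sym i≡j))))
        (≡.trans (count-orthogonal j) (≡.sym (ℕₚ.+-identityʳ _))))

    module _ (a : Fin n → ℕ) (a-idem : ∀ i → a i ℕ.* a i ≡ a i) where

      deviation : Vec → ℤ
      deviation v = ∑ℤ (allFin n) (λ i → ℤ.+ a i ℤ.* defect i v)

      -- Taken in ℕ through the absolute value, so that `∑-multiples` applies to it.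
      deviation² : Vec → ℕ
      deviation² v = ℤ.∣ deviation v ∣ ℕ.* ℤ.∣ deviation v ∣

      deviation-resp : ∀ {v w} → (∀ i → orthogonal i v ≡ orthogonal i w) → deviation v ≡ deviation w
      deviation-resp e = ℤ∑.∑-cong (allFin n) (λ i → cong (λ o → ℤ.+ a i ℤ.* (ℤ.+ q ℤ.* ℤ.+ o ℤ.- ℤ.1ℤ)) (e i))

      ∑-deviation² : ∑ (vecs t) deviation² ≡ ∑ (allFin n) a ℕ.* (q-1 ℕ.* q ℕ.^ t)
      ∑-deviation² = ℤₚ.+-injective (begin
        ℤ.+ ∑ (vecs t) deviation²
          ≡⟨ ≡.trans (pos-∑ (vecs t) deviation²) (ℤ∑.∑-cong (vecs t) (λ v → ≡.sym (square≡∣∣ (deviation v)))) ⟩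
        ∑ℤ (vecs t) (λ v → deviation v ℤ.* deviation v)
          ≡⟨ ℤ∑.∑-cong (vecs t) (λ v → ≡.trans (ℤ∑.∑-*-∑ (allFin n) (allFin n) _ _)
               (ℤ∑.∑-cong (allFin n) (λ i → ℤ∑.∑-cong (allFin n) (λ j → rearrange (ℤ.+ a i) (defect i v) (ℤ.+ a j) (defect j v))))) ⟩
        ∑ℤ (vecs t) (λ v → ∑ℤ (allFin n) (λ i → ∑ℤ (allFin n) (λ j → ℤ.+ a i ℤ.* ℤ.+ a j ℤ.* (defect i v ℤ.* defect j v))))
          ≡⟨ ≡.trans (ℤ∑.∑-comm (vecs t) (allFin n) _) (ℤ∑.∑-cong (allFin n) (λ i → ≡.trans (ℤ∑.∑-comm (vecs t) (allFin n) _)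
               (ℤ∑.∑-cong (allFin n) (λ j → ≡.trans (ℤ∑.∑-*ˡ (vecs t) (ℤ.+ a i ℤ.* ℤ.+ a j) _) (cong (ℤ.+ a i ℤ.* ℤ.+ a j ℤ.*_) (defect-correlation i j)))))) ⟩
        ∑ℤ (allFin n) (λ i → ∑ℤ (allFin n) (λ j → ℤ.+ a i ℤ.* ℤ.+ a j ℤ.* ℤ.+ (⟦ j Finₚ.≟ i ⟧ ℕ.* K)))
          ≡⟨ ℤ∑.∑-cong (allFin n) (λ i → ≡.trans (ℤ∑.∑-cong (allFin n) (λ j → ≡.trans
               (cong (ℤ._* ℤ.+ (⟦ j Finₚ.≟ i ⟧ ℕ.* K)) (≡.sym (ℤₚ.pos-* (a i) (a j)))) (≡.sym (ℤₚ.pos-* (a i ℕ.* a j) _))))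
               (≡.sym (pos-∑ (allFin n) _))) ⟩
        ∑ℤ (allFin n) (λ i → ℤ.+ ∑ (allFin n) (λ j → a i ℕ.* a j ℕ.* (⟦ j Finₚ.≟ i ⟧ ℕ.* K)))
          ≡⟨ pos-∑ (allFin n) _ ⟨
        ℤ.+ ∑ (allFin n) (λ i → ∑ (allFin n) (λ j → a i ℕ.* a j ℕ.* (⟦ j Finₚ.≟ i ⟧ ℕ.* K)))
          ≡⟨ cong ℤ.+_ (≡.trans (∑-cong (allFin n) (λ i → ≡.trans (∑-cong (allFin n) (λ j → rearrangeℕ (a i) (a j) ⟦ j Finₚ.≟ i ⟧ K))
               (≡.trans (Enumerated.∑-δ (finEnumerated n) i (cong (λ j → a i ℕ.* a j ℕ.* K))) (cong (ℕ._* K) (a-idem i)))))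
               (∑-*ʳ (allFin n) a K)) ⟩
        ℤ.+ (∑ (allFin n) a ℕ.* K)
          ∎)
        where
        open ≡.≡-Reasoning
        K = q-1 ℕ.* q ℕ.^ t
        rearrange : ∀ a d b e → a ℤ.* d ℤ.* (b ℤ.* e) ≡ a ℤ.* b ℤ.* (d ℤ.* e)
        rearrange = ℤ-Solver.solve-∀
        rearrangeℕ : ∀ a b d k → a ℕ.* b ℕ.* (d ℕ.* k) ≡ d ℕ.* (a ℕ.* b ℕ.* k)
        rearrangeℕ = solve-∀

      ∑-deviation²-points : ∑ (allFin n) (λ j → deviation² (x j)) ≤ ∑ (allFin n) a ℕ.* q ℕ.^ t
      ∑-deviation²-points = ℕₚ.*-cancelˡ-≤ (q-1) {{ℕ.>-nonZero (ℕₚ.∸-monoˡ-≤ {2} 1 (ℕₚ.≤-trans (s≤s (s≤s z≤n)) 3≤q))}} (begin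
        q-1 ℕ.* ∑ (allFin n) (λ j → deviation² (x j))
          ≡⟨ cong (ℕ._* ∑ (allFin n) (λ j → deviation² (x j))) ∑-≉0 ⟨
        ∑ 𝔽 (λ c → ⟦ ¬? (c ≟ 0#) ⟧) ℕ.* ∑ (allFin n) (λ j → deviation² (x j))
          ≡⟨ ≡.trans (∑-*-∑ 𝔽 (allFin n) _ _) (∑-cong 𝔽 (λ c → ∑-cong (allFin n) (λ j → homogeneous c j (c ≟ 0#)))) ⟩
        ∑ 𝔽 (λ c → ∑ (allFin n) (λ j → ⟦ ¬? (c ≟ 0#) ⟧ ℕ.* deviation² (λ l → c * x j l)))
          ≤⟨ ∑-multiples (λ {v} {w} v≋w → cong (λ d → ℤ.∣ d ∣ ℕ.* ℤ.∣ d ∣) (deviation-resp {v} {w} (λ i → orthogonality-resp i v≋w))) ⟩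
        ∑ (vecs t) deviation²
          ≡⟨ ∑-deviation² ⟩
        ∑ (allFin n) a ℕ.* (q-1 ℕ.* q ℕ.^ t)
          ≡⟨ swap (∑ (allFin n) a) (q-1) (q ℕ.^ t) ⟩
        q-1 ℕ.* (∑ (allFin n) a ℕ.* q ℕ.^ t)
          ∎)
        where
        open ℕₚ.≤-Reasoning
        swap : ∀ a b c → a ℕ.* (b ℕ.* c) ≡ b ℕ.* (a ℕ.* c)
        swap = solve-∀
        homogeneous : ∀ c j (c≟0 : Dec (c ≈ 0#)) → ⟦ ¬? c≟0 ⟧ ℕ.* deviation² (x j) ≡ ⟦ ¬? c≟0 ⟧ ℕ.* deviation² (λ l → c * x j l)
        homogeneous c j (yes _)  = ≡.refl
        homogeneous c j (no c≉0) = cong (λ d → 1 ℕ.* (ℤ.∣ d ∣ ℕ.* ℤ.∣ d ∣)) (deviation-resp (λ i →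
          ⟦⟧-cong (x i ∙ x j ≟ 0#) (x i ∙ (λ l → c * x j l) ≟ 0#)
            (λ e → trans (∙-scaleʳ c (x i) (x j)) (trans (*-congˡ e) (zeroʳ c)))
            (λ e → [ (λ c≈0 → contradiction c≈0 c≉0) , (λ e′ → e′) ] (zero-product (trans (sym (∙-scaleʳ c (x i) (x j))) e)))))

      discrepancy : (b : Fin n → ℕ) → (∀ j → b j ℕ.* b j ≡ b j) →
        let A = ∑ (allFin n) a ; B = ∑ (allFin n) b
            e = ∑ (allFin n) (λ i → ∑ (allFin n) (λ j → a i ℕ.* b j ℕ.* orthogonal i (x j)))
            D = ℤ.+ (q ℕ.* e) ℤ.- ℤ.+ (A ℕ.* B)
        in D ℤ.* D ℤ.≤ ℤ.+ (A ℕ.* B ℕ.* q ℕ.^ t)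
      discrepancy b b-idem = begin
        D ℤ.* D
          ≡⟨ cong (λ d → d ℤ.* d) D≡ ⟩
        ∑ℤ (allFin n) (λ j → ℤ.+ b j ℤ.* deviation (x j)) ℤ.* ∑ℤ (allFin n) (λ j → ℤ.+ b j ℤ.* deviation (x j))
          ≤⟨ cauchy-schwarz (allFin n) (λ j → ℤ.+ b j) (λ j → deviation (x j)) ⟩
        ∑ℤ (allFin n) (λ j → ℤ.+ b j ℤ.* ℤ.+ b j) ℤ.* ∑ℤ (allFin n) (λ j → deviation (x j) ℤ.* deviation (x j))
          ≡⟨ cong₂ ℤ._*_ (≡.trans (ℤ∑.∑-cong (allFin n) (λ j → ≡.trans (≡.sym (ℤₚ.pos-* (b j) (b j))) (cong ℤ.+_ (b-idem j)))) (≡.sym (pos-∑ (allFin n) b)))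
               (≡.trans (ℤ∑.∑-cong (allFin n) (λ j → square≡∣∣ (deviation (x j)))) (≡.sym (pos-∑ (allFin n) _))) ⟩
        ℤ.+ B ℤ.* ℤ.+ ∑ (allFin n) (λ j → deviation² (x j))
          ≡⟨ ℤₚ.pos-* B _ ⟨
        ℤ.+ (B ℕ.* ∑ (allFin n) (λ j → deviation² (x j)))
          ≤⟨ ℤ.+≤+ (ℕₚ.*-monoʳ-≤ B ∑-deviation²-points) ⟩
        ℤ.+ (B ℕ.* (A ℕ.* q ℕ.^ t))
          ≡⟨ cong ℤ.+_ (swap A B (q ℕ.^ t)) ⟩
        ℤ.+ (A ℕ.* B ℕ.* q ℕ.^ t)
          ∎
        where
        open ℤₚ.≤-Reasoning
        A = ∑ (allFin n) a
        B = ∑ (allFin n) b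
        e = ∑ (allFin n) (λ i → ∑ (allFin n) (λ j → a i ℕ.* b j ℕ.* orthogonal i (x j)))
        D = ℤ.+ (q ℕ.* e) ℤ.- ℤ.+ (A ℕ.* B)
        swap : ∀ a b c → b ℕ.* (a ℕ.* c) ≡ a ℕ.* b ℕ.* c
        swap = solve-∀
        expand : ∀ a b Q o → a ℤ.* b ℤ.* o ℤ.* Q ℤ.+ a ℤ.* ℤ.- b ≡ b ℤ.* (a ℤ.* (Q ℤ.* o ℤ.- ℤ.1ℤ))
        expand = ℤ-Solver.solve-∀
        -- Both q e and A B are double sums over i and j, and their difference has the terms a i b j
        -- (q [x i ∙ x j = 0] - 1). Summing over i inside leaves b j times the deviation at x j.
        D≡ : D ≡ ∑ℤ (allFin n) (λ j → ℤ.+ b j ℤ.* deviation (x j))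
        D≡ = begin-equality
          ℤ.+ (q ℕ.* e) ℤ.- ℤ.+ (A ℕ.* B)
            ≡⟨ cong₂ ℤ._+_ (≡.trans (cong ℤ.+_ (ℕₚ.*-comm q e)) (≡.trans (ℤₚ.pos-* e q) (cong (ℤ._* ℤ.+ q) (≡.trans (pos-∑ (allFin n) _)
                 (ℤ∑.∑-cong (allFin n) (λ i → ≡.trans (pos-∑ (allFin n) _) (ℤ∑.∑-cong (allFin n) (λ j →
                   ≡.trans (ℤₚ.pos-* (a i ℕ.* b j) _) (cong (ℤ._* ℤ.+ orthogonal i (x j)) (ℤₚ.pos-* (a i) (b j)))))))))))
               (≡.trans (cong ℤ.-_ (≡.trans (ℤₚ.pos-* A B) (cong₂ ℤ._*_ (pos-∑ (allFin n) a) (pos-∑ (allFin n) b))))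
                 (≡.trans (ℤₚ.neg-distribʳ-* (∑ℤ (allFin n) (λ i → ℤ.+ a i)) (∑ℤ (allFin n) (λ j → ℤ.+ b j))) (cong (∑ℤ (allFin n) (λ i → ℤ.+ a i) ℤ.*_) (≡.trans (≡.sym (ℤₚ.-1*i≡-i _)) (≡.sym (ℤ∑.∑-*ˡ (allFin n) ℤ.-1ℤ _)))))) ⟩
          ∑ℤ (allFin n) (λ i → ∑ℤ (allFin n) (λ j → ℤ.+ a i ℤ.* ℤ.+ b j ℤ.* ℤ.+ orthogonal i (x j))) ℤ.* ℤ.+ q ℤ.+
            ∑ℤ (allFin n) (λ i → ℤ.+ a i) ℤ.* ∑ℤ (allFin n) (λ j → ℤ.-1ℤ ℤ.* ℤ.+ b j)
            ≡⟨ cong₂ ℤ._+_ (≡.trans (≡.sym (ℤ∑.∑-*ʳ (allFin n) _ _)) (ℤ∑.∑-cong (allFin n) (λ i → ≡.sym (ℤ∑.∑-*ʳ (allFin n) _ _))))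
                 (ℤ∑.∑-*-∑ (allFin n) (allFin n) _ _) ⟩
          ∑ℤ (allFin n) (λ i → ∑ℤ (allFin n) (λ j → ℤ.+ a i ℤ.* ℤ.+ b j ℤ.* ℤ.+ orthogonal i (x j) ℤ.* ℤ.+ q)) ℤ.+
            ∑ℤ (allFin n) (λ i → ∑ℤ (allFin n) (λ j → ℤ.+ a i ℤ.* (ℤ.-1ℤ ℤ.* ℤ.+ b j)))
            ≡⟨ ≡.trans (≡.sym (ℤ∑.∑-+ (allFin n) _ _)) (ℤ∑.∑-cong (allFin n) (λ i → ≡.trans (≡.sym (ℤ∑.∑-+ (allFin n) _ _))
                 (ℤ∑.∑-cong (allFin n) (λ j → ≡.trans (cong (λ m → ℤ.+ a i ℤ.* ℤ.+ b j ℤ.* ℤ.+ orthogonal i (x j) ℤ.* ℤ.+ q ℤ.+ ℤ.+ a i ℤ.* m) (ℤₚ.-1*i≡-i (ℤ.+ b j)))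
                   (expand (ℤ.+ a i) (ℤ.+ b j) (ℤ.+ q) (ℤ.+ orthogonal i (x j))))))) ⟩
          ∑ℤ (allFin n) (λ i → ∑ℤ (allFin n) (λ j → ℤ.+ b j ℤ.* (ℤ.+ a i ℤ.* defect i (x j))))
            ≡⟨ ≡.trans (ℤ∑.∑-comm (allFin n) (allFin n) _) (ℤ∑.∑-cong (allFin n) (λ j → ℤ∑.∑-*ˡ (allFin n) (ℤ.+ b j) _)) ⟩
          ∑ℤ (allFin n) (λ j → ℤ.+ b j ℤ.* deviation (x j))
            ∎

-- Edges of a graph

⟦⟧-⊎ : {P Q : Set} (P? : Dec P) (Q? : Dec Q) → ⟦ P? ⊎-dec Q? ⟧ ℕ.+ ⟦ P? ⟧ ℕ.* ⟦ Q? ⟧ ≡ ⟦ P? ⟧ ℕ.+ ⟦ Q? ⟧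
⟦⟧-⊎ (yes _) (yes _) = ≡.refl
⟦⟧-⊎ (yes _) (no _)  = ≡.refl
⟦⟧-⊎ (no _)  (yes _) = ≡.refl
⟦⟧-⊎ (no _)  (no _)  = ≡.refl

length-filter : {A : Set} {P : U.Pred A 0ℓ} (P? : U.Decidable P) (xs : List A) → length (filter P? xs) ≡ ∑ xs (λ x → ⟦ P? x ⟧)
length-filter P? xs = ≡.trans (≡.sym (≡.trans (∑-const (filter P? xs) 1) (ℕₚ.*-identityʳ _)))
  (≡.trans (∑-filter P? xs (λ _ → 1)) (∑-cong xs (λ x → ℕₚ.*-identityʳ _)))

∣∣≡∑ : ∀ {n} (p : Subset n) → ∣ p ∣ ≡ ∑ (allFin n) (λ i → ⟦ i ∈? p ⟧)
∣∣≡∑ []            = ≡.refl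
∣∣≡∑ (s ∷ p)       = ≡.trans (head s) (≡.sym (≡.trans (∑-allFin-suc (λ i → ⟦ i ∈? (s ∷ p) ⟧))
  (cong (⟦ Fin.zero ∈? (s ∷ p) ⟧ ℕ.+_) (≡.trans (∑-cong (allFin _) (λ i → ⟦⟧-cong (Fin.suc i ∈? (s ∷ p)) (i ∈? p) drop-there there)) (≡.sym (∣∣≡∑ p))))))
  where
  head : ∀ s → ∣ s ∷ p ∣ ≡ ⟦ Fin.zero ∈? (s ∷ p) ⟧ ℕ.+ ∣ p ∣
  head inside  = ≡.refl
  head outside = ≡.refl

module _ (G : Graph) where
  open Graph G

  -- An edge has both ends in X ∩ Y exactly when both of its orientations run from X to Y. So the
  -- second summand of `edgeCount` is the overlap term of inclusion-exclusion, and the total counts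
  -- the oriented edges from X to Y.
  edgeCount≡∑ : ∀ (X Y : Subset order) → edgeCount G X Y ≡
    ∑ (allFin order) (λ i → ∑ (allFin order) (λ j → ⟦ i ∈? X ⟧ ℕ.* ⟦ j ∈? Y ⟧ ℕ.* ⟦ adjacent? (vertex i) (vertex j) ⟧))
  edgeCount≡∑ X Y = begin
    edgeCount G X Y
      ≡⟨ cong₂ ℕ._+_ (length-filter _ (edges G)) (length-filter _ (edges G)) ⟩
    ∑ (edges G) (λ (i , j) → ⟦ ((i ∈? X) ×-dec (j ∈? Y)) ⊎-dec ((j ∈? X) ×-dec (i ∈? Y)) ⟧) ℕ.+
      ∑ (edges G) (λ (i , j) → ⟦ (i ∈? (X ∩ Y)) ×-dec (j ∈? (X ∩ Y)) ⟧)
      ≡⟨ ≡.trans (≡.sym (∑-+ (edges G) _ _)) (∑-cong (edges G) (λ (i , j) → both-ways i j)) ⟩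
    ∑ (edges G) (λ (i , j) → a i ℕ.* b j ℕ.+ a j ℕ.* b i)
      ≡⟨ ≡.trans (∑-filter _ pairs _) (∑-cartesianProduct V V _) ⟩
    ∑ V (λ i → ∑ V (λ j → ⟦ (i Finₚ.<? j) ×-dec adj i j ⟧ ℕ.* (a i ℕ.* b j ℕ.+ a j ℕ.* b i)))
      ≡⟨ ≡.trans (∑-cong V (λ i → ≡.trans (∑-cong V (λ j → ℕₚ.*-distribˡ-+ ⟦ (i Finₚ.<? j) ×-dec adj i j ⟧ (a i ℕ.* b j) (a j ℕ.* b i))) (∑-+ V _ _))) (∑-+ V _ _) ⟩
    ∑ V (λ i → ∑ V (λ j → ⟦ (i Finₚ.<? j) ×-dec adj i j ⟧ ℕ.* (a i ℕ.* b j))) ℕ.+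
      ∑ V (λ i → ∑ V (λ j → ⟦ (i Finₚ.<? j) ×-dec adj i j ⟧ ℕ.* (a j ℕ.* b i)))
      ≡⟨ cong (∑ V (λ i → ∑ V (λ j → ⟦ (i Finₚ.<? j) ×-dec adj i j ⟧ ℕ.* (a i ℕ.* b j))) ℕ.+_) (∑-comm V V _) ⟩
    ∑ V (λ i → ∑ V (λ j → ⟦ (i Finₚ.<? j) ×-dec adj i j ⟧ ℕ.* (a i ℕ.* b j))) ℕ.+
      ∑ V (λ i → ∑ V (λ j → ⟦ (j Finₚ.<? i) ×-dec adj j i ⟧ ℕ.* (a i ℕ.* b j)))
      ≡⟨ ≡.trans (≡.sym (∑-+ V _ _)) (∑-cong V (λ i → ≡.trans (≡.sym (∑-+ V _ _)) (∑-cong V (λ j → ordered i j)))) ⟩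
    ∑ V (λ i → ∑ V (λ j → a i ℕ.* b j ℕ.* ⟦ adj i j ⟧))
      ∎
    where
    open ≡.≡-Reasoning
    V = allFin order
    pairs = cartesianProduct V V
    a b : Fin order → ℕ
    a i = ⟦ i ∈? X ⟧
    b i = ⟦ i ∈? Y ⟧
    adj : ∀ i j → Dec (Adjacent (vertex i) (vertex j))
    adj i j = adjacent? (vertex i) (vertex j)
    both : ∀ i → ⟦ i ∈? (X ∩ Y) ⟧ ≡ a i ℕ.* b i
    both i = ≡.trans (⟦⟧-cong (i ∈? (X ∩ Y)) ((i ∈? X) ×-dec (i ∈? Y)) (x∈p∩q⁻ X Y) x∈p∩q⁺) (⟦⟧-× (i ∈? X) (i ∈? Y))
    both-ways : ∀ i j → ⟦ ((i ∈? X) ×-dec (j ∈? Y)) ⊎-dec ((j ∈? X) ×-dec (i ∈? Y)) ⟧ ℕ.+ ⟦ (i ∈? (X ∩ Y)) ×-dec (j ∈? (X ∩ Y)) ⟧ ≡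
                        a i ℕ.* b j ℕ.+ a j ℕ.* b i
    both-ways i j = ≡.trans (cong (⟦ ((i ∈? X) ×-dec (j ∈? Y)) ⊎-dec ((j ∈? X) ×-dec (i ∈? Y)) ⟧ ℕ.+_) (≡.trans
      (⟦⟧-× (i ∈? (X ∩ Y)) (j ∈? (X ∩ Y))) (≡.trans (cong₂ ℕ._*_ (both i) (both j)) (≡.trans (swap (a i) (b i) (a j) (b j))
        (≡.sym (cong₂ ℕ._*_ (⟦⟧-× (i ∈? X) (j ∈? Y)) (⟦⟧-× (j ∈? X) (i ∈? Y))))))))
      (≡.trans (⟦⟧-⊎ ((i ∈? X) ×-dec (j ∈? Y)) ((j ∈? X) ×-dec (i ∈? Y))) (cong₂ ℕ._+_ (⟦⟧-× (i ∈? X) (j ∈? Y)) (⟦⟧-× (j ∈? X) (i ∈? Y))))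
      where
      swap : ∀ a b c d → a ℕ.* b ℕ.* (c ℕ.* d) ≡ a ℕ.* d ℕ.* (c ℕ.* b)
      swap = solve-∀
    orient : ∀ i j → ⟦ (i Finₚ.<? j) ×-dec adj i j ⟧ ℕ.+ ⟦ (j Finₚ.<? i) ×-dec adj j i ⟧ ≡ ⟦ adj i j ⟧
    orient i j with Finₚ.<-cmp i j
    ... | tri< i<j _ i≯j = ≡.trans (cong₂ ℕ._+_
            (⟦⟧-cong ((i Finₚ.<? j) ×-dec adj i j) (adj i j) proj₂ (i<j ,_)) (⟦⟧-no ((j Finₚ.<? i) ×-dec adj j i) (λ (j<i , _) → i≯j j<i))) (ℕₚ.+-identityʳ _)
    ... | tri> i≮j _ j<i = cong₂ ℕ._+_ (⟦⟧-no ((i Finₚ.<? j) ×-dec adj i j) (λ (i<j , _) → i≮j i<j))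
            (⟦⟧-cong ((j Finₚ.<? i) ×-dec adj j i) (adj i j) (λ (_ , e) → adj-sym e) (λ e → j<i , adj-sym e))
    ... | tri≈ i≮j ≡.refl _ = ≡.trans (cong₂ ℕ._+_ (⟦⟧-no ((i Finₚ.<? i) ×-dec adj i i) (λ (i<i , _) → i≮j i<i))
            (⟦⟧-no ((i Finₚ.<? i) ×-dec adj i i) (λ (i<i , _) → i≮j i<i))) (≡.sym (⟦⟧-no (adj i i) adj-irrefl))
    ordered : ∀ i j → ⟦ (i Finₚ.<? j) ×-dec adj i j ⟧ ℕ.* (a i ℕ.* b j) ℕ.+ ⟦ (j Finₚ.<? i) ×-dec adj j i ⟧ ℕ.* (a i ℕ.* b j) ≡
                      a i ℕ.* b j ℕ.* ⟦ adj i j ⟧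
    ordered i j = ≡.trans (≡.sym (ℕₚ.*-distribʳ-+ (a i ℕ.* b j) ⟦ (i Finₚ.<? j) ×-dec adj i j ⟧ ⟦ (j Finₚ.<? i) ×-dec adj j i ⟧)) (≡.trans (cong (ℕ._* (a i ℕ.* b j)) (orient i j)) (ℕₚ.*-comm _ (a i ℕ.* b j)))

-- Roots

open RationalLemmas

ι-mono : ∀ {m n} → m ≤ n → ι m ℚ.≤ ι n
ι-mono {m} {n} m≤n = subst (λ k → ι m ℚ.≤ ι k) (ℕₚ.m+[n∸m]≡n m≤n)
  (subst (ι m ℚ.≤_) (≡.sym (ι-+ m (n ℕ.∸ m))) (≤-+ʳ (0≤ι (n ℕ.∸ m))))

ι-^ : ∀ n k → ι (n ℕ.^ k) ≡ ι n ^ℚ k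
ι-^ n zero    = ≡.refl
ι-^ n (suc k) = ≡.trans (ι-* n (n ℕ.^ k)) (cong (ι n ℚ.*_) (ι-^ n k))

1^ : ∀ k → 1ℚ ^ℚ k ≡ 1ℚ
1^ zero    = ≡.refl
1^ (suc k) = ≡.trans (ℚₚ.*-identityˡ _) (1^ k)

^-distrib-* : ∀ x y k → (x ℚ.* y) ^ℚ k ≡ x ^ℚ k ℚ.* y ^ℚ k
^-distrib-* x y zero    = ≡.refl
^-distrib-* x y (suc k) = ≡.trans (cong (x ℚ.* y ℚ.*_) (^-distrib-* x y k))
  (solve 4 (λ x y a b → x :* y :* (a :* b) := x :* a :* (y :* b)) ≡.refl x y (x ^ℚ k) (y ^ℚ k))
  where open +-*-Solver

^-cancel-≤ : ∀ k {x y} → 0ℚ ℚ.≤ y → x ^ℚ suc k ℚ.≤ y ^ℚ suc k → x ℚ.≤ y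
^-cancel-≤ k {x} {y} 0≤y x^≤y^ with x ℚₚ.≤? y
... | yes x≤y = x≤y
... | no x≰y  = contradiction (ℚₚ.<-≤-trans y^<x^ x^≤y^) (ℚₚ.<-irrefl ≡.refl)
  where
  y<x = ℚₚ.≰⇒> x≰y
  d = x ℚ.- y
  0<d : 0ℚ ℚ.< d
  0<d = subst (ℚ._< d) (ℚₚ.+-inverseʳ y) (ℚₚ.+-monoˡ-< (ℚ.- y) y<x)
  y+d≡x : y ℚ.+ d ≡ x
  y+d≡x = solve 2 (λ x y → y :+ (x :- y) := x) ≡.refl x y
    where open +-*-Solver
  y^<x^ : y ^ℚ suc k ℚ.< x ^ℚ suc k
  y^<x^ = begin-strict
    y ^ℚ suc k                        ≡⟨ ℚₚ.+-identityʳ _ ⟨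
    y ^ℚ suc k ℚ.+ 0ℚ                 <⟨ ℚₚ.+-monoʳ-< (y ^ℚ suc k) (0<^ (suc k) 0<d) ⟩
    y ^ℚ suc k ℚ.+ d ^ℚ suc k         ≤⟨ ^-superadditive k 0≤y (ℚₚ.<⇒≤ 0<d) ⟩
    (y ℚ.+ d) ^ℚ suc k                ≡⟨ cong (_^ℚ suc k) y+d≡x ⟩
    x ^ℚ suc k                        ∎
    where open ℚₚ.≤-Reasoning

mesh-vanishes : ∀ C → 0ℚ ℚ.< C → ∀ ε → 0ℚ ℚ.< ε → ∃ λ N → ∀ n → N ≤ n → C ℚ.* mesh n ℚ.≤ ε
mesh-vanishes C 0<C ε 0<ε = ↧ₙ e , λ n N≤n → begin
  C ℚ.* mesh n               ≤⟨ ℚₚ.*-monoˡ-≤-nonNeg C {{ℚ.nonNegative (ℚₚ.<⇒≤ 0<C)}} (mesh≤ {e} n 0<e N≤n) ⟩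
  C ℚ.* (ℚ.1/ C ℚ.* ε)       ≡⟨ ℚₚ.*-assoc C (ℚ.1/ C) ε ⟨
  C ℚ.* ℚ.1/ C ℚ.* ε         ≡⟨ cong (ℚ._* ε) (ℚₚ.*-inverseʳ C) ⟩
  1ℚ ℚ.* ε                   ≡⟨ ℚₚ.*-identityˡ ε ⟩
  ε                          ∎
  where
  open ℚₚ.≤-Reasoning
  instance
    C-pos : ℚ.Positive C
    C-pos = ℚ.positive 0<C
    C-nonZero : ℚ.NonZero C
    C-nonZero = ℚₚ.pos⇒nonZero C
  e = ℚ.1/ C ℚ.* ε
  0<e : 0ℚ ℚ.< e
  0<e = 0<* (ℚₚ.positive⁻¹ (ℚ.1/ C) {{ℚₚ.1/pos⇒pos C}}) 0<ε

-- The power form of x ≤ C b^(1/(k+1)). The approximate root is short of the true one by less than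
-- `mesh n`, and the loss C `mesh n` is absorbed by ε. Since x is a sequence, it may consist of
-- approximate roots too.
≤-root : ∀ k b C → 0ℚ ℚ.< C → (x : ℕ → ℚ) → (∀ n → x n ^ℚ suc k ℚ.≤ C ^ℚ suc k ℚ.* b) →
         ∀ ε → 0ℚ ℚ.< ε → ∃ λ N → ∀ n → N ≤ n → x n ℚ.≤ C ℚ.* approxRoot (suc k) (b ℚ.⊔ 0ℚ) n ℚ.+ ε
≤-root k b C 0<C x x^≤ ε 0<ε = let (N , small) = mesh-vanishes C 0<C ε 0<ε in N , λ n N≤n → begin
  x n
    ≤⟨ ^-cancel-≤ k {x n} {C ℚ.* (r n ℚ.+ mesh n)} (0≤* 0≤C (0≤+ {r n} {mesh n} (approxRoot-nonNeg (suc k) b⁺ n) (ℚₚ.<⇒≤ (0<mesh n)))) (below n) ⟩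
  C ℚ.* (r n ℚ.+ mesh n)                  ≡⟨ ℚₚ.*-distribˡ-+ C (r n) (mesh n) ⟩
  C ℚ.* r n ℚ.+ C ℚ.* mesh n              ≤⟨ ℚₚ.+-monoʳ-≤ (C ℚ.* r n) (small n N≤n) ⟩
  C ℚ.* r n ℚ.+ ε                         ∎
  where
  open ℚₚ.≤-Reasoning
  b⁺ = b ℚ.⊔ 0ℚ
  r = approxRoot (suc k) b⁺
  0≤C = ℚₚ.<⇒≤ 0<C
  below : ∀ n → x n ^ℚ suc k ℚ.≤ (C ℚ.* (r n ℚ.+ mesh n)) ^ℚ suc k
  below n = begin
    x n ^ℚ suc k                                ≤⟨ x^≤ n ⟩
    C ^ℚ suc k ℚ.* b
      ≤⟨ ℚₚ.*-monoˡ-≤-nonNeg (C ^ℚ suc k) {{ℚ.nonNegative (0≤^ (suc k) 0≤C)}} (ℚₚ.≤-trans (ℚₚ.p≤p⊔q b 0ℚ) (ℚₚ.<⇒≤ (approxRoot-upper k b⁺ n))) ⟩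
    C ^ℚ suc k ℚ.* (r n ℚ.+ mesh n) ^ℚ suc k    ≡⟨ ^-distrib-* C (r n ℚ.+ mesh n) (suc k) ⟨
    (C ℚ.* (r n ℚ.+ mesh n)) ^ℚ suc k           ∎

≤-squared : ∀ x a → 0ℚ ℚ.≤ a → x ^ℚ 2 ℚ.≤ a → x ℚ.≤ 1ℚ ℚ.+ a
≤-squared x a 0≤a x²≤a with ℚₚ.≤-total 1ℚ x
... | inj₂ x≤1 = ℚₚ.≤-trans {x} {1ℚ} {1ℚ ℚ.+ a} x≤1 (≤-+ʳ {1ℚ} {a} 0≤a)
... | inj₁ 1≤x = begin
  x             ≤⟨ a≤^ 1 {x} 1≤x ⟩
  x ^ℚ 2        ≤⟨ x²≤a ⟩
  a             ≡⟨ ℚₚ.+-identityˡ a ⟨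
  0ℚ ℚ.+ a      ≤⟨ ℚₚ.+-monoˡ-≤ a {0ℚ} {1ℚ} 0≤1 ⟩
  1ℚ ℚ.+ a      ∎
  where open ℚₚ.≤-Reasoning

mesh≤1 : ∀ n → mesh n ℚ.≤ 1ℚ
mesh≤1 n = begin
  mesh n                   ≡⟨ ℚₚ.*-identityˡ (mesh n) ⟨
  1ℚ ℚ.* mesh n
    ≤⟨ ℚₚ.*-monoʳ-≤-nonNeg (mesh n) {{ℚ.nonNegative (ℚₚ.<⇒≤ (0<mesh n))}} {1ℚ} {ι (suc n)} (ι-mono {1} {suc n} (s≤s z≤n)) ⟩
  ι (suc n) ℚ.* mesh n     ≡⟨ ι*mesh n ⟩
  1ℚ                       ∎
  where open ℚₚ.≤-Reasoning

-- The product of two roots, each off by at most d, is off by at most (r + s + d) d. This is a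
-- rational bound for r + s + d when r² ≤ a, s² ≤ b and d ≤ 1; being independent of the precision,
-- it may be crude.
rootBound : ℚ → ℚ → ℚ
rootBound a b = (1ℚ ℚ.+ a) ℚ.+ ((1ℚ ℚ.+ b) ℚ.+ 1ℚ)

0<rootBound : ∀ a b → 0ℚ ℚ.≤ a → 0ℚ ℚ.≤ b → 0ℚ ℚ.< rootBound a b
0<rootBound a b 0≤a 0≤b = begin-strict
  0ℚ                                         <⟨ 0<1 ⟩
  1ℚ                                         ≤⟨ ≤-+ʳ {1ℚ} {a} 0≤a ⟩
  1ℚ ℚ.+ a
    ≤⟨ ≤-+ʳ {1ℚ ℚ.+ a} {(1ℚ ℚ.+ b) ℚ.+ 1ℚ} (0≤+ {1ℚ ℚ.+ b} {1ℚ} (0≤+ {1ℚ} {b} 0≤1 0≤b) 0≤1) ⟩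
  (1ℚ ℚ.+ a) ℚ.+ ((1ℚ ℚ.+ b) ℚ.+ 1ℚ)         ∎
  where open ℚₚ.≤-Reasoning

≤-product-of-roots : ∀ a b z r s d → 0ℚ ℚ.≤ a → 0ℚ ℚ.≤ b → 0ℚ ℚ.≤ r → 0ℚ ℚ.≤ s → 0ℚ ℚ.≤ d → d ℚ.≤ 1ℚ →
  z ^ℚ 2 ℚ.≤ a ℚ.* b → r ^ℚ 2 ℚ.≤ a → s ^ℚ 2 ℚ.≤ b → a ℚ.≤ (r ℚ.+ d) ^ℚ 2 → b ℚ.≤ (s ℚ.+ d) ^ℚ 2 →
  z ℚ.≤ r ℚ.* s ℚ.+ rootBound a b ℚ.* d
≤-product-of-roots a b z r s d 0≤a 0≤b 0≤r 0≤s 0≤d d≤1 z²≤ab r²≤a s²≤b a≤ b≤ = begin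
  z                                              ≤⟨ ^-cancel-≤ 1 {z} {(r ℚ.+ d) ℚ.* (s ℚ.+ d)} (0≤* {r ℚ.+ d} {s ℚ.+ d} (0≤+ {r} {d} 0≤r 0≤d) (0≤+ {s} {d} 0≤s 0≤d)) z²≤ ⟩
  (r ℚ.+ d) ℚ.* (s ℚ.+ d)                        ≡⟨ expand r s d ⟩
  r ℚ.* s ℚ.+ (r ℚ.+ (s ℚ.+ d)) ℚ.* d
    ≤⟨ ℚₚ.+-monoʳ-≤ (r ℚ.* s) {(r ℚ.+ (s ℚ.+ d)) ℚ.* d} {rootBound a b ℚ.* d}
                                                      (ℚₚ.*-monoʳ-≤-nonNeg d {{ℚ.nonNegative 0≤d}} {r ℚ.+ (s ℚ.+ d)} {rootBound a b} bounded) ⟩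
  r ℚ.* s ℚ.+ rootBound a b ℚ.* d                ∎
  where
  open ℚₚ.≤-Reasoning
  bounded : r ℚ.+ (s ℚ.+ d) ℚ.≤ rootBound a b
  bounded = ℚₚ.+-mono-≤ {r} {1ℚ ℚ.+ a} {s ℚ.+ d} {(1ℚ ℚ.+ b) ℚ.+ 1ℚ} (≤-squared r a 0≤a r²≤a)
    (ℚₚ.+-mono-≤ {s} {1ℚ ℚ.+ b} {d} {1ℚ} (≤-squared s b 0≤b s²≤b) d≤1)
  expand : ∀ r s d → (r ℚ.+ d) ℚ.* (s ℚ.+ d) ≡ r ℚ.* s ℚ.+ (r ℚ.+ (s ℚ.+ d)) ℚ.* d
  expand = solve 3 (λ r s d → (r :+ d) :* (s :+ d) := r :* s :+ (r :+ (s :+ d)) :* d) ≡.refl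
    where open +-*-Solver
  z²≤ : z ^ℚ 2 ℚ.≤ ((r ℚ.+ d) ℚ.* (s ℚ.+ d)) ^ℚ 2
  z²≤ = begin
    z ^ℚ 2                                  ≤⟨ z²≤ab ⟩
    a ℚ.* b                                 ≤⟨ *-mono-≤ {a} {(r ℚ.+ d) ^ℚ 2} {b} {(s ℚ.+ d) ^ℚ 2} 0≤a 0≤b a≤ b≤ ⟩
    (r ℚ.+ d) ^ℚ 2 ℚ.* (s ℚ.+ d) ^ℚ 2       ≡⟨ ^-distrib-* (r ℚ.+ d) (s ℚ.+ d) 2 ⟨
    ((r ℚ.+ d) ℚ.* (s ℚ.+ d)) ^ℚ 2          ∎

≤-√*√ : ∀ a b z → 0ℚ ℚ.≤ a → 0ℚ ℚ.≤ b → z ^ℚ 2 ℚ.≤ a ℚ.* b →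
        ∀ ε → 0ℚ ℚ.< ε → ∃ λ N → ∀ n → N ≤ n → z ℚ.≤ approxRoot 2 a n ℚ.* approxRoot 2 b n ℚ.+ ε
≤-√*√ a b z 0≤a 0≤b z²≤ab ε 0<ε = proj₁ limit , λ n N≤n → ℚₚ.≤-trans
  {z} {approxRoot 2 a n ℚ.* approxRoot 2 b n ℚ.+ rootBound a b ℚ.* mesh n} {approxRoot 2 a n ℚ.* approxRoot 2 b n ℚ.+ ε}
  (≤-product-of-roots a b z (approxRoot 2 a n) (approxRoot 2 b n) (mesh n) 0≤a 0≤b (approxRoot-nonNeg 2 a n) (approxRoot-nonNeg 2 b n)
    (ℚₚ.<⇒≤ (0<mesh n)) (mesh≤1 n) z²≤ab (approxRoot-lower 1 a n 0≤a) (approxRoot-lower 1 b n 0≤b)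
    (ℚₚ.<⇒≤ (approxRoot-upper 1 a n)) (ℚₚ.<⇒≤ (approxRoot-upper 1 b n)))
  (ℚₚ.+-monoʳ-≤ (approxRoot 2 a n ℚ.* approxRoot 2 b n) {rootBound a b ℚ.* mesh n} {ε} (proj₂ limit n N≤n))
  where
  limit = mesh-vanishes (rootBound a b) (0<rootBound a b 0≤a 0≤b) ε 0<ε

fromℚ-mono : ∀ {a b} → a ℚ.≤ b → fromℚ a ≤ᴿ fromℚ b
fromℚ-mono {a} {b} a≤b ε 0<ε = 0 , λ _ _ → ℚₚ.≤-trans a≤b (≤-+ʳ (ℚₚ.<⇒≤ 0<ε))

fromℚ-pos : ∀ {a} → 0ℚ ℚ.< a → 0ᴿ <ᴿ fromℚ a
fromℚ-pos {a} 0<a = a , 0<a , 0 , λ _ _ → ℚₚ.≤-reflexive (ℚₚ.+-identityˡ a)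

0≤√ : ∀ x → 0ᴿ ≤ᴿ √ x
0≤√ x ε 0<ε = 0 , λ n _ → ℚₚ.≤-trans (approxRoot-nonNeg 2 (seq x n ℚ.⊔ 0ℚ) n) (≤-+ʳ (ℚₚ.<⇒≤ 0<ε))

⊔0 : ∀ {a} → 0ℚ ℚ.≤ a → a ℚ.⊔ 0ℚ ≡ a
⊔0 0≤a = ℚₚ.p≥q⇒p⊔q≡p 0≤a

mul-monoʳ : ∀ c {a b} → 0ℚ ℚ.≤ c → a ℚ.≤ b → a ℚ.* c ℚ.≤ b ℚ.* c
mul-monoʳ c {a} {b} 0≤c a≤b = ℚₚ.*-monoʳ-≤-nonNeg c {{ℚ.nonNegative 0≤c}} {a} {b} a≤b

mul-monoˡ : ∀ c {a b} → 0ℚ ℚ.≤ c → a ℚ.≤ b → c ℚ.* a ℚ.≤ c ℚ.* b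
mul-monoˡ c {a} {b} 0≤c a≤b = ℚₚ.*-monoˡ-≤-nonNeg c {{ℚ.nonNegative 0≤c}} {a} {b} a≤b

-- Real bounds from the comparison of n with a power of q

reciprocal-≤ : ∀ c {Q P N M} → Q ℚ.* P ≡ 1ℚ → N ℚ.* M ≡ 1ℚ → 0ℚ ℚ.≤ P → 0ℚ ℚ.≤ M → Q ℚ.≤ c ℚ.* N → M ℚ.≤ c ℚ.* P
reciprocal-≤ c {Q} {P} {N} {M} QP≡1 NM≡1 0≤P 0≤M Q≤cN = begin
  M                        ≡⟨ ℚₚ.*-identityˡ M ⟨
  1ℚ ℚ.* M                 ≡⟨ cong (ℚ._* M) QP≡1 ⟨
  Q ℚ.* P ℚ.* M            ≤⟨ mul-monoʳ M {Q ℚ.* P} {c ℚ.* N ℚ.* P} 0≤M (mul-monoʳ P {Q} {c ℚ.* N} 0≤P Q≤cN) ⟩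
  c ℚ.* N ℚ.* P ℚ.* M      ≡⟨ solve 4 (λ c N P M → c :* N :* P :* M := c :* P :* (N :* M)) ≡.refl c N P M ⟩
  c ℚ.* P ℚ.* (N ℚ.* M)    ≡⟨ cong (c ℚ.* P ℚ.*_) NM≡1 ⟩
  c ℚ.* P ℚ.* 1ℚ           ≡⟨ ℚₚ.*-identityʳ (c ℚ.* P) ⟩
  c ℚ.* P                  ∎
  where
  open ℚₚ.≤-Reasoning
  open +-*-Solver

-- Because c ≤ c^(k+1), the constant c can replace its own (k+1)-st root, which keeps the constants
-- of Θ rational.
≤-scaled-power : ∀ k c {m p} → 1ℚ ℚ.≤ c → 0ℚ ℚ.≤ p → m ℚ.≤ c ℚ.* p → m ℚ.≤ c ^ℚ suc k ℚ.* p
≤-scaled-power k c {m} {p} 1≤c 0≤p m≤cp = ℚₚ.≤-trans {m} {c ℚ.* p} {c ^ℚ suc k ℚ.* p} m≤cp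
  (mul-monoʳ p {c} {c ^ℚ suc k} 0≤p (a≤^ k {c} 1≤c))

root-≤ : ∀ k c d s m p → 1ℚ ℚ.≤ c → 0ℚ ℚ.≤ d → d ℚ.* c ≡ 1ℚ → 0ℚ ℚ.≤ p → s ^ℚ suc k ℚ.≤ m → m ℚ.≤ c ℚ.* p ^ℚ suc k → d ℚ.* s ℚ.≤ p
root-≤ k c d s m p 1≤c 0≤d dc≡1 0≤p s^≤m m≤ = begin
  d ℚ.* s
    ≤⟨ mul-monoˡ d {s} {c ℚ.* p} 0≤d (^-cancel-≤ k {s} {c ℚ.* p} (0≤* {c} {p} (ℚₚ.≤-trans {0ℚ} {1ℚ} {c} 0≤1 1≤c) 0≤p) s^≤) ⟩
  d ℚ.* (c ℚ.* p)      ≡⟨ ℚₚ.*-assoc d c p ⟨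
  d ℚ.* c ℚ.* p        ≡⟨ cong (ℚ._* p) dc≡1 ⟩
  1ℚ ℚ.* p             ≡⟨ ℚₚ.*-identityˡ p ⟩
  p                    ∎
  where
  open ℚₚ.≤-Reasoning
  s^≤ : s ^ℚ suc k ℚ.≤ (c ℚ.* p) ^ℚ suc k
  s^≤ = begin
    s ^ℚ suc k                        ≤⟨ s^≤m ⟩
    m                                 ≤⟨ ≤-scaled-power k c {m} {p ^ℚ suc k} 1≤c (0≤^ (suc k) {p} 0≤p) m≤ ⟩
    c ^ℚ suc k ℚ.* p ^ℚ suc k         ≡⟨ ^-distrib-* c p (suc k) ⟨
    (c ℚ.* p) ^ℚ suc k                ∎

0≤mesh : ∀ n → 0ℚ ℚ.≤ mesh n
0≤mesh n = ℚₚ.<⇒≤ (0<mesh n)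

ι*mesh-^ : ∀ r k → ι (suc r ℕ.^ k) ℚ.* mesh r ^ℚ k ≡ 1ℚ
ι*mesh-^ r k = begin
  ι (suc r ℕ.^ k) ℚ.* mesh r ^ℚ k       ≡⟨ cong (ℚ._* mesh r ^ℚ k) (ι-^ (suc r) k) ⟩
  ι (suc r) ^ℚ k ℚ.* mesh r ^ℚ k        ≡⟨ ^-distrib-* (ι (suc r)) (mesh r) k ⟨
  (ι (suc r) ℚ.* mesh r) ^ℚ k           ≡⟨ cong (_^ℚ k) (ι*mesh r) ⟩
  1ℚ ^ℚ k                               ≡⟨ 1^ k ⟩
  1ℚ                                    ∎
  where open ≡.≡-Reasoning

ι-mono-* : ∀ {m} c n → m ≤ c ℕ.* n → ι m ℚ.≤ ι c ℚ.* ι n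
ι-mono-* {m} c n m≤cn = subst (ι m ℚ.≤_) (ι-* c n) (ι-mono m≤cn)

0<ι : ∀ n → 0ℚ ℚ.< ι (suc n)
0<ι n = ℚₚ.<-≤-trans {0ℚ} {1ℚ} {ι (suc n)} 0<1 (ι-mono {1} {suc n} (s≤s z≤n))

-- The hypothesis says 1/n ≤ 9 (1/q)^(k+1) with q = r + 1. Taking roots, with 9 in place of its
-- root, gives n^(-1/(k+1)) ≤ 9/q; `mesh 8` is 1/9.
1/q≥ : ∀ r k n → suc r ℕ.^ suc k ≤ 9 ℕ.* n → fromℚ (mesh 8) *ᴿ (n ^-1/ suc k) ≤ᴿ fromℚ (mesh r)
1/q≥ r k zero    h ε 0<ε = contradiction h (ℕₚ.<⇒≱ (ℕₚ.m^n>0 (suc r) (suc k)))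
1/q≥ r k (suc n) h ε 0<ε = 0 , λ m _ → ℚₚ.≤-trans {mesh 8 ℚ.* s m} {mesh r} {mesh r ℚ.+ ε}
  (root-≤ k (ι 9) (mesh 8) (s m) (mesh n ℚ.⊔ 0ℚ) (mesh r) (ι-mono {1} {9} (s≤s z≤n)) (0≤mesh 8) (ι*mesh 8) (0≤mesh r)
    (approxRoot-lower k (mesh n ℚ.⊔ 0ℚ) m (ℚₚ.p≤q⊔p (mesh n) 0ℚ))
    (subst (ℚ._≤ ι 9 ℚ.* mesh r ^ℚ suc k) (≡.sym (⊔0 (0≤mesh n)))
      (reciprocal-≤ (ι 9) {ι (suc r ℕ.^ suc k)} {mesh r ^ℚ suc k} {ι (suc n)} {mesh n} (ι*mesh-^ r (suc k)) (ι*mesh n)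
        (0≤^ (suc k) {mesh r} (0≤mesh r)) (0≤mesh n) (ι-mono-* 9 (suc n) h))))
  (≤-+ʳ {mesh r} {ε} (ℚₚ.<⇒≤ 0<ε))
  where
  s = approxRoot (suc k) (mesh n ℚ.⊔ 0ℚ)

1/q≤ : ∀ r k n → suc r ℕ.^ suc k ≤ 9 ℕ.* n → n ≤ 2 ℕ.* suc r ℕ.^ suc k → fromℚ (mesh r) ≤ᴿ fromℕ 2 *ᴿ (n ^-1/ suc k)
1/q≤ r k zero    h _ ε 0<ε = contradiction h (ℕₚ.<⇒≱ (ℕₚ.m^n>0 (suc r) (suc k)))
1/q≤ r k (suc n) _ h = ≤-root k (mesh n) (ι 2) (0<ι 1) (λ _ → mesh r) (λ _ →
  ≤-scaled-power k (ι 2) {mesh r ^ℚ suc k} {mesh n} (ι-mono {1} {2} (s≤s z≤n)) (0≤mesh n)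
    (reciprocal-≤ (ι 2) {ι (suc n)} {mesh n} {ι (suc r ℕ.^ suc k)} {mesh r ^ℚ suc k} (ι*mesh n) (ι*mesh-^ r (suc k))
      (0≤mesh n) (0≤^ (suc k) {mesh r} (0≤mesh r)) (ι-mono-* 2 (suc r ℕ.^ suc k) h)))

half-square-≤ : ∀ s a b → 0ℚ ℚ.≤ a → s ^ℚ 2 ℚ.≤ b → b ℚ.≤ ι 2 ℚ.* a → (½ ℚ.* s) ^ℚ 2 ℚ.≤ 1ℚ ^ℚ 2 ℚ.* a
half-square-≤ s a b 0≤a s²≤b b≤2a = begin
  (½ ℚ.* s) ^ℚ 2                          ≡⟨ ^-distrib-* ½ s 2 ⟩
  ½ ^ℚ 2 ℚ.* s ^ℚ 2                       ≤⟨ mul-monoˡ (½ ^ℚ 2) {s ^ℚ 2} {b} 0≤¼ s²≤b ⟩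
  ½ ^ℚ 2 ℚ.* b                            ≤⟨ mul-monoˡ (½ ^ℚ 2) {b} {ι 2 ℚ.* a} 0≤¼ b≤2a ⟩
  ½ ^ℚ 2 ℚ.* (ι 2 ℚ.* a)                  ≡⟨ ℚₚ.*-assoc (½ ^ℚ 2) (ι 2) a ⟨
  ½ ^ℚ 2 ℚ.* ι 2 ℚ.* a                    ≤⟨ mul-monoʳ a {½ ^ℚ 2 ℚ.* ι 2} {1ℚ ^ℚ 2} 0≤a (ℚ.*≤* (ℤ.+≤+ (s≤s z≤n))) ⟩
  1ℚ ^ℚ 2 ℚ.* a                           ∎
  where
  open ℚₚ.≤-Reasoning
  0≤¼ : 0ℚ ℚ.≤ ½ ^ℚ 2
  0≤¼ = ℚ.*≤* (ℤ.+≤+ z≤n)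

module _ (r k n : ℕ) where

  private
    q = suc r
    p = mesh r
    a = ι (q ℕ.^ k)
    b = ι n ℚ.* p
    0≤a = 0≤ι (q ℕ.^ k)
    0≤b : 0ℚ ℚ.≤ b
    0≤b = 0≤* {ι n} {p} (0≤ι n) (0≤mesh r)
    ι-q^suc : ι (q ℕ.^ suc k) ℚ.* p ≡ a
    ι-q^suc = begin
      ι (q ℕ.^ suc k) ℚ.* p         ≡⟨ cong (ℚ._* p) (ι-* q (q ℕ.^ k)) ⟩
      ι q ℚ.* a ℚ.* p               ≡⟨ solve 3 (λ q a p → q :* a :* p := q :* p :* a) ≡.refl (ι q) a p ⟩
      ι q ℚ.* p ℚ.* a               ≡⟨ cong (ℚ._* a) (ι*mesh r) ⟩
      1ℚ ℚ.* a                      ≡⟨ ℚₚ.*-identityˡ a ⟩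
      a                             ∎
      where
      open ≡.≡-Reasoning
      open +-*-Solver

  open ℚₚ.≤-Reasoning

  -- Here n/q ≤ 2 q^k; the factor ½ is a rational number below the root of ½.
  √-lower : n ≤ 2 ℕ.* suc r ℕ.^ suc k → fromℚ ½ *ᴿ √ (fromℕ n *ᴿ fromℚ (mesh r)) ≤ᴿ √ (fromℕ (suc r ℕ.^ k))
  √-lower h ε 0<ε = proj₁ limit , λ m N≤m →
    subst (λ c → ½ ℚ.* s m ℚ.≤ c ℚ.+ ε) (ℚₚ.*-identityˡ (approxRoot 2 (a ℚ.⊔ 0ℚ) m)) (proj₂ limit m N≤m)
    where
    s = approxRoot 2 (b ℚ.⊔ 0ℚ)
    b≤2a : b ℚ.⊔ 0ℚ ℚ.≤ ι 2 ℚ.* a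
    b≤2a = begin
      b ℚ.⊔ 0ℚ                                  ≡⟨ ⊔0 0≤b ⟩
      ι n ℚ.* p
        ≤⟨ mul-monoʳ p {ι n} {ι 2 ℚ.* ι (q ℕ.^ suc k)} (0≤mesh r) (ι-mono-* 2 (q ℕ.^ suc k) h) ⟩
      ι 2 ℚ.* ι (q ℕ.^ suc k) ℚ.* p             ≡⟨ ℚₚ.*-assoc (ι 2) (ι (q ℕ.^ suc k)) p ⟩
      ι 2 ℚ.* (ι (q ℕ.^ suc k) ℚ.* p)           ≡⟨ cong (ι 2 ℚ.*_) ι-q^suc ⟩
      ι 2 ℚ.* a                                 ∎
    limit = ≤-root 1 a 1ℚ 0<1 (λ m → ½ ℚ.* s m) (λ m →
      half-square-≤ (s m) a (b ℚ.⊔ 0ℚ) 0≤a (approxRoot-lower 1 (b ℚ.⊔ 0ℚ) m (ℚₚ.p≤q⊔p b 0ℚ)) b≤2a) ε 0<ε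

  -- Here q^k ≤ 9 n/q, and 3 is the root of 9.
  √-upper : suc r ℕ.^ suc k ≤ 9 ℕ.* n → √ (fromℕ (suc r ℕ.^ k)) ≤ᴿ fromℕ 3 *ᴿ √ (fromℕ n *ᴿ fromℚ (mesh r))
  √-upper h = ≤-root 1 b (ι 3) (0<ι 2) (approxRoot 2 (a ℚ.⊔ 0ℚ)) (λ m → ℚₚ.≤-trans
    {approxRoot 2 (a ℚ.⊔ 0ℚ) m ^ℚ 2} {a ℚ.⊔ 0ℚ} {ι 3 ^ℚ 2 ℚ.* b}
    (approxRoot-lower 1 (a ℚ.⊔ 0ℚ) m (ℚₚ.p≤q⊔p a 0ℚ)) a≤9b)
    where
    a≤9b : a ℚ.⊔ 0ℚ ℚ.≤ ι 3 ^ℚ 2 ℚ.* b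
    a≤9b = begin
      a ℚ.⊔ 0ℚ                                  ≡⟨ ⊔0 0≤a ⟩
      a                                         ≡⟨ ι-q^suc ⟨
      ι (q ℕ.^ suc k) ℚ.* p
        ≤⟨ mul-monoʳ p {ι (q ℕ.^ suc k)} {ι 9 ℚ.* ι n} (0≤mesh r) (ι-mono-* 9 n h) ⟩
      ι 9 ℚ.* ι n ℚ.* p                         ≡⟨ ℚₚ.*-assoc (ι 9) (ι n) p ⟩
      ι 9 ℚ.* b                                 ∎

-- The jumbledness inequality over the reals

square-∣∣ : ∀ z → ℚ.∣ z ∣ ^ℚ 2 ≡ z ℚ.* z
square-∣∣ z with ℚₚ.∣p∣≡p∨∣p∣≡-p z
... | inj₁ eq = ≡.trans (cong (_^ℚ 2) eq) (solve 1 (λ z → z :* (z :* con 1ℚ) := z :* z) ≡.refl z)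
  where open +-*-Solver
... | inj₂ eq = ≡.trans (cong (_^ℚ 2) eq) (solve 1 (λ z → :- z :* (:- z :* con 1ℚ) := z :* z) ≡.refl z)
  where open +-*-Solver

-- The hypothesis is (m - k)² ≤ k Q. As q z = m - k and Q = q² a, dividing by q² gives the claim.
unscaled-square-≤ : ∀ q p e A B a Q → 0ℚ ℚ.< q → q ℚ.* p ≡ 1ℚ → Q ≡ q ℚ.* (q ℚ.* a) →
  let m = q ℚ.* e ; k = A ℚ.* B ; z = e ℚ.- p ℚ.* A ℚ.* B in
  m ℚ.* m ℚ.+ k ℚ.* k ℚ.≤ k ℚ.* Q ℚ.+ ι 2 ℚ.* (m ℚ.* k) → z ℚ.* z ℚ.≤ a ℚ.* k
unscaled-square-≤ q p e A B a Q 0<q qp≡1 Q≡ h =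
  ℚₚ.*-cancelˡ-≤-pos {z ℚ.* z} {a ℚ.* k} (q ℚ.* q) {{ℚ.positive (0<* {q} {q} 0<q 0<q)}} (begin
    q ℚ.* q ℚ.* (z ℚ.* z)
      ≡⟨ solve 2 (λ q z → q :* q :* (z :* z) := q :* z :* (q :* z)) ≡.refl q z ⟩
    q ℚ.* z ℚ.* (q ℚ.* z)                                         ≡⟨ cong₂ ℚ._*_ qz qz ⟩
    (m ℚ.- k) ℚ.* (m ℚ.- k)
      ≡⟨ solve 2 (λ m k → (m :- k) :* (m :- k) := m :* m :+ k :* k :- con (ι 2) :* (m :* k)) ≡.refl m k ⟩
    m ℚ.* m ℚ.+ k ℚ.* k ℚ.- ι 2 ℚ.* (m ℚ.* k)
      ≤⟨ ℚₚ.+-monoˡ-≤ (ℚ.- (ι 2 ℚ.* (m ℚ.* k))) {m ℚ.* m ℚ.+ k ℚ.* k} {k ℚ.* Q ℚ.+ ι 2 ℚ.* (m ℚ.* k)} h ⟩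
    k ℚ.* Q ℚ.+ ι 2 ℚ.* (m ℚ.* k) ℚ.- ι 2 ℚ.* (m ℚ.* k)
      ≡⟨ solve 2 (λ x y → x :+ y :- y := x) ≡.refl (k ℚ.* Q) (ι 2 ℚ.* (m ℚ.* k)) ⟩
    k ℚ.* Q                                                       ≡⟨ cong (k ℚ.*_) Q≡ ⟩
    k ℚ.* (q ℚ.* (q ℚ.* a))
      ≡⟨ solve 3 (λ k q a → k :* (q :* (q :* a)) := q :* q :* (a :* k)) ≡.refl k q a ⟩
    q ℚ.* q ℚ.* (a ℚ.* k)                                         ∎)
  where
  open ℚₚ.≤-Reasoning
  open +-*-Solver
  m = q ℚ.* e
  k = A ℚ.* B
  z = e ℚ.- p ℚ.* A ℚ.* B
  qz : q ℚ.* z ≡ m ℚ.- k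
  qz = begin-equality
    q ℚ.* z
      ≡⟨ solve 5 (λ q e p A B → q :* (e :- p :* A :* B) := q :* e :- q :* p :* (A :* B)) ≡.refl q e p A B ⟩
    m ℚ.- q ℚ.* p ℚ.* k                   ≡⟨ cong (λ c → m ℚ.- c ℚ.* k) qp≡1 ⟩
    m ℚ.- 1ℚ ℚ.* k                        ≡⟨ cong (λ c → m ℚ.- c) (ℚₚ.*-identityˡ k) ⟩
    m ℚ.- k                               ∎

-- The hypothesis is (qe − AB)² ≤ ABq² · qˢ with the cross term moved to the right.
jumbled-bound : ∀ r s A B e → let q = suc r in
  (q ℕ.* e) ℕ.* (q ℕ.* e) ℕ.+ (A ℕ.* B) ℕ.* (A ℕ.* B) ≤ A ℕ.* B ℕ.* q ℕ.^ (2 ℕ.+ s) ℕ.+ 2 ℕ.* (q ℕ.* e ℕ.* (A ℕ.* B)) →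
  absᴿ (fromℕ e -ᴿ fromℚ (mesh r) *ᴿ fromℕ A *ᴿ fromℕ B) ≤ᴿ √ (fromℕ (q ℕ.^ s)) *ᴿ √ (fromℕ A *ᴿ fromℕ B)
jumbled-bound r s A B e h = ≤-√*√ (a ℚ.⊔ 0ℚ) (b ℚ.⊔ 0ℚ) ℚ.∣ z ∣ (ℚₚ.p≤q⊔p a 0ℚ) (ℚₚ.p≤q⊔p b 0ℚ)
  (subst₂ ℚ._≤_ (≡.sym (square-∣∣ z)) (≡.sym (cong₂ ℚ._*_ (⊔0 (0≤ι (q ℕ.^ s))) (⊔0 (0≤* {ι A} {ι B} (0≤ι A) (0≤ι B)))))
    (unscaled-square-≤ (ι q) p (ι e) (ι A) (ι B) a (ι (q ℕ.^ (2 ℕ.+ s))) (0<ι r) (ι*mesh r)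
      (≡.trans (ι-* q (q ℕ.* q ℕ.^ s)) (cong (ι q ℚ.*_) (ι-* q (q ℕ.^ s)))) hℚ))
  where
  q = suc r
  p = mesh r
  a = ι (q ℕ.^ s)
  b = ι A ℚ.* ι B
  z = ι e ℚ.- p ℚ.* ι A ℚ.* ι B
  m = ι q ℚ.* ι e
  k = ι A ℚ.* ι B
  hℚ : m ℚ.* m ℚ.+ k ℚ.* k ℚ.≤ k ℚ.* ι (q ℕ.^ (2 ℕ.+ s)) ℚ.+ ι 2 ℚ.* (m ℚ.* k)
  hℚ = subst₂ ℚ._≤_
    (≡.trans (ι-+ (q ℕ.* e ℕ.* (q ℕ.* e)) (A ℕ.* B ℕ.* (A ℕ.* B))) (cong₂ ℚ._+_
      (≡.trans (ι-* (q ℕ.* e) (q ℕ.* e)) (cong₂ ℚ._*_ (ι-* q e) (ι-* q e)))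
      (≡.trans (ι-* (A ℕ.* B) (A ℕ.* B)) (cong₂ ℚ._*_ (ι-* A B) (ι-* A B)))))
    (≡.trans (ι-+ (A ℕ.* B ℕ.* q ℕ.^ (2 ℕ.+ s)) (2 ℕ.* (q ℕ.* e ℕ.* (A ℕ.* B)))) (cong₂ ℚ._+_
      (≡.trans (ι-* (A ℕ.* B) (q ℕ.^ (2 ℕ.+ s))) (cong (ℚ._* ι (q ℕ.^ (2 ℕ.+ s))) (ι-* A B)))
      (≡.trans (ι-* 2 (q ℕ.* e ℕ.* (A ℕ.* B))) (cong (ι 2 ℚ.*_) (≡.trans (ι-* (q ℕ.* e) (A ℕ.* B)) (cong₂ ℚ._*_ (ι-* q e) (ι-* A B)))))))
    (ι-mono h)

-- The graphs AK⊠

module _ {q : ℕ} (F : FiniteField q) (q-odd : ¬ 2 ∣ q) where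
  open NormCounts F q-odd

  module _ (t : ℕ) where
    private
      S = X⊠/∼ F t
      n = FiniteSet.card S
      x : Fin n → Vector Carrier t
      x i = proj₁ (FiniteSet.nth S i)
      open Points F q-odd t x (λ i → nonSquare⇒≉0 (proj₂ (FiniteSet.nth S i))) (FiniteSet.nth-injective S)

    card-upper : q-1 ℕ.* n ≤ q ℕ.^ t
    card-upper = points-upper

    card-cover : ∑ (vecs t) (λ v → ⟦ isNonSquare? F q-odd (v ∙ v) ⟧) ≤ q ℕ.* n
    card-cover = points-cover (λ v → isNonSquare? F q-odd (v ∙ v))
      (λ v ns → FiniteSet.index S (v , ns) , FiniteSet.nth-index S (v , ns))

  card-X⊠/∼-lower : ∀ u → q ℕ.^ (1 ℕ.+ u) ≤ 9 ℕ.* FiniteSet.card (X⊠/∼ F (2 ℕ.+ u))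
  card-X⊠/∼-lower u = ℕₚ.*-cancelˡ-≤ q {{ℕ.>-nonZero (ℕₚ.≤-trans (s≤s z≤n) 3≤q)}} (begin
    q ℕ.^ (2 ℕ.+ u)                                                              ≤⟨ nonSquareVectors-lower F q-odd u ⟩
    9 ℕ.* ∑ (vecs (2 ℕ.+ u)) (λ v → ⟦ isNonSquare? F q-odd (v ∙ v) ⟧)
      ≤⟨ ℕₚ.*-monoʳ-≤ 9 (card-cover (2 ℕ.+ u)) ⟩
    9 ℕ.* (q ℕ.* n)                                                              ≡⟨ swap q n ⟩
    q ℕ.* (9 ℕ.* n)                                                              ∎)
    where
    open ℕₚ.≤-Reasoning
    n = FiniteSet.card (X⊠/∼ F (2 ℕ.+ u))
    swap : ∀ q n → 9 ℕ.* (q ℕ.* n) ≡ q ℕ.* (9 ℕ.* n)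
    swap = solve-∀

  -- Each point has q - 1 representatives among q^(2+u) vectors, and q ≤ 2 (q - 1).
  card-X⊠/∼-upper : ∀ u → FiniteSet.card (X⊠/∼ F (2 ℕ.+ u)) ≤ 2 ℕ.* q ℕ.^ (1 ℕ.+ u)
  card-X⊠/∼-upper u = bound 3≤q (card-upper (2 ℕ.+ u))
    where
    bound : ∀ {q n m} → 3 ≤ q → (q ∸ 1) ℕ.* n ≤ q ℕ.* m → n ≤ 2 ℕ.* m
    bound {suc (suc r)} {n} {m} (s≤s (s≤s _)) h = ℕₚ.*-cancelˡ-≤ (suc r) (begin
      suc r ℕ.* n                              ≤⟨ h ⟩
      suc (suc r) ℕ.* m                        ≤⟨ ℕₚ.m≤m+n _ (r ℕ.* m) ⟩
      suc (suc r) ℕ.* m ℕ.+ r ℕ.* m            ≡⟨ collect r m ⟩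
      suc r ℕ.* (2 ℕ.* m)                      ∎)
      where
      open ℕₚ.≤-Reasoning
      collect : ∀ r m → suc (suc r) ℕ.* m ℕ.+ r ℕ.* m ≡ suc r ℕ.* (2 ℕ.* m)
      collect = solve-∀

  module _ (t : ℕ) (G : Graph) (vec : Graph.Vertex G → Vector Carrier t) 
    (nonAbsolute : ∀ u → ¬ vec u ∙ vec u ≈ 0#) (distinct : ∀ {u v} → _∼_ F t (vec u) (vec v) → Graph._≈_ G u v)
    (adjacent⇒ : ∀ {u v} → Graph.Adjacent G u v → vec u ∙ vec v ≈ 0#)
    (⇒adjacent : ∀ {u v} → vec u ∙ vec v ≈ 0# → Graph.Adjacent G u v) where
    private
      open Graph G using (order; vertex; adjacent?)
      n = order
      x : Fin n → Vector Carrier t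
      x i = vec (vertex i)
      x-distinct : ∀ {i j} → _∼_ F t (x i) (x j) → i ≡ j
      x-distinct i∼j = FiniteSet.nth-injective (Graph.vertices G) (distinct i∼j)
      open Points F q-odd t x (λ i → nonAbsolute (vertex i)) x-distinct

    edge-discrepancy : ∀ (X Y : Subset n) → let e = edgeCount G X Y ; A = ∣ X ∣ ; B = ∣ Y ∣ in
      (q ℕ.* e) ℕ.* (q ℕ.* e) ℕ.+ (A ℕ.* B) ℕ.* (A ℕ.* B) ≤ A ℕ.* B ℕ.* q ℕ.^ t ℕ.+ 2 ℕ.* (q ℕ.* e ℕ.* (A ℕ.* B))
    edge-discrepancy X Y = unsquare (q ℕ.* edgeCount G X Y) (∣ X ∣ ℕ.* ∣ Y ∣) (∣ X ∣ ℕ.* ∣ Y ∣ ℕ.* q ℕ.^ t)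
      (transfer (≡.sym (∣∣≡∑ X)) (≡.sym (∣∣≡∑ Y)) (≡.sym e≡)
        (discrepancy (λ i → ⟦ i ∈? X ⟧) (λ i → ⟦⟧-idem (i ∈? X)) (λ j → ⟦ j ∈? Y ⟧) (λ j → ⟦⟧-idem (j ∈? Y))))
      where
      e≡ : edgeCount G X Y ≡ ∑ (allFin n) (λ i → ∑ (allFin n) (λ j → ⟦ i ∈? X ⟧ ℕ.* ⟦ j ∈? Y ⟧ ℕ.* orthogonal i (x j)))
      e≡ = ≡.trans (edgeCount≡∑ G X Y) (∑-cong (allFin n) (λ i → ∑-cong (allFin n) (λ j →
        cong (⟦ i ∈? X ⟧ ℕ.* ⟦ j ∈? Y ⟧ ℕ.*_) (⟦⟧-cong (adjacent? (vertex i) (vertex j)) (x i ∙ x j ≟ 0#) adjacent⇒ ⇒adjacent))))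
      transfer : ∀ {A A′ B B′ e e′} → A ≡ A′ → B ≡ B′ → e ≡ e′ →
        (ℤ.+ (q ℕ.* e) ℤ.- ℤ.+ (A ℕ.* B)) ℤ.* (ℤ.+ (q ℕ.* e) ℤ.- ℤ.+ (A ℕ.* B)) ℤ.≤ ℤ.+ (A ℕ.* B ℕ.* q ℕ.^ t) →
        (ℤ.+ (q ℕ.* e′) ℤ.- ℤ.+ (A′ ℕ.* B′)) ℤ.* (ℤ.+ (q ℕ.* e′) ℤ.- ℤ.+ (A′ ℕ.* B′)) ℤ.≤ ℤ.+ (A′ ℕ.* B′ ℕ.* q ℕ.^ t)
      transfer ≡.refl ≡.refl ≡.refl h = h
      -- The inequality leaves ℤ in a form without subtraction because it enters ℚ through `ι`,
      -- which is defined on ℕ.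
      unsquare : ∀ m k N → (ℤ.+ m ℤ.- ℤ.+ k) ℤ.* (ℤ.+ m ℤ.- ℤ.+ k) ℤ.≤ ℤ.+ N → m ℕ.* m ℕ.+ k ℕ.* k ≤ N ℕ.+ 2 ℕ.* (m ℕ.* k)
      unsquare m k N h = ℤₚ.drop‿+≤+ (begin
        ℤ.+ (m ℕ.* m ℕ.+ k ℕ.* k)
          ≡⟨ ≡.trans (ℤₚ.pos-+ (m ℕ.* m) (k ℕ.* k)) (cong₂ ℤ._+_ (ℤₚ.pos-* m m) (ℤₚ.pos-* k k)) ⟩
        ℤ.+ m ℤ.* ℤ.+ m ℤ.+ ℤ.+ k ℤ.* ℤ.+ k                                                ≡⟨ complete (ℤ.+ m) (ℤ.+ k) ⟩
        (ℤ.+ m ℤ.- ℤ.+ k) ℤ.* (ℤ.+ m ℤ.- ℤ.+ k) ℤ.+ ℤ.+ 2 ℤ.* (ℤ.+ m ℤ.* ℤ.+ k)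
          ≤⟨ ℤₚ.+-monoˡ-≤ (ℤ.+ 2 ℤ.* (ℤ.+ m ℤ.* ℤ.+ k)) h ⟩
        ℤ.+ N ℤ.+ ℤ.+ 2 ℤ.* (ℤ.+ m ℤ.* ℤ.+ k)
          ≡⟨ cong (λ c → ℤ.+ N ℤ.+ ℤ.+ 2 ℤ.* c) (≡.sym (ℤₚ.pos-* m k)) ⟩
        ℤ.+ N ℤ.+ ℤ.+ 2 ℤ.* ℤ.+ (m ℕ.* k)
          ≡⟨ cong (λ c → ℤ.+ N ℤ.+ c) (≡.sym (ℤₚ.pos-* 2 (m ℕ.* k))) ⟩
        ℤ.+ N ℤ.+ ℤ.+ (2 ℕ.* (m ℕ.* k))                                                    ≡⟨ ℤₚ.pos-+ N _ ⟨
        ℤ.+ (N ℕ.+ 2 ℕ.* (m ℕ.* k))                                                        ∎)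
        where
        open ℤₚ.≤-Reasoning
        complete : ∀ m k → m ℤ.* m ℤ.+ k ℤ.* k ≡ (m ℤ.- k) ℤ.* (m ℤ.- k) ℤ.+ ℤ.+ 2 ℤ.* (m ℤ.* k)
        complete = ℤ-Solver.solve-∀

  orthogonality-jumbled : ∀ s (G : Graph) (let open Graph G using (Vertex; Adjacent))
    (vec : Vertex → Vector Carrier (2 ℕ.+ s)) → (∀ u → ¬ vec u ∙ vec u ≈ 0#) → (∀ {u v} → _∼_ F (2 ℕ.+ s) (vec u) (vec v) → Graph._≈_ G u v) →
    (∀ {u v} → Adjacent u v → vec u ∙ vec v ≈ 0#) → (∀ {u v} → vec u ∙ vec v ≈ 0# → Adjacent u v) →
    Jumbled G (fromℚ (mesh (q ∸ 1))) (√ (fromℕ (q ℕ.^ s)))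
  orthogonality-jumbled s G vec nonAbsolute distinct adjacent⇒ ⇒adjacent =
    fromℚ-mono (0≤mesh (q ∸ 1)) , fromℚ-mono (mesh≤1 (q ∸ 1)) , 0≤√ (fromℕ (q ℕ.^ s)) , λ X Y →
    bound 1+q-1 ∣ X ∣ ∣ Y ∣ (edgeCount G X Y)
      (edge-discrepancy (2 ℕ.+ s) G vec nonAbsolute distinct (λ {u} {v} → adjacent⇒ {u} {v}) (λ {u} {v} → ⇒adjacent {u} {v}) X Y)
    where
    -- As `mesh r` is 1/(r + 1), the density 1/q is `mesh (q ∸ 1)`; matching on the equation puts q
    -- in the form suc r.
    bound : ∀ {r q} → suc r ≡ q → ∀ A B e →
      (q ℕ.* e) ℕ.* (q ℕ.* e) ℕ.+ (A ℕ.* B) ℕ.* (A ℕ.* B) ≤ A ℕ.* B ℕ.* q ℕ.^ (2 ℕ.+ s) ℕ.+ 2 ℕ.* (q ℕ.* e ℕ.* (A ℕ.* B)) →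
      absᴿ (fromℕ e -ᴿ fromℚ (mesh r) *ᴿ fromℕ A *ᴿ fromℕ B) ≤ᴿ √ (fromℕ (q ℕ.^ s)) *ᴿ √ (fromℕ A *ᴿ fromℕ B)
    bound {r} ≡.refl = jumbled-bound r s

  AK⊠-jumbled : ∀ s → Jumbled (AK⊠ F (2 ℕ.+ s)) (fromℚ (mesh (q ∸ 1))) (√ (fromℕ (q ℕ.^ s)))
  AK⊠-jumbled s = orthogonality-jumbled s (AK⊠ F (2 ℕ.+ s)) (λ u → proj₁ (proj₁ (proj₁ u)))
    (λ u → proj₂ (proj₁ u)) (λ e → e) (λ e → e) (λ e → e)

  AK⊠-completeFree-odd : ∀ t k → t ≡ 1 ℕ.+ k ℕ.* 2 → CompleteFree (AK⊠ F t) t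
  AK⊠-completeFree-odd _ k ≡.refl = AK⊠-completeFree F q-odd k

odd-form : ∀ t → ¬ 2 ∣ t → ∃ λ k → t ≡ 1 ℕ.+ k ℕ.* 2
odd-form 0             t-odd = contradiction (2 ∣0) t-odd
odd-form 1             t-odd = 0 , ≡.refl
odd-form (suc (suc t)) t-odd =
  let (k , t≡) = odd-form t (λ { (divides c t≡c*2) → t-odd (divides (suc c) (cong (2 ℕ.+_) t≡c*2)) })
  in suc k , cong (2 ℕ.+_) t≡

density-bounds : ∀ r q s n → suc r ≡ q → q ℕ.^ (1 ℕ.+ s) ≤ 9 ℕ.* n → n ≤ 2 ℕ.* q ℕ.^ (1 ℕ.+ s) →
  fromℚ (mesh 8) *ᴿ (n ^-1/ (2 ℕ.+ s ∸ 1)) ≤ᴿ fromℚ (mesh r) × fromℚ (mesh r) ≤ᴿ fromℕ 2 *ᴿ (n ^-1/ (2 ℕ.+ s ∸ 1))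
density-bounds r _ s n ≡.refl l u = 1/q≥ r s n l , 1/q≤ r s n l u

scale-bounds : ∀ r q s n → suc r ≡ q → q ℕ.^ (1 ℕ.+ s) ≤ 9 ℕ.* n → n ≤ 2 ℕ.* q ℕ.^ (1 ℕ.+ s) →
  fromℚ ½ *ᴿ √ (fromℕ n *ᴿ fromℚ (mesh r)) ≤ᴿ √ (fromℕ (q ℕ.^ s)) ×
  √ (fromℕ (q ℕ.^ s)) ≤ᴿ fromℕ 3 *ᴿ √ (fromℕ n *ᴿ fromℚ (mesh r))
scale-bounds r _ s n ≡.refl l u = √-lower r s n u , √-upper r s n l

module _ (s : ℕ) where
  open OddFiniteField
  open RationalLemmas using (0<mesh)

  density-Θ : (λ K → fromℚ (mesh (q K ∸ 1))) =Θ (λ K → FiniteSet.card (X⊠/∼ (𝔽 K) (2 ℕ.+ s)) ^-1/ (2 ℕ.+ s ∸ 1))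
  density-Θ = fromℚ (mesh 8) , fromℕ 2 , fromℚ-pos (0<mesh 8) , fromℚ-pos (0<ι 1) , λ K →
    density-bounds (q K ∸ 1) (q K) s (FiniteSet.card (X⊠/∼ (𝔽 K) (2 ℕ.+ s))) (NormCounts.1+q-1 (𝔽 K) (odd K))
      (card-X⊠/∼-lower (𝔽 K) (odd K) s) (card-X⊠/∼-upper (𝔽 K) (odd K) s)

  scale-Θ : (λ K → √ (fromℕ (q K ℕ.^ s))) =Θ (λ K → √ (fromℕ (FiniteSet.card (X⊠/∼ (𝔽 K) (2 ℕ.+ s))) *ᴿ fromℚ (mesh (q K ∸ 1))))
  scale-Θ = fromℚ ½ , fromℕ 3 , fromℚ-pos (ℚₚ.positive⁻¹ ½) , fromℚ-pos (0<ι 2) , λ K →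
    scale-bounds (q K ∸ 1) (q K) s (FiniteSet.card (X⊠/∼ (𝔽 K) (2 ℕ.+ s))) (NormCounts.1+q-1 (𝔽 K) (odd K))
      (card-X⊠/∼-lower (𝔽 K) (odd K) s) (card-X⊠/∼-upper (𝔽 K) (odd K) s)

-- A predicate on the dimension, so that the result for 2 + s, where the exponent t - 2 is simply s,
-- can be transported to t.
Conclusion : ℕ → Set₁
Conclusion t = ∃₂ λ (p α : OddFiniteField → ℝ) →
    (∀ K → let G = AK⊠ (OddFiniteField.𝔽 K) t in
    CompleteFree G t × Jumbled G (p K) (α K))
    × p =Θ (λ K → FiniteSet.card (X⊠/∼ (OddFiniteField.𝔽 K) t) ^-1/ (t ∸ 1))
    × α =Θ (λ K → √ (fromℕ (FiniteSet.card (X⊠/∼ (OddFiniteField.𝔽 K) t)) *ᴿ p K))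

conclusion : ∀ s k → 2 ℕ.+ s ≡ 1 ℕ.+ k ℕ.* 2 → Conclusion (2 ℕ.+ s)
conclusion s k t≡ = (λ K → fromℚ (mesh (q K ∸ 1))) , (λ K → √ (fromℕ (q K ℕ.^ s)))
  , (λ K → AK⊠-completeFree-odd (𝔽 K) (odd K) (2 ℕ.+ s) k t≡ , AK⊠-jumbled (𝔽 K) (odd K) s)
  , density-Θ s , scale-Θ s
  where open OddFiniteField

theorem4p3 : ∀ (t : ℕ) → 3 ≤ t → ¬ 2 ∣ t →
    ∃₂ λ (p α : OddFiniteField → ℝ) →
    (∀ K → let G = AK⊠ (OddFiniteField.𝔽 K) t in
    CompleteFree G t × Jumbled G (p K) (α K))
    × p =Θ (λ K → FiniteSet.card (X⊠/∼ (OddFiniteField.𝔽 K) t) ^-1/ (t ∸ 1))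
    × α =Θ (λ K → √ (fromℕ (FiniteSet.card (X⊠/∼ (OddFiniteField.𝔽 K) t)) *ᴿ p K))
theorem4p3 t 3≤t t-odd = subst Conclusion 2+[t∸2]≡t (conclusion (t ∸ 2) (proj₁ t-form) (≡.trans 2+[t∸2]≡t (proj₂ t-form)))
  where
  2+[t∸2]≡t = ℕₚ.m+[n∸m]≡n (ℕₚ.<⇒≤ 3≤t)
  t-form = odd-form t t-odd
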